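{- Let $m,n\ge 1$ be integers, let $r\in\mathbb{Z}/n\mathbb{Z}$, and let $\lambda=(\lambda_1\ge\cdots\ge\lambda_m\ge0)$ be a partition with at most $m$ parts. Let $\delta=(m-1,m-2,\ldots,1,0)$. Then $$s_\lambda^{(r)}(\mathbf{x}_1,\ldots,\mathbf{x}_m)=\frac{b_{\lambda+\delta}^{(r)}}{b_\delta^{(r)}}=\frac{b_{\lambda+\delta}^{(r)}}{\prod_{1\le i<j\le m}(\pi_i-\pi_j)}.$$
   Context: Fix integers $m,n\ge 1$. For $i\in\{1,\dots,m\}$ and $j\in\mathbb{Z}/n\mathbb{Z}$ let $x_i^{(j)}$ be an indeterminate, and work in the field $\mathbb{Q}(x_i^{(j)})$ of rational functions in these $mn$ indeterminates. All superscripts in parentheses are read modulo $n$. Write $\mathbf{x}_i=(x_i^{(1)},\dots,x_i^{(n)})$ and $\pi_i=x_i^{(1)}x_i^{(2)}\cdots x_i^{(n)}$. **Loop Schur functions.** Boxes of a Young diagram are indexed by (row, column) $=(i,j)$ with $i,j\ge1$. A semistandard tableau $T$ of shape $\lambda$ is a filling of the Young diagram of $\lambda$ with positive integers that is weakly increasing along rows and strictly increasing down columns. For $r\in\mathbb{Z}/n\mathbb{Z}$ define $$s_\lambda^{(r)}(\mathbf{x}_1,\dots,\mathbf{x}_m)=\sum_T\ \prod_{(i,j)\in\lambda} x_{T(i,j)}^{(r+i-j)},$$ the sum being over semistandard tableaux $T$ of shape $\lambda$ with entries in $\{1,\dots,m\}$; $s_\emptyset^{(r)}=1$. **The polynomials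 $\sigma_k^{(r)}$.** For $k\ge1$, $r\in\mathbb{Z}/n\mathbb{Z}$ and $1\le a\le b\le m$, let $$\sigma_k^{(r)}(\mathbf{x}_a,\ldots,\mathbf{x}_b)=\sum x_{i_1}^{(r)}x_{i_2}^{(r-1)}\cdots x_{i_k}^{(r-k+1)},$$ where the sum is over weakly increasing sequences $a\le i_1\le\cdots\le i_k\le b$ such that each of the numbers $a+1,a+2,\ldots,b$ appears in the sequence at most $n-1$ times (there is no restriction on the number of times $a$ appears). Set $\sigma_0^{(r)}=1$. **The determinants $b_\alpha^{(r)}$.** For a sequence $\alpha=(\alpha_1,\dots,\alpha_m)$ of non-negative integers, let $B_\alpha^{(r)}$ be the $m\times m$ matrix with entries $$(B_\alpha^{(r)})_{ij}=x_j^{(r+j-1)}x_j^{(r+j-2)}\cdots x_j^{(r+j-\alpha_i)}\;\sigma_{(n-1)(m-j)}^{(r+j-\alpha_i-1)}(\mathbf{x}_j,\ldots,\mathbf{x}_m)$$ (the product of $x_j$'s has $\alpha_i$ factors and equals $1$ if $\alpha_i=0$), and let $b_\alpha^{(r)}=\det(B_\alpha^{(r)})$. Addition $\lambda+\delta$ is componentwise. -}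

module Defs where

open import Algebra.Apartness.Bundles using (HeytingField)
open import Algebra.Bundles using (AbelianGroup; CommutativeRing)
import Algebra.Properties.CommutativeMonoid.Sum as FiniteSum
import Algebra.Properties.CommutativeSemigroup as CommutativeSemigroupProperties
import Algebra.Properties.Group as GroupProperties
import Algebra.Properties.Ring as RingProperties
import Algebra.Solver.Ring.NaturalCoefficients.Default as Solver
open import Data.Fin using (Fin; zero; suc; toℕ; fromℕ<; combine; punchIn)
import Data.Fin as Fin
open import Data.Fin.Properties using (all?; _≟_; _≤?_; _<?_)
open import Data.Integer as ℤ using (ℤ; +_; _⊖_; _%ℕ_)
open import Data.Integer.DivMod using (n%ℕd<d)
open import Data.List using (List; []; _∷_; map; foldr; filter; length; allFin; cartesianProduct; cartesianProductWith)
open import Data.Nat as ℕ using (ℕ; zero; suc; NonZero; _∸_)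
open import Data.Product using (_×_; _,_)
import Data.Rational as ℚ
import Data.Rational.Properties as ℚ
open import Data.Sum as Sum using (_⊎_; inj₁; inj₂; fromInj₂)
open import Data.Vec.Functional using (Vector)
open import Function using (_∘_)
open import Level using (0ℓ)
open import Relation.Binary using (IsEquivalence; Decidable; DecSetoid)
import Relation.Binary.Properties.DecSetoid as DecSetoidProperties
open import Relation.Binary.PropositionalEquality as ≡ using (_≡_)
import Relation.Binary.Reasoning.Setoid as SetoidReasoning
open import Relation.Nullary using (¬_; yes; no; contradiction)
open import Relation.Nullary.Decidable using (map′; _×-dec_; _→-dec_)
open import Relation.Unary using () renaming (Decidable to Decidable₁)

record DiscreteDomain : Set₁ where
  field
    commutativeRing : CommutativeRing 0ℓ 0ℓ
  open CommutativeRing commutativeRing public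
  field
    _≈?_           : Decidable _≈_
    1≉0            : ¬ 1# ≈ 0#
    noZeroDivisors : ∀ x y → x * y ≈ 0# → x ≈ 0# ⊎ y ≈ 0#

ℚ-domain : DiscreteDomain
ℚ-domain = record
  { commutativeRing = ℚ.+-*-commutativeRing
  ; _≈?_            = ℚ._≟_
  ; 1≉0             = λ ()
  ; noZeroDivisors  = noZeroDivisors
  }
  where
  open ≡.≡-Reasoning
  noZeroDivisors : ∀ p q → p ℚ.* q ≡ ℚ.0ℚ → p ≡ ℚ.0ℚ ⊎ q ≡ ℚ.0ℚ
  noZeroDivisors p q pq≡0 with p ℚ.≟ ℚ.0ℚ
  ... | yes p≡0 = inj₁ p≡0
  ... | no  p≢0 = inj₂ (begin
    q                    ≡⟨ ℚ.*-identityˡ q ⟨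
    ℚ.1ℚ ℚ.* q           ≡⟨ ≡.cong (ℚ._* q) (ℚ.*-inverseˡ p) ⟨
    (ℚ.1/ p ℚ.* p) ℚ.* q ≡⟨ ℚ.*-assoc (ℚ.1/ p) p q ⟩
    ℚ.1/ p ℚ.* (p ℚ.* q) ≡⟨ ≡.cong (ℚ.1/ p ℚ.*_) pq≡0 ⟩
    ℚ.1/ p ℚ.* ℚ.0ℚ      ≡⟨ ℚ.*-zeroʳ (ℚ.1/ p) ⟩
    ℚ.0ℚ                 ∎)
    where instance _ = ℚ.≢-nonZero p≢0

-- Univariate polynomials: coefficient lists, constant term first; trailing
-- zeros are ignored by _≋_.
module Polynomial (D : DiscreteDomain) where
  private module D = DiscreteDomain D
  open D using (Carrier; _≈_; 0#; 1#)

  Poly : Set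
  Poly = List Carrier

  coeff : Poly → ℕ → Carrier
  coeff []      k       = 0#
  coeff (a ∷ p) zero    = a
  coeff (a ∷ p) (suc k) = coeff p k

  infix 4 _≋_
  record _≋_ (p q : Poly) : Set where
    constructor coeffwise
    field at : ∀ k → coeff p k ≈ coeff q k
  open _≋_ public

  infixl 6 _⊕_
  infixl 7 _⊗_ _⊙_

  _⊕_ : Poly → Poly → Poly
  []      ⊕ q       = q
  (a ∷ p) ⊕ []      = a ∷ p
  (a ∷ p) ⊕ (b ∷ q) = (a D.+ b) ∷ (p ⊕ q)

  _⊙_ : Carrier → Poly → Poly
  a ⊙ p = map (a D.*_) p

  _⊗_ : Poly → Poly → Poly
  []      ⊗ q = []
  (a ∷ p) ⊗ q = (a ⊙ q) ⊕ (0# ∷ (p ⊗ q))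

  negate : Poly → Poly
  negate = map (λ a → D.- a)

  private
    open RingProperties D.ring using (-0#≈0#)

    ≋-refl : ∀ {p} → p ≋ p
    ≋-refl = coeffwise λ k → D.refl

    ≋-sym : ∀ {p q} → p ≋ q → q ≋ p
    ≋-sym e = coeffwise λ k → D.sym (at e k)

    ≋-trans : ∀ {p q r} → p ≋ q → q ≋ r → p ≋ r
    ≋-trans e f = coeffwise λ k → D.trans (at e k) (at f k)

    ∷-cong : ∀ {a b p q} → a ≈ b → p ≋ q → a ∷ p ≋ b ∷ q
    ∷-cong e f = coeffwise λ { zero → e ; (suc k) → at f k }

    ∷-tail : ∀ {a b p q} → a ∷ p ≋ b ∷ q → p ≋ q
    ∷-tail e = coeffwise λ k → at e (suc k)

    ∷-tail₀ : ∀ {a p} → a ∷ p ≋ [] → p ≋ []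
    ∷-tail₀ e = coeffwise λ k → at e (suc k)

    0∷ : ∀ {a p} → a ≈ 0# → p ≋ [] → a ∷ p ≋ []
    0∷ e f = coeffwise λ { zero → e ; (suc k) → at f k }

    coeff-⊕ : ∀ p q k → coeff (p ⊕ q) k ≈ coeff p k D.+ coeff q k
    coeff-⊕ []      q       k       = D.sym (D.+-identityˡ _)
    coeff-⊕ (a ∷ p) []      k       = D.sym (D.+-identityʳ _)
    coeff-⊕ (a ∷ p) (b ∷ q) zero    = D.refl
    coeff-⊕ (a ∷ p) (b ∷ q) (suc k) = coeff-⊕ p q k

    coeff-⊙ : ∀ a p k → coeff (a ⊙ p) k ≈ a D.* coeff p k
    coeff-⊙ a []      k       = D.sym (D.zeroʳ a)
    coeff-⊙ a (b ∷ p) zero    = D.refl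
    coeff-⊙ a (b ∷ p) (suc k) = coeff-⊙ a p k

    coeff-negate : ∀ p k → coeff (negate p) k ≈ D.- coeff p k
    coeff-negate []      k       = D.sym -0#≈0#
    coeff-negate (b ∷ p) zero    = D.refl
    coeff-negate (b ∷ p) (suc k) = coeff-negate p k

    ⊕-cong : ∀ {p p′ q q′} → p ≋ p′ → q ≋ q′ → p ⊕ q ≋ p′ ⊕ q′
    ⊕-cong {p} {p′} {q} {q′} e f = coeffwise λ k →
      D.trans (coeff-⊕ p q k) (D.trans (D.+-cong (at e k) (at f k)) (D.sym (coeff-⊕ p′ q′ k)))

    ⊕-assoc : ∀ p q r → (p ⊕ q) ⊕ r ≋ p ⊕ (q ⊕ r)
    ⊕-assoc p q r = coeffwise λ k → begin
      coeff ((p ⊕ q) ⊕ r) k                     ≈⟨ coeff-⊕ (p ⊕ q) r k ⟩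
      coeff (p ⊕ q) k D.+ coeff r k             ≈⟨ D.+-congʳ (coeff-⊕ p q k) ⟩
      (coeff p k D.+ coeff q k) D.+ coeff r k   ≈⟨ D.+-assoc _ _ _ ⟩
      coeff p k D.+ (coeff q k D.+ coeff r k)   ≈⟨ D.+-congˡ (coeff-⊕ q r k) ⟨
      coeff p k D.+ coeff (q ⊕ r) k             ≈⟨ coeff-⊕ p (q ⊕ r) k ⟨
      coeff (p ⊕ (q ⊕ r)) k                     ∎
      where open SetoidReasoning D.setoid

    ⊕-comm : ∀ p q → p ⊕ q ≋ q ⊕ p
    ⊕-comm p q = coeffwise λ k →
      D.trans (coeff-⊕ p q k) (D.trans (D.+-comm _ _) (D.sym (coeff-⊕ q p k)))

    ⊕-identityʳ : ∀ p → p ⊕ [] ≋ p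
    ⊕-identityʳ p = ⊕-comm p []

    negate-cong : ∀ {p q} → p ≋ q → negate p ≋ negate q
    negate-cong {p} {q} e = coeffwise λ k →
      D.trans (coeff-negate p k) (D.trans (D.-‿cong (at e k)) (D.sym (coeff-negate q k)))

    negate-inverseʳ : ∀ p → p ⊕ negate p ≋ []
    negate-inverseʳ p = coeffwise λ k →
      D.trans (coeff-⊕ p (negate p) k)
        (D.trans (D.+-congˡ (coeff-negate p k)) (D.-‿inverseʳ _))

    negate-inverseˡ : ∀ p → negate p ⊕ p ≋ []
    negate-inverseˡ p = ≋-trans (⊕-comm (negate p) p) (negate-inverseʳ p)

    ≋-isEquivalence : IsEquivalence _≋_
    ≋-isEquivalence = record { refl = ≋-refl ; sym = ≋-sym ; trans = ≋-trans }

    ⊕-abelianGroup : AbelianGroup 0ℓ 0ℓ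
    ⊕-abelianGroup = record
      { Carrier = Poly ; _≈_ = _≋_ ; _∙_ = _⊕_ ; ε = [] ; _⁻¹ = negate
      ; isAbelianGroup = record
        { isGroup = record
          { isMonoid = record
            { isSemigroup = record
              { isMagma = record { isEquivalence = ≋-isEquivalence ; ∙-cong = ⊕-cong }
              ; assoc = ⊕-assoc }
            ; identity = (λ _ → ≋-refl) , ⊕-identityʳ }
          ; inverse = negate-inverseˡ , negate-inverseʳ
          ; ⁻¹-cong = negate-cong }
        ; comm = ⊕-comm } }

    module G = AbelianGroup ⊕-abelianGroup
    open CommutativeSemigroupProperties G.commutativeSemigroup using (interchange; x∙yz≈y∙xz)
    open SetoidReasoning G.setoid

    ⊙-cong : ∀ {a b p q} → a ≈ b → p ≋ q → a ⊙ p ≋ b ⊙ q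
    ⊙-cong {a} {b} {p} {q} e f = coeffwise λ k →
      D.trans (coeff-⊙ a p k) (D.trans (D.*-cong e (at f k)) (D.sym (coeff-⊙ b q k)))

    0⊙ : ∀ {a} p → a ≈ 0# → a ⊙ p ≋ []
    0⊙ {a} p e = coeffwise λ k → D.trans (coeff-⊙ a p k) (D.trans (D.*-congʳ e) (D.zeroˡ _))

    1⊙ : ∀ p → 1# ⊙ p ≋ p
    1⊙ p = coeffwise λ k → D.trans (coeff-⊙ 1# p k) (D.*-identityˡ _)

    ⊙-⊕ : ∀ a p q → a ⊙ (p ⊕ q) ≋ (a ⊙ p) ⊕ (a ⊙ q)
    ⊙-⊕ a p q = coeffwise λ k →
      D.trans (coeff-⊙ a (p ⊕ q) k) (D.trans (D.*-congˡ (coeff-⊕ p q k))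
        (D.trans (D.distribˡ _ _ _) (D.sym (D.trans (coeff-⊕ (a ⊙ p) (a ⊙ q) k)
          (D.+-cong (coeff-⊙ a p k) (coeff-⊙ a q k))))))

    ⊙-⊙ : ∀ a b p → (a D.* b) ⊙ p ≋ a ⊙ (b ⊙ p)
    ⊙-⊙ a b p = coeffwise λ k →
      D.trans (coeff-⊙ (a D.* b) p k) (D.trans (D.*-assoc _ _ _)
        (D.sym (D.trans (coeff-⊙ a (b ⊙ p) k) (D.*-congˡ (coeff-⊙ b p k)))))

    0∷-⊕ : ∀ p q → 0# ∷ (p ⊕ q) ≋ (0# ∷ p) ⊕ (0# ∷ q)
    0∷-⊕ p q = ∷-cong (D.sym (D.+-identityˡ 0#)) ≋-refl

    ⊗-zeroʳ : ∀ p → p ⊗ [] ≋ []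
    ⊗-zeroʳ []      = ≋-refl
    ⊗-zeroʳ (a ∷ p) = 0∷ D.refl (⊗-zeroʳ p)

    ⊗-∷ : ∀ p b q → p ⊗ (b ∷ q) ≋ (b ⊙ p) ⊕ (0# ∷ (p ⊗ q))
    ⊗-∷ []      b q = ≋-sym (0∷ D.refl ≋-refl)
    ⊗-∷ (a ∷ p) b q = ∷-cong (D.+-congʳ (D.*-comm a b)) (begin
      (a ⊙ q) ⊕ (p ⊗ (b ∷ q))              ≈⟨ G.∙-congˡ (⊗-∷ p b q) ⟩
      (a ⊙ q) ⊕ ((b ⊙ p) ⊕ (0# ∷ (p ⊗ q))) ≈⟨ x∙yz≈y∙xz (a ⊙ q) (b ⊙ p) _ ⟩
      (b ⊙ p) ⊕ ((a ⊙ q) ⊕ (0# ∷ (p ⊗ q))) ∎)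

    ⊗-comm : ∀ p q → p ⊗ q ≋ q ⊗ p
    ⊗-comm []      q = ≋-sym (⊗-zeroʳ q)
    ⊗-comm (a ∷ p) q = begin
      (a ⊙ q) ⊕ (0# ∷ (p ⊗ q)) ≈⟨ G.∙-congˡ {a ⊙ q} (∷-cong D.refl (⊗-comm p q)) ⟩
      (a ⊙ q) ⊕ (0# ∷ (q ⊗ p)) ≈⟨ ⊗-∷ q a p ⟨
      q ⊗ (a ∷ p)              ∎

    ⊗-congˡ : ∀ p {q q′} → q ≋ q′ → p ⊗ q ≋ p ⊗ q′
    ⊗-congˡ []      e = ≋-refl
    ⊗-congˡ (a ∷ p) e = G.∙-cong (⊙-cong D.refl e) (∷-cong D.refl (⊗-congˡ p e))

    ⊗-cong : ∀ {p p′ q q′} → p ≋ p′ → q ≋ q′ → p ⊗ q ≋ p′ ⊗ q′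
    ⊗-cong {p} {p′} {q} {q′} e f = begin
      p  ⊗ q  ≈⟨ ⊗-congˡ p f ⟩
      p  ⊗ q′ ≈⟨ ⊗-comm p q′ ⟩
      q′ ⊗ p  ≈⟨ ⊗-congˡ q′ e ⟩
      q′ ⊗ p′ ≈⟨ ⊗-comm q′ p′ ⟩
      p′ ⊗ q′ ∎

    ⊗-distribˡ : ∀ p q r → p ⊗ (q ⊕ r) ≋ (p ⊗ q) ⊕ (p ⊗ r)
    ⊗-distribˡ []      q r = ≋-refl
    ⊗-distribˡ (a ∷ p) q r = begin
      (a ⊙ (q ⊕ r)) ⊕ (0# ∷ (p ⊗ (q ⊕ r)))
        ≈⟨ G.∙-cong (⊙-⊕ a q r) (∷-cong D.refl (⊗-distribˡ p q r)) ⟩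
      ((a ⊙ q) ⊕ (a ⊙ r)) ⊕ (0# ∷ ((p ⊗ q) ⊕ (p ⊗ r)))
        ≈⟨ G.∙-congˡ {(a ⊙ q) ⊕ (a ⊙ r)} (0∷-⊕ (p ⊗ q) (p ⊗ r)) ⟩
      ((a ⊙ q) ⊕ (a ⊙ r)) ⊕ ((0# ∷ (p ⊗ q)) ⊕ (0# ∷ (p ⊗ r)))
        ≈⟨ interchange (a ⊙ q) (a ⊙ r) (0# ∷ (p ⊗ q)) (0# ∷ (p ⊗ r)) ⟩
      ((a ∷ p) ⊗ q) ⊕ ((a ∷ p) ⊗ r) ∎

    ⊗-distribʳ : ∀ r p q → (p ⊕ q) ⊗ r ≋ (p ⊗ r) ⊕ (q ⊗ r)
    ⊗-distribʳ r p q = begin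
      (p ⊕ q) ⊗ r       ≈⟨ ⊗-comm (p ⊕ q) r ⟩
      r ⊗ (p ⊕ q)       ≈⟨ ⊗-distribˡ r p q ⟩
      (r ⊗ p) ⊕ (r ⊗ q) ≈⟨ G.∙-cong (⊗-comm r p) (⊗-comm r q) ⟩
      (p ⊗ r) ⊕ (q ⊗ r) ∎

    ⊙-⊗ : ∀ a p q → (a ⊙ p) ⊗ q ≋ a ⊙ (p ⊗ q)
    ⊙-⊗ a []      q = ≋-refl
    ⊙-⊗ a (b ∷ p) q = begin
      ((a D.* b) ⊙ q) ⊕ (0# ∷ ((a ⊙ p) ⊗ q))
        ≈⟨ G.∙-cong (⊙-⊙ a b q) (∷-cong (D.sym (D.zeroʳ a)) (⊙-⊗ a p q)) ⟩
      (a ⊙ (b ⊙ q)) ⊕ (a ⊙ (0# ∷ (p ⊗ q)))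
        ≈⟨ ⊙-⊕ a (b ⊙ q) (0# ∷ (p ⊗ q)) ⟨
      a ⊙ ((b ⊙ q) ⊕ (0# ∷ (p ⊗ q))) ∎

    0∷-⊗ : ∀ {a} p q → a ≈ 0# → (a ∷ p) ⊗ q ≋ 0# ∷ (p ⊗ q)
    0∷-⊗ p q e = G.∙-congʳ {0# ∷ (p ⊗ q)} (0⊙ q e)

    ⊗-assoc : ∀ p q r → (p ⊗ q) ⊗ r ≋ p ⊗ (q ⊗ r)
    ⊗-assoc []      q r = ≋-refl
    ⊗-assoc (a ∷ p) q r = begin
      ((a ⊙ q) ⊕ (0# ∷ (p ⊗ q))) ⊗ r
        ≈⟨ ⊗-distribʳ r (a ⊙ q) (0# ∷ (p ⊗ q)) ⟩
      ((a ⊙ q) ⊗ r) ⊕ ((0# ∷ (p ⊗ q)) ⊗ r)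
        ≈⟨ G.∙-cong (⊙-⊗ a q r) (0∷-⊗ (p ⊗ q) r D.refl) ⟩
      (a ⊙ (q ⊗ r)) ⊕ (0# ∷ ((p ⊗ q) ⊗ r))
        ≈⟨ G.∙-congˡ {a ⊙ (q ⊗ r)} (∷-cong D.refl (⊗-assoc p q r)) ⟩
      (a ⊙ (q ⊗ r)) ⊕ (0# ∷ (p ⊗ (q ⊗ r))) ∎

    ⊗-identityˡ : ∀ p → (1# ∷ []) ⊗ p ≋ p
    ⊗-identityˡ p = begin
      (1# ⊙ p) ⊕ (0# ∷ []) ≈⟨ G.∙-cong (1⊙ p) (0∷ D.refl ≋-refl) ⟩
      p ⊕ []               ≈⟨ ⊕-identityʳ p ⟩
      p                    ∎

    ⊗-identityʳ : ∀ p → p ⊗ (1# ∷ []) ≋ p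
    ⊗-identityʳ p = ≋-trans (⊗-comm p (1# ∷ [])) (⊗-identityˡ p)

    _≋?_ : Decidable _≋_
    []      ≋? []      = yes ≋-refl
    []      ≋? (b ∷ q) = map′ (λ { (e , f) → ≋-sym (0∷ e f) }) (λ e → D.sym (at e 0) , ∷-tail₀ (≋-sym e))
                           ((b D.≈? 0#) ×-dec map′ ≋-sym ≋-sym ([] ≋? q))
    (a ∷ p) ≋? []      = map′ (λ { (e , f) → 0∷ e f }) (λ e → at e 0 , ∷-tail₀ e)
                           ((a D.≈? 0#) ×-dec (p ≋? []))
    (a ∷ p) ≋? (b ∷ q) = map′ (λ { (e , f) → ∷-cong e f }) (λ e → at e 0 , ∷-tail e)
                           ((a D.≈? b) ×-dec (p ≋? q))

    ⊗-cancelˡ : ∀ {a} p q → ¬ a ≈ 0# → (a ∷ p) ⊗ q ≋ [] → q ≋ []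
    ⊗-cancelˡ     p []      a≉0 e = ≋-refl
    ⊗-cancelˡ {a} p (b ∷ q) a≉0 e = 0∷ b≈0 (⊗-cancelˡ p q a≉0 (∷-tail₀ (begin
      0# ∷ ((a ∷ p) ⊗ q)                   ≈⟨ G.∙-congʳ {0# ∷ ((a ∷ p) ⊗ q)} (0⊙ (a ∷ p) b≈0) ⟨
      (b ⊙ (a ∷ p)) ⊕ (0# ∷ ((a ∷ p) ⊗ q)) ≈⟨ ⊗-∷ (a ∷ p) b q ⟨
      (a ∷ p) ⊗ (b ∷ q)                    ≈⟨ e ⟩
      []                                   ∎)))
      where
      b≈0 : b ≈ 0#
      b≈0 = fromInj₂ (λ a≈0 → contradiction a≈0 a≉0)
        (D.noZeroDivisors a b (D.trans (D.sym (D.+-identityʳ (a D.* b))) (at e 0)))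

    ⊗-noZeroDivisors : ∀ p q → p ⊗ q ≋ [] → p ≋ [] ⊎ q ≋ []
    ⊗-noZeroDivisors []      q e = inj₁ ≋-refl
    ⊗-noZeroDivisors (a ∷ p) q e with a D.≈? 0#
    ... | yes a≈0 = Sum.map₁ (0∷ a≈0)
                      (⊗-noZeroDivisors p q (∷-tail₀ (≋-trans (≋-sym (0∷-⊗ p q a≈0)) e)))
    ... | no  a≉0 = inj₂ (⊗-cancelˡ p q a≉0 e)

  domain : DiscreteDomain
  domain = record
    { commutativeRing = record
      { Carrier = Poly ; _≈_ = _≋_ ; _+_ = _⊕_ ; _*_ = _⊗_
      ; -_ = negate ; 0# = [] ; 1# = 1# ∷ []
      ; isCommutativeRing = record
        { isRing = record
          { +-isAbelianGroup = G.isAbelianGroup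
          ; *-cong = ⊗-cong
          ; *-assoc = ⊗-assoc
          ; *-identity = ⊗-identityˡ , ⊗-identityʳ
          ; distrib = ⊗-distribˡ , ⊗-distribʳ }
        ; *-comm = ⊗-comm } }
    ; _≈?_ = _≋?_
    ; 1≉0 = λ e → D.1≉0 (at e 0)
    ; noZeroDivisors = ⊗-noZeroDivisors }

ℚ[_] : ℕ → DiscreteDomain
ℚ[ zero  ] = ℚ-domain
ℚ[ suc N ] = Polynomial.domain ℚ[ N ]

var : ∀ {N} → Fin N → DiscreteDomain.Carrier ℚ[ N ]
var {suc N} zero    = DiscreteDomain.0# ℚ[ N ] ∷ DiscreteDomain.1# ℚ[ N ] ∷ []
var {suc N} (suc i) = var i ∷ []

module FieldOfFractions (D : DiscreteDomain) where
  private module D = DiscreteDomain D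

  record Fraction : Set where
    constructor fraction
    field
      num   : D.Carrier
      den   : D.Carrier
      den≉0 : ¬ den D.≈ D.0#
  open Fraction public

  infix 4 _≃_
  record _≃_ (u v : Fraction) : Set where
    constructor cross
    field uncross : num u D.* den v D.≈ num v D.* den u
  open _≃_ public

  private
    *-nonzero : ∀ {a b} → ¬ a D.≈ D.0# → ¬ b D.≈ D.0# → ¬ a D.* b D.≈ D.0#
    *-nonzero {a} {b} a≉0 b≉0 e with D.noZeroDivisors a b e
    ... | inj₁ a≈0 = a≉0 a≈0
    ... | inj₂ b≈0 = b≉0 b≈0

  ι : D.Carrier → Fraction
  ι a = fraction a D.1# D.1≉0

  0ᶠ 1ᶠ : Fraction
  0ᶠ = ι D.0#
  1ᶠ = ι D.1#

  infixl 6 _⊞_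
  infixl 7 _⊠_

  _⊞_ : Fraction → Fraction → Fraction
  u ⊞ v = fraction (num u D.* den v D.+ num v D.* den u) (den u D.* den v)
                   (*-nonzero (den≉0 u) (den≉0 v))

  _⊠_ : Fraction → Fraction → Fraction
  u ⊠ v = fraction (num u D.* num v) (den u D.* den v) (*-nonzero (den≉0 u) (den≉0 v))

  neg : Fraction → Fraction
  neg u = fraction (D.- num u) (den u) (den≉0 u)

  private
    open SetoidReasoning D.setoid
    module GP = GroupProperties D.+-group
    module RP = RingProperties D.ring

    open D using (_+_; _*_; -_; _≈_)
    open Solver D.commutativeSemiring using (solve; _:+_; _:*_; _:=_)

    cancel : ∀ a b c → ¬ c ≈ D.0# → a * c ≈ b * c → a ≈ b
    cancel a b c c≉0 e with D.noZeroDivisors (a D.- b) c (begin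
      (a D.- b) * c         ≈⟨ RP.[y-z]x≈yx-zx c a b ⟩
      a * c D.- b * c       ≈⟨ GP.x≈y⇒x∙y⁻¹≈ε e ⟩
      D.0#                  ∎)
    ... | inj₁ a-b≈0 = GP.x∙y⁻¹≈ε⇒x≈y a b a-b≈0
    ... | inj₂ c≈0   = contradiction c≈0 c≉0

    ≃-refl : ∀ {u} → u ≃ u
    ≃-refl = cross D.refl

    ≃-sym : ∀ {u v} → u ≃ v → v ≃ u
    ≃-sym (cross e) = cross (D.sym e)

    ≃-trans : ∀ {u v w} → u ≃ v → v ≃ w → u ≃ w
    ≃-trans {fraction a b _} {fraction c d d≉0} {fraction e f _} (cross p) (cross q) =
      cross (cancel _ _ d d≉0 (begin
        a * f * d     ≈⟨ l₁ a f d ⟩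
        (a * d) * f   ≈⟨ D.*-congʳ p ⟩
        (c * b) * f   ≈⟨ l₂ c b f ⟩
        (c * f) * b   ≈⟨ D.*-congʳ q ⟩
        (e * d) * b   ≈⟨ l₁ e d b ⟩
        e * b * d     ∎))
      where
      l₁ : ∀ a f d → a * f * d ≈ (a * d) * f
      l₁ = solve 3 (λ a f d → a :* f :* d := (a :* d) :* f) D.refl
      l₂ : ∀ a f d → a * f * d ≈ (a * d) * f
      l₂ = solve 3 (λ a f d → a :* f :* d := (a :* d) :* f) D.refl

    ⊞-cong : ∀ {u u′ v v′} → u ≃ u′ → v ≃ v′ → u ⊞ v ≃ u′ ⊞ v′
    ⊞-cong {fraction a b _} {fraction a′ b′ _} {fraction c d _} {fraction c′ d′ _} (cross p) (cross q) =
      cross (begin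
        (a * d + c * b) * (b′ * d′)               ≈⟨ l a b c d b′ d′ ⟩
        (a * b′) * (d * d′) + (c * d′) * (b * b′) ≈⟨ D.+-cong (D.*-congʳ p) (D.*-congʳ q) ⟩
        (a′ * b) * (d * d′) + (c′ * d) * (b * b′) ≈⟨ r a′ b c′ d b′ d′ ⟩
        (a′ * d′ + c′ * b′) * (b * d)             ∎)
      where
      l : ∀ a b c d b′ d′ → (a * d + c * b) * (b′ * d′) ≈ (a * b′) * (d * d′) + (c * d′) * (b * b′)
      l = solve 6 (λ a b c d b′ d′ → (a :* d :+ c :* b) :* (b′ :* d′) := (a :* b′) :* (d :* d′) :+ (c :* d′) :* (b :* b′)) D.refl
      r : ∀ a′ b c′ d b′ d′ → (a′ * b) * (d * d′) + (c′ * d) * (b * b′) ≈ (a′ * d′ + c′ * b′) * (b * d)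
      r = solve 6 (λ a′ b c′ d b′ d′ → (a′ :* b) :* (d :* d′) :+ (c′ :* d) :* (b :* b′) := (a′ :* d′ :+ c′ :* b′) :* (b :* d)) D.refl

    interchange : ∀ a b c d → (a * b) * (c * d) ≈ (a * c) * (b * d)
    interchange = solve 4 (λ a b c d → (a :* b) :* (c :* d) := (a :* c) :* (b :* d)) D.refl

    ⊠-cong : ∀ {u u′ v v′} → u ≃ u′ → v ≃ v′ → u ⊠ v ≃ u′ ⊠ v′
    ⊠-cong {fraction a b _} {fraction a′ b′ _} {fraction c d _} {fraction c′ d′ _} (cross p) (cross q) =
      cross (begin
        (a * c) * (b′ * d′) ≈⟨ interchange a c b′ d′ ⟩
        (a * b′) * (c * d′) ≈⟨ D.*-cong p q ⟩
        (a′ * b) * (c′ * d) ≈⟨ interchange a′ b c′ d ⟩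
        (a′ * c′) * (b * d) ∎)

    neg-cong : ∀ {u v} → u ≃ v → neg u ≃ neg v
    neg-cong {fraction a b _} {fraction c d _} (cross p) = cross (begin
      (- a) * d ≈⟨ RP.-‿distribˡ-* a d ⟨
      - (a * d) ≈⟨ D.-‿cong p ⟩
      - (c * b) ≈⟨ RP.-‿distribˡ-* c b ⟩
      (- c) * b ∎)

    ⊞-assoc : ∀ u v w → (u ⊞ v) ⊞ w ≃ u ⊞ (v ⊞ w)
    ⊞-assoc (fraction a b _) (fraction c d _) (fraction e f _) = cross (l a b c d e f)
      where
      l : ∀ a b c d e f → ((a * d + c * b) * f + e * (b * d)) * (b * (d * f)) ≈ (a * (d * f) + (c * f + e * d) * b) * (b * d * f)
      l = solve 6 (λ a b c d e f → ((a :* d :+ c :* b) :* f :+ e :* (b :* d)) :* (b :* (d :* f)) := (a :* (d :* f) :+ (c :* f :+ e :* d) :* b) :* (b :* d :* f)) D.refl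

    ⊞-comm : ∀ u v → u ⊞ v ≃ v ⊞ u
    ⊞-comm (fraction a b _) (fraction c d _) = cross (l a b c d)
      where
      l : ∀ a b c d → (a * d + c * b) * (d * b) ≈ (c * b + a * d) * (b * d)
      l = solve 4 (λ a b c d → (a :* d :+ c :* b) :* (d :* b) := (c :* b :+ a :* d) :* (b :* d)) D.refl

    ⊞-identityˡ : ∀ u → 0ᶠ ⊞ u ≃ u
    ⊞-identityˡ (fraction a b _) = cross (D.*-cong
      (D.trans (D.+-cong (D.zeroˡ b) (D.*-identityʳ a)) (D.+-identityˡ a))
      (D.sym (D.*-identityˡ b)))

    ⊞-inverseˡ : ∀ u → neg u ⊞ u ≃ 0ᶠ
    ⊞-inverseˡ (fraction a b _) = cross (begin
      ((- a) * b + a * b) * D.1# ≈⟨ D.*-identityʳ _ ⟩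
      (- a) * b + a * b          ≈⟨ D.+-congʳ (RP.-‿distribˡ-* a b) ⟨
      - (a * b) + a * b          ≈⟨ D.-‿inverseˡ _ ⟩
      D.0#                       ≈⟨ D.zeroˡ _ ⟨
      D.0# * (b * b)             ∎)

    ⊠-assoc : ∀ u v w → (u ⊠ v) ⊠ w ≃ u ⊠ (v ⊠ w)
    ⊠-assoc (fraction a b _) (fraction c d _) (fraction e f _) =
      cross (D.*-cong (D.*-assoc a c e) (D.sym (D.*-assoc b d f)))

    ⊠-comm : ∀ u v → u ⊠ v ≃ v ⊠ u
    ⊠-comm (fraction a b _) (fraction c d _) = cross (D.*-cong (D.*-comm a c) (D.*-comm d b))

    ⊠-identityˡ : ∀ u → 1ᶠ ⊠ u ≃ u
    ⊠-identityˡ (fraction a b _) = cross (D.*-cong (D.*-identityˡ a) (D.sym (D.*-identityˡ b)))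

    ⊠-distribˡ : ∀ u v w → u ⊠ (v ⊞ w) ≃ (u ⊠ v) ⊞ (u ⊠ w)
    ⊠-distribˡ (fraction a b _) (fraction c d _) (fraction e f _) = cross (l a b c d e f)
      where
      l : ∀ a b c d e f → (a * (c * f + e * d)) * ((b * d) * (b * f)) ≈ ((a * c) * (b * f) + (a * e) * (b * d)) * (b * (d * f))
      l = solve 6 (λ a b c d e f → (a :* (c :* f :+ e :* d)) :* ((b :* d) :* (b :* f)) := ((a :* c) :* (b :* f) :+ (a :* e) :* (b :* d)) :* (b :* (d :* f))) D.refl

    ⊠-distribʳ : ∀ w u v → (u ⊞ v) ⊠ w ≃ (u ⊠ w) ⊞ (v ⊠ w)
    ⊠-distribʳ w u v = ≃-trans (⊠-comm (u ⊞ v) w) (≃-trans (⊠-distribˡ w u v)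
      (⊞-cong (⊠-comm w u) (⊠-comm w v)))

  commutativeRing : CommutativeRing 0ℓ 0ℓ
  commutativeRing = record
    { Carrier = Fraction ; _≈_ = _≃_ ; _+_ = _⊞_ ; _*_ = _⊠_
    ; -_ = neg ; 0# = 0ᶠ ; 1# = 1ᶠ
    ; isCommutativeRing = record
      { isRing = record
        { +-isAbelianGroup = record
          { isGroup = record
            { isMonoid = record
              { isSemigroup = record
                { isMagma = record
                  { isEquivalence = record { refl = ≃-refl ; sym = ≃-sym ; trans = ≃-trans }
                  ; ∙-cong = ⊞-cong }
                ; assoc = ⊞-assoc }
              ; identity = ⊞-identityˡ , λ u → ≃-trans (⊞-comm u 0ᶠ) (⊞-identityˡ u) }
            ; inverse = ⊞-inverseˡ , λ u → ≃-trans (⊞-comm u (neg u)) (⊞-inverseˡ u)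
            ; ⁻¹-cong = neg-cong }
          ; comm = ⊞-comm }
        ; *-cong = ⊠-cong
        ; *-assoc = ⊠-assoc
        ; *-identity = ⊠-identityˡ , λ u → ≃-trans (⊠-comm u 1ᶠ) (⊠-identityˡ u)
        ; distrib = ⊠-distribˡ , ⊠-distribʳ }
      ; *-comm = ⊠-comm } }

  private
    module K = CommutativeRing commutativeRing
    module KG = GroupProperties K.+-group

    num≉0 : ∀ u → ¬ u ≃ 0ᶠ → ¬ num u ≈ D.0#
    num≉0 u u≄0 e = u≄0 (cross (begin
      num u * D.1# ≈⟨ D.*-identityʳ _ ⟩
      num u        ≈⟨ e ⟩
      D.0#         ≈⟨ D.zeroˡ _ ⟨
      D.0# * den u ∎))

  inv : ∀ u → ¬ u ≃ 0ᶠ → Fraction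
  inv u u≄0 = fraction (den u) (num u) (num≉0 u u≄0)

  infixl 7 _/_[_]
  _/_[_] : Fraction → ∀ v → ¬ v ≃ 0ᶠ → Fraction
  u / v [ v≄0 ] = u ⊠ inv v v≄0

  private
    inv-inverseʳ : ∀ u (u≄0 : ¬ u ≃ 0ᶠ) → u ⊠ inv u u≄0 ≃ 1ᶠ
    inv-inverseʳ (fraction a b _) _ = cross (begin
      (a * b) * D.1# ≈⟨ D.*-comm _ _ ⟩
      D.1# * (a * b) ≈⟨ D.*-congˡ (D.*-comm a b) ⟩
      D.1# * (b * a) ∎)

    _≃?_ : Decidable _≃_
    u ≃? v = map′ cross uncross ((num u * den v) D.≈? (num v * den u))

    decSetoid : DecSetoid 0ℓ 0ℓ
    decSetoid = record
      { isDecEquivalence = record { isEquivalence = K.isEquivalence ; _≟_ = _≃?_ } }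

    1≄0 : ¬ 1ᶠ ≃ 0ᶠ
    1≄0 (cross e) = D.1≉0 (D.trans (D.sym (D.*-identityʳ D.1#)) (D.trans e (D.zeroˡ D.1#)))

  heytingField : HeytingField 0ℓ 0ℓ 0ℓ
  heytingField = record
    { isHeytingField = record
      { isHeytingCommutativeRing = record
        { isCommutativeRing   = K.isCommutativeRing
        ; isApartnessRelation = DecSetoidProperties.≉-isApartnessRelation decSetoid
        ; #⇒invertible = λ {u} {v} u≄v →
            let w≄0 = u≄v ∘ KG.x∙y⁻¹≈ε⇒x≈y u v
                w   = u K.- v
            in inv w w≄0 , K.trans (K.*-comm (inv w w≄0) w) (inv-inverseʳ w w≄0) , inv-inverseʳ w w≄0
        ; invertible⇒# = λ {u} {v} (w , _ , e) u≃v →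
            1≄0 (K.trans (K.sym e) (K.trans (K.*-congʳ {w} (KG.x≈y⇒x∙y⁻¹≈ε {u} {v} u≃v)) (K.zeroˡ w))) }
      ; tight = DecSetoidProperties.≉-tight decSetoid } }

module RationalFunctions (m n : ℕ) where
  open FieldOfFractions ℚ[ m ℕ.* n ] public

  indeterminate : Fin m → Fin n → Fraction
  indeterminate i j = ι (var (combine i j))

-- ℤ/nℤ is Fin n; r +ᶻ z is the residue class of r + z.
infixl 6 _+ᶻ_
_+ᶻ_ : ∀ {n} .{{_ : NonZero n}} → Fin n → ℤ → Fin n
_+ᶻ_ {n} r z = fromℕ< (n%ℕd<d (+ toℕ r ℤ.+ z) n)

-- The 1-based index of an element of Fin k.
pos : ∀ {k} → Fin k → ℕ
pos i = suc (toℕ i)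

choices : ∀ {k} {A : Fin k → Set} → (∀ i → List (A i)) → List (∀ i → A i)
choices {zero}  L = (λ ()) ∷ []
choices {suc k} L = cartesianProductWith cons (L zero) (choices (L ∘ suc))
  where
  cons : ∀ {A : Fin (suc k) → Set} → A zero → (∀ i → A (suc i)) → ∀ i → A i
  cons a f zero    = a
  cons a f (suc i) = f i

IsPartition : ∀ {m} → Vector ℕ m → Set
IsPartition ν = ∀ i j → i Fin.≤ j → ν j ℕ.≤ ν i

δ : ∀ {m} → Vector ℕ m
δ {m} i = m ∸ pos i

-- A filling of the diagram with rows of lengths ν₁, ν₂, … by entries in {1,…,m}.
Filling : ∀ {m} → Vector ℕ m → Set
Filling {m} ν = ∀ i → Fin (ν i) → Fin m

fillings : ∀ {m} (ν : Vector ℕ m) → List (Filling ν)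
fillings {m} ν = choices λ i → choices λ j → allFin m

Semistandard : ∀ {m} (ν : Vector ℕ m) → Filling ν → Set
Semistandard ν T =
  (∀ i (j j′ : Fin (ν i)) → j Fin.≤ j′ → T i j Fin.≤ T i j′) ×
  (∀ i i′ (j : Fin (ν i)) (j′ : Fin (ν i′)) → i Fin.< i′ → pos j ≡ pos j′ → T i j Fin.< T i′ j′)

semistandard? : ∀ {m} (ν : Vector ℕ m) → Decidable₁ (Semistandard ν)
semistandard? ν T =
  (all? λ i → all? λ j → all? λ j′ → (j ≤? j′) →-dec (T i j ≤? T i j′)) ×-dec
  (all? λ i → all? λ i′ → all? λ j → all? λ j′ →
    (i <? i′) →-dec ((pos j ℕ.≟ pos j′) →-dec (T i j <? T i′ j′)))

occurrences : ∀ {m k} → Fin m → (Fin k → Fin m) → ℕ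
occurrences {k = k} c q = length (filter (λ t → q t ≟ c) (allFin k))

Admissible : ∀ {m} (n a b : ℕ) {k : ℕ} → (Fin k → Fin m) → Set
Admissible n a b q =
  (∀ t t′ → t Fin.≤ t′ → q t Fin.≤ q t′) ×
  (∀ t → a ℕ.≤ pos (q t) × pos (q t) ℕ.≤ b) ×
  (∀ c → a ℕ.< pos c → pos c ℕ.≤ b → occurrences c q ℕ.≤ n ∸ 1)

admissible? : ∀ {m} (n a b : ℕ) {k : ℕ} → Decidable₁ (Admissible {m} n a b {k})
admissible? n a b q =
  (all? λ t → all? λ t′ → (t ≤? t′) →-dec (q t ≤? q t′)) ×-dec
  ((all? λ t → (a ℕ.≤? pos (q t)) ×-dec (pos (q t) ℕ.≤? b)) ×-dec
   (all? λ c → (a ℕ.<? pos c) →-dec ((pos c ℕ.≤? b) →-dec (occurrences c q ℕ.≤? n ∸ 1))))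

module Determinant {c ℓ} (R : CommutativeRing c ℓ) where
  open CommutativeRing R hiding (zero)
  open FiniteSum +-commutativeMonoid using (sum)

  sign : ℕ → Carrier
  sign zero    = 1#
  sign (suc k) = - sign k

  det : ∀ {k} → (Fin k → Fin k → Carrier) → Carrier
  det {zero}  A = 1#
  det {suc k} A = sum λ j → sign (toℕ j) * (A zero j * det λ i l → A (suc i) (punchIn j l))

module LoopFunctions {c ℓ} (R : CommutativeRing c ℓ) {m n : ℕ} .{{_ : NonZero n}}
                     (x : Fin m → Fin n → CommutativeRing.Carrier R) where
  open CommutativeRing R hiding (zero)
  open Determinant R
  open FiniteSum *-commutativeMonoid using () renaming (sum to ∏)

  sumOver : ∀ {A : Set} → List A → (A → Carrier) → Carrier
  sumOver L f = foldr (λ a s → f a + s) 0# L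

  productOver : ∀ {A : Set} → List A → (A → Carrier) → Carrier
  productOver L f = foldr (λ a s → f a * s) 1# L

  -- The superscripts 1,…,n run once through ℤ/nℤ.
  π : Fin m → Carrier
  π i = ∏ λ (j : Fin n) → x i j

  loopSchur : Vector ℕ m → Fin n → Carrier
  loopSchur ν r = sumOver (filter (semistandard? ν) (fillings ν)) λ T →
    ∏ λ i → ∏ λ j → x (T i j) (r +ᶻ (pos i ⊖ pos j))

  -- σₖ⁽ʳ⁾(x_a,…,x_b), with 1-based a and b.
  σ : ℕ → Fin n → ℕ → ℕ → Carrier
  σ k r a b = sumOver (filter (admissible? n a b) (choices λ (_ : Fin k) → allFin m)) λ q →
    ∏ λ t → x (q t) (r +ᶻ (1 ⊖ pos t))

  B : Vector ℕ m → Fin n → Fin m → Fin m → Carrier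
  B α r i j =
    (∏ λ (t : Fin (α i)) → x j (r +ᶻ (pos j ⊖ pos t))) *
    σ ((n ∸ 1) ℕ.* (m ∸ pos j)) (r +ᶻ (pos j ⊖ suc (α i))) (pos j) m

  b : Vector ℕ m → Fin n → Carrier
  b α r = det (B α r)

  ∏[πᵢ-πⱼ] : Carrier
  ∏[πᵢ-πⱼ] = productOver (filter (λ (i , j) → i <? j) (cartesianProduct (allFin m) (allFin m)))
    λ (i , j) → π i - π j

{-# OPTIONS --safe #-}
module Submission where

-- Over any commutative ring, b_{ν+δ} = s_ν ∏_{i<j} (π_i − π_j), by induction on m, removing
-- the last variable x_m.  As a function of α, the entry F_j(α) of column j satisfies
--   F_j(α + 1) = x_m^{(r+m−α−1)} F_j(α) + (π_j − π_m) F′_j(α),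
-- where F′_j is the entry for x_1, …, x_{m−1}, and the last summand is absent for j = m.
-- Subtracting from each row a multiple of the next one therefore clears the last column above
-- its bottom entry and turns row i into a combination of the rows F′(μ_i + m − 1 − i),
-- ν_{i+1} ≤ μ_i ≤ ν_i, weighted by products of the x_m.  Expanding multilinearly gives the rule
-- by which s_ν branches when the boxes with entry m are removed.  The case ν = 0 gives b_δ, and
-- ∏ (π_i − π_j) ≠ 0 since the monomials π_i are separated by points with coordinates 0 and 1.

open import Defs
open import Algebra.Bundles using (CommutativeRing)
import Algebra.Properties.CommutativeMonoid.Sum as FiniteSum
import Algebra.Properties.CommutativeSemigroup as CommutativeSemigroupProperties
import Algebra.Properties.Group as GroupProperties
import Algebra.Properties.Ring as RingProperties
import Algebra.Properties.Semiring.Sum as SemiringSum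
import Algebra.Solver.Ring.NaturalCoefficients.Default as SemiringSolver
open import Data.Bool using (if_then_else_; true; false)
open import Data.Fin as Fin using (Fin; zero; suc; toℕ; fromℕ; fromℕ<; inject₁; inject≤; punchIn; combine; remQuot)
open import Data.Fin.Induction using (<-weakInduction)
open import Data.Fin.Permutation using (Permutation; permutation; _⟨$⟩ʳ_)
open import Data.Fin.Properties using (∀-cons; all?; _≟_; _<?_; toℕ-injective; toℕ<n; toℕ-fromℕ; toℕ-fromℕ<; toℕ-inject₁; toℕ-inject≤; fromℕ<-cong; fromℕ≢inject₁; inject₁-injective; ≤fromℕ; <⇒≢; remQuot-combine)
open import Data.Fin.Relation.Unary.Top using (view; ‵fromℕ; ‵inject₁)
open import Data.Integer as ℤ using (ℤ; +_; -[1+_]; _⊖_; _%ℕ_; _/ℕ_)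
open import Data.Integer.DivMod using (n%ℕd<d; a≡a%ℕn+[a/ℕn]*n)
import Data.Integer.Properties as ℤ
open import Data.Integer.Tactic.RingSolver using (solve-∀)
open import Data.List using (List; []; _∷_; _++_; map; foldr; filter; length; tabulate; applyUpTo; upTo; allFin; cartesianProduct; cartesianProductWith)
open import Data.List.Relation.Unary.All as All using (All; []; _∷_)
import Data.List.Relation.Unary.All.Properties as All
open import Data.Nat as ℕ using (ℕ; zero; suc; NonZero; _∸_; z≤n; s≤s)
open import Data.Nat.DivMod using (m<n⇒m%n≡m)
import Data.Nat.Properties as ℕ
open import Data.Product using (Σ-syntax; ∃; _×_; _,_; proj₁; proj₂)
open import Data.Rational as ℚ using (ℚ)
import Data.Rational.Properties as ℚ
open import Data.Sum using (_⊎_; inj₁; inj₂)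
open import Data.Vec.Functional using (Vector; zipWith)
open import Function using (_∘_; id)
open import Relation.Binary.PropositionalEquality as ≡ using (_≡_; _≢_)
import Relation.Binary.Reasoning.Setoid as SetoidReasoning
open import Relation.Nullary using (¬_; Dec; does; yes; no; contradiction)
open import Relation.Nullary.Decidable using (_×-dec_)
open import Relation.Unary using () renaming (Decidable to Decidable₁)

-- The recurrence for the columns comes from the degree (n - 1)(m - j) of the factor σ in column j.
-- The letters j + 1, ..., m occur at most n - 1 times each, so every admissible word of greater
-- length begins with j. Multiplying σ by the run of α variables x_j therefore only lengthens its
-- words: F_j(α) is the σ of degree α + (n - 1)(m - j) with superscript r + j - 1. Sorted by the
-- multiplicity of m, the n terms of F_j(α + 1) and those of F_j(α) times one more x_m are
-- neighbouring windows of one sequence; they differ only in their end terms, which are π_j and π_m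
-- times F′_j(α). The coefficient of F_j(α) is the same in all columns because lowering r + j - 1 by
-- (n - 1)(m - j) raises it by m - j modulo n. So one row operation serves all columns, and the
-- factors x_m collected along row i are exactly the weights of boxes of row i that hold the entry
-- m.

-- Families split at the last index, and lists of choices.

snoc : ∀ {a k} {A : Fin (suc k) → Set a} → (∀ i → A (inject₁ i)) → A (fromℕ k) → ∀ i → A i
snoc {k = zero}  g a zero    = a
snoc {k = suc k} g a zero    = g zero
snoc {k = suc k} g a (suc i) = snoc (g ∘ suc) a i

snoc-inject₁ : ∀ {a k} {A : Fin (suc k) → Set a} (g : ∀ i → A (inject₁ i)) (a : A (fromℕ k)) i →
               snoc {A = A} g a (inject₁ i) ≡ g i
snoc-inject₁ {k = suc k} g a zero    = ≡.refl
snoc-inject₁ {k = suc k} g a (suc i) = snoc-inject₁ (g ∘ suc) a i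

snoc-fromℕ : ∀ {a k} {A : Fin (suc k) → Set a} (g : ∀ i → A (inject₁ i)) (a : A (fromℕ k)) →
             snoc {A = A} g a (fromℕ k) ≡ a
snoc-fromℕ {k = zero}  g a = ≡.refl
snoc-fromℕ {k = suc k} g a = snoc-fromℕ (g ∘ suc) a

-- The relation is a parameter because the values can be rows of a filling, which are functions and
-- are compared pointwise.
snoc-cong : ∀ {a k} {A : Fin (suc k) → Set a} (_~_ : ∀ {i} → A i → A i → Set a)
            {g h : ∀ i → A (inject₁ i)} {a b : A (fromℕ k)} →
            (∀ i → g i ~ h i) → a ~ b → ∀ i → snoc {A = A} g a i ~ snoc {A = A} h b i
snoc-cong {k = zero}  _~_ g~h a~b zero    = a~b
snoc-cong {k = suc k} _~_ g~h a~b zero    = g~h zero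
snoc-cong {k = suc k} _~_ g~h a~b (suc i) = snoc-cong _~_ (g~h ∘ suc) a~b i

cartesianProductWith-All : ∀ {A B C : Set} {P : A → Set} {Q : B → Set} {S : C → Set} (h : A → B → C) →
  (∀ {a b} → P a → Q b → S (h a b)) → ∀ {L M} → All P L → All Q M → All S (cartesianProductWith h L M)
cartesianProductWith-All h f []       qs = []
cartesianProductWith-All h f (p ∷ ps) qs = All.++⁺ (All.map⁺ (All.map (f p) qs)) (cartesianProductWith-All h f ps qs)

-- Recovers the bounds on the row lengths of a shape from its membership in a list of choices.
choices-All : ∀ {k} {A : Fin k → Set} {P : ∀ i → A i → Set} (L : ∀ i → List (A i)) →
              (∀ i → All (P i) (L i)) → All (λ g → ∀ i → P i (g i)) (choices L)
choices-All {zero}  L ps = (λ ()) ∷ []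
choices-All {suc k} L ps = cartesianProductWith-All _ (λ p q → λ { zero → p ; (suc i) → q i }) (ps zero) (choices-All (L ∘ suc) (ps ∘ suc))

-- Finite sums, products and indicators in a commutative ring.

module Sums {c ℓ} (R : CommutativeRing c ℓ) where
  open CommutativeRing R hiding (zero)
  open CommutativeSemigroupProperties +-commutativeSemigroup using (interchange)
  open SetoidReasoning setoid
  private
    module S = FiniteSum +-commutativeMonoid
    module P = FiniteSum *-commutativeMonoid
    module SR = SemiringSum semiring

  -- Opaque, so that the summand can be inferred from a goal of the form sum f ≈ sum g.
  opaque
    sum ∏ : ∀ {k} → (Fin k → Carrier) → Carrier
    sum = S.sum
    ∏   = P.sum

    sum-def : ∀ {k} (f : Fin k → Carrier) → S.sum f ≈ sum f
    sum-def f = refl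

    ∏-def : ∀ {k} (f : Fin k → Carrier) → P.sum f ≈ ∏ f
    ∏-def f = refl

    sum-suc : ∀ {k} (f : Fin (suc k) → Carrier) → sum f ≈ f zero + sum (f ∘ suc)
    sum-suc f = refl

    ∏-suc : ∀ {k} (f : Fin (suc k) → Carrier) → ∏ f ≈ f zero * ∏ (f ∘ suc)
    ∏-suc f = refl

    sum-cong : ∀ {k} {f g : Fin k → Carrier} → (∀ i → f i ≈ g i) → sum f ≈ sum g
    sum-cong {k} = S.sum-cong-≋ {k}

    ∏-cong : ∀ {k} {f g : Fin k → Carrier} → (∀ i → f i ≈ g i) → ∏ f ≈ ∏ g
    ∏-cong {k} = P.sum-cong-≋ {k}

    sum-zero : ∀ {k} {f : Fin k → Carrier} → (∀ i → f i ≈ 0#) → sum f ≈ 0#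
    sum-zero {zero}  e = refl
    sum-zero {suc k} e = trans (+-cong (e zero) (sum-zero (e ∘ suc))) (+-identityˡ 0#)

    ∏-one : ∀ {k} {f : Fin k → Carrier} → (∀ i → f i ≈ 1#) → ∏ f ≈ 1#
    ∏-one {zero}  e = refl
    ∏-one {suc k} e = trans (*-cong (e zero) (∏-one (e ∘ suc))) (*-identityˡ 1#)

    sum-init-last : ∀ {k} (f : Fin (suc k) → Carrier) → sum f ≈ sum (f ∘ inject₁) + f (fromℕ k)
    sum-init-last = S.sum-init-last

    ∏-init-last : ∀ {k} (f : Fin (suc k) → Carrier) → ∏ f ≈ ∏ (f ∘ inject₁) * f (fromℕ k)
    ∏-init-last = P.sum-init-last

    ∏-remove : ∀ {k} (i : Fin (suc k)) f → ∏ f ≈ f i * ∏ (f ∘ punchIn i)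
    ∏-remove i = P.sum-remove {i = i}

    ∏-permute : ∀ {k} (f : Fin k → Carrier) (ρ : Permutation k k) → ∏ f ≈ ∏ (f ∘ (ρ ⟨$⟩ʳ_))
    ∏-permute = P.sum-permute

    sum-distrib-+ : ∀ {k} {f g : Fin k → Carrier} → (sum λ i → f i + g i) ≈ sum f + sum g
    sum-distrib-+ {k} {f} {g} = S.∑-distrib-+ {k} f g

    ∏-distrib-* : ∀ {k} {f g : Fin k → Carrier} → (∏ λ i → f i * g i) ≈ ∏ f * ∏ g
    ∏-distrib-* {k} {f} {g} = P.∑-distrib-+ {k} f g

    *-distribˡ-sum : ∀ {k} {a} {f : Fin k → Carrier} → a * sum f ≈ (sum λ i → a * f i)
    *-distribˡ-sum {k} {a} {f} = SR.*-distribˡ-sum {k} a f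

    *-distribʳ-sum : ∀ {k} {a} {f : Fin k → Carrier} → sum f * a ≈ (sum λ i → f i * a)
    *-distribʳ-sum {k} {a} {f} = SR.*-distribʳ-sum {k} a f

  -- Turns the condition of a filtered sum into a factor, so that sums run over whole lists and
  -- conditions factor as weights do.
  𝟙 : ∀ {P : Set} → Dec P → Carrier
  𝟙 P? = if does P? then 1# else 0#

  𝟙-yes : ∀ {P : Set} (P? : Dec P) → P → 𝟙 P? ≈ 1#
  𝟙-yes (yes _) p = refl
  𝟙-yes (no ¬p) p = contradiction p ¬p

  𝟙-no : ∀ {P : Set} (P? : Dec P) → ¬ P → 𝟙 P? ≈ 0#
  𝟙-no (yes p) ¬p = contradiction p ¬p
  𝟙-no (no _)  ¬p = refl

  𝟙-cong : ∀ {P Q : Set} (P? : Dec P) (Q? : Dec Q) → (P → Q) → (Q → P) → 𝟙 P? ≈ 𝟙 Q?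
  𝟙-cong (yes p) Q? f g = sym (𝟙-yes Q? (f p))
  𝟙-cong (no ¬p) Q? f g = sym (𝟙-no Q? (¬p ∘ g))

  𝟙-× : ∀ {P Q : Set} (P? : Dec P) (Q? : Dec Q) → 𝟙 (P? ×-dec Q?) ≈ 𝟙 P? * 𝟙 Q?
  𝟙-× (yes _) (yes _) = sym (*-identityˡ 1#)
  𝟙-× (yes _) (no _)  = sym (*-identityˡ 0#)
  𝟙-× (no _)  _       = sym (zeroˡ _)

  ∑ : ∀ {A : Set} → List A → (A → Carrier) → Carrier
  ∑ L f = foldr (λ a s → f a + s) 0# L

  module _ {A : Set} where
    ∑-cong-All : ∀ {P : A → Set} {L} {f g : A → Carrier} → All P L → (∀ a → P a → f a ≈ g a) → ∑ L f ≈ ∑ L g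
    ∑-cong-All []       e = refl
    ∑-cong-All (p ∷ ps) e = +-cong (e _ p) (∑-cong-All ps e)

    ∑-cong : ∀ L {f g : A → Carrier} → (∀ a → f a ≈ g a) → ∑ L f ≈ ∑ L g
    ∑-cong []      e = refl
    ∑-cong (a ∷ L) e = +-cong (e a) (∑-cong L e)

    ∑-zero : ∀ L {f : A → Carrier} → (∀ a → f a ≈ 0#) → ∑ L f ≈ 0#
    ∑-zero []      e = refl
    ∑-zero (a ∷ L) e = trans (+-cong (e a) (∑-zero L e)) (+-identityˡ 0#)

    ∑-distrib : ∀ L (f g : A → Carrier) → ∑ L (λ a → f a + g a) ≈ ∑ L f + ∑ L g
    ∑-distrib []      f g = sym (+-identityˡ 0#)
    ∑-distrib (a ∷ L) f g = trans (+-congˡ (∑-distrib L f g)) (interchange _ _ _ _)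

    *-distribˡ-∑ : ∀ k L (f : A → Carrier) → k * ∑ L f ≈ ∑ L (λ a → k * f a)
    *-distribˡ-∑ k []      f = zeroʳ k
    *-distribˡ-∑ k (a ∷ L) f = trans (distribˡ k _ _) (+-congˡ (*-distribˡ-∑ k L f))

    *-distribʳ-∑ : ∀ k L (f : A → Carrier) → ∑ L f * k ≈ ∑ L (λ a → f a * k)
    *-distribʳ-∑ k []      f = zeroˡ k
    *-distribʳ-∑ k (a ∷ L) f = trans (distribʳ k _ _) (+-congˡ (*-distribʳ-∑ k L f))

    ∑-++ : ∀ L M (f : A → Carrier) → ∑ (L ++ M) f ≈ ∑ L f + ∑ M f
    ∑-++ []      M f = sym (+-identityˡ _)
    ∑-++ (a ∷ L) M f = trans (+-congˡ (∑-++ L M f)) (sym (+-assoc _ _ _))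

    ∑-filter : ∀ {P : A → Set} (P? : Decidable₁ P) L (f : A → Carrier) →
               ∑ (filter P? L) f ≈ ∑ L (λ a → 𝟙 (P? a) * f a)
    ∑-filter P? []      f = refl
    ∑-filter P? (a ∷ L) f with does (P? a)
    ... | true  = +-cong (sym (*-identityˡ _)) (∑-filter P? L f)
    ... | false = trans (∑-filter P? L f) (sym (trans (+-congʳ (zeroˡ _)) (+-identityˡ _)))

    opaque
      unfolding sum

      ∑-tabulate : ∀ {k} (g : Fin k → A) (f : A → Carrier) → ∑ (tabulate g) f ≈ sum (f ∘ g)
      ∑-tabulate {zero}  g f = refl
      ∑-tabulate {suc k} g f = +-congˡ (∑-tabulate (g ∘ suc) f)

      ∑-applyUpTo : ∀ (g : ℕ → A) k (f : A → Carrier) → ∑ (applyUpTo g k) f ≈ sum {k} (f ∘ g ∘ toℕ)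
      ∑-applyUpTo g zero    f = refl
      ∑-applyUpTo g (suc k) f = +-congˡ (∑-applyUpTo (g ∘ suc) k f)

    ∑-sum-swap : ∀ L {k} (f : A → Fin k → Carrier) → (∑ L λ a → sum (f a)) ≈ (sum λ i → ∑ L λ a → f a i)
    ∑-sum-swap []      f = sym (sum-zero λ _ → refl)
    ∑-sum-swap (a ∷ L) f = trans (+-congˡ (∑-sum-swap L f)) (sym sum-distrib-+)

  module _ {A B : Set} where
    ∑-swap : ∀ L M (f : A → B → Carrier) → (∑ L λ a → ∑ M λ b → f a b) ≈ (∑ M λ b → ∑ L λ a → f a b)
    ∑-swap []      M f = sym (∑-zero M λ _ → refl)
    ∑-swap (a ∷ L) M f = trans (+-congˡ (∑-swap L M f)) (sym (∑-distrib M _ _))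

    ∑-map : ∀ (h : A → B) L (f : B → Carrier) → ∑ (map h L) f ≈ ∑ L (f ∘ h)
    ∑-map h []      f = refl
    ∑-map h (a ∷ L) f = +-congˡ (∑-map h L f)

  ∑-cartesianProductWith : ∀ {A B C : Set} (h : A → B → C) L M (f : C → Carrier) →
                           ∑ (cartesianProductWith h L M) f ≈ ∑ L λ a → ∑ M λ b → f (h a b)
  ∑-cartesianProductWith h []      M f = refl
  ∑-cartesianProductWith h (a ∷ L) M f = begin
    ∑ (map (h a) M ++ cartesianProductWith h L M) f            ≈⟨ ∑-++ (map (h a) M) _ f ⟩
    ∑ (map (h a) M) f + ∑ (cartesianProductWith h L M) f       ≈⟨ +-cong (∑-map (h a) M f) (∑-cartesianProductWith h L M f) ⟩
    ∑ M (f ∘ h a) + (∑ L λ a → ∑ M λ b → f (h a b))            ∎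

  -- The elements of `choices` are functions, and splitting and reassembling them gives back the
  -- original only pointwise. Without function extensionality, summands must be known to respect
  -- this.
  Extensional : ∀ {k} {A : Fin k → Set} → ((∀ i → A i) → Carrier) → Set ℓ
  Extensional f = ∀ {g h} → (∀ i → g i ≡ h i) → f g ≈ f h

  ∑-choices : ∀ {k} {A : Fin (suc k) → Set} (L : ∀ i → List (A i)) {f : (∀ i → A i) → Carrier} → Extensional f →
              ∑ (choices L) f ≈ ∑ (L zero) λ a → ∑ (choices (L ∘ suc)) λ g → f (∀-cons a g)
  ∑-choices L {f} ext = trans (∑-cartesianProductWith _ (L zero) (choices (L ∘ suc)) f)
    (∑-cong (L zero) λ a → ∑-cong (choices (L ∘ suc)) λ g → ext λ { zero → ≡.refl ; (suc i) → ≡.refl })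

  -- `choices` is built from the first index, whereas the branching rule singles out the last row of
  -- a tableau. The induction carries the last choice inwards past the first one.
  ∑-choices-snoc : ∀ {k} {A : Fin (suc k) → Set} (L : ∀ i → List (A i)) {f : (∀ i → A i) → Carrier} → Extensional f →
                   ∑ (choices L) f ≈ ∑ (choices (L ∘ inject₁)) λ g → ∑ (L (fromℕ k)) λ a → f (snoc g a)
  ∑-choices-snoc {zero} L {f} ext = begin
    ∑ (choices L) f                        ≈⟨ ∑-choices L ext ⟩
    (∑ (L zero) λ a → f (∀-cons a _) + 0#) ≈⟨ ∑-cong (L zero) (λ a → trans (+-identityʳ _) (ext λ { zero → ≡.refl })) ⟩
    (∑ (L zero) λ a → f (snoc _ a))        ≈⟨ +-identityʳ _ ⟨
    (∑ (L zero) λ a → f (snoc _ a)) + 0#   ∎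
  ∑-choices-snoc {suc k} {A} L {f} ext = begin
    ∑ (choices L) f
      ≈⟨ ∑-choices L ext ⟩
    (∑ (L zero) λ a → ∑ (choices (L ∘ suc)) λ g → f (∀-cons a g))
      ≈⟨ ∑-cong (L zero) (λ a → ∑-choices-snoc (L ∘ suc) λ g≗ → ext λ { zero → ≡.refl ; (suc i) → g≗ i }) ⟩
    (∑ (L zero) λ a → ∑ (choices (L ∘ inject₁ ∘ suc)) λ g → ∑ (L (fromℕ (suc k))) λ z → f (∀-cons a (snoc g z)))
      ≈⟨ ∑-cong (L zero) (λ a → ∑-cong (choices (L ∘ inject₁ ∘ suc)) λ g → ∑-cong (L (fromℕ (suc k))) λ z →
           ext λ { zero → ≡.refl ; (suc i) → ≡.refl }) ⟩
    (∑ (L zero) λ a → ∑ (choices (L ∘ inject₁ ∘ suc)) λ g → ∑ (L (fromℕ (suc k))) λ z → f (snoc {A = A} (∀-cons {P = A ∘ inject₁} a g) z))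
      ≈⟨ ∑-choices (L ∘ inject₁) (λ g≗ → ∑-cong (L (fromℕ (suc k))) λ z → ext (snoc-cong {A = A} _≡_ g≗ ≡.refl)) ⟨
    (∑ (choices (L ∘ inject₁)) λ g → ∑ (L (fromℕ (suc k))) λ z → f (snoc {A = A} g z)) ∎

-- Determinants: row operations and multilinear expansion.

punchIn-inject₁-≤ : ∀ {k} (j l : Fin k) → j Fin.≤ l → punchIn (inject₁ j) l ≡ suc l
punchIn-inject₁-≤ zero    l       _         = ≡.refl
punchIn-inject₁-≤ (suc j) (suc l) (s≤s j≤l) = ≡.cong suc (punchIn-inject₁-≤ j l j≤l)

punchIn-suc-≤ : ∀ {k} (j l : Fin k) → j Fin.≤ l → punchIn (suc l) j ≡ inject₁ j
punchIn-suc-≤ zero    l       _         = ≡.refl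
punchIn-suc-≤ (suc j) (suc l) (s≤s j≤l) = ≡.cong suc (punchIn-suc-≤ j l j≤l)

-- The cosimplicial identity: two columns may be deleted in either order.
punchIn-punchIn-≤ : ∀ {k} (j l : Fin (suc k)) (i : Fin k) → j Fin.≤ l →
                    punchIn (inject₁ j) (punchIn l i) ≡ punchIn (suc l) (punchIn j i)
punchIn-punchIn-≤ zero    l       i       _         = ≡.refl
punchIn-punchIn-≤ (suc j) (suc l) zero    _         = ≡.refl
punchIn-punchIn-≤ (suc j) (suc l) (suc i) (s≤s j≤l) = ≡.cong suc (punchIn-punchIn-≤ j l i j≤l)

punchIn-inject₁-inject₁ : ∀ {k} (j : Fin (suc k)) (i : Fin k) → punchIn (inject₁ j) (inject₁ i) ≡ inject₁ (punchIn j i)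
punchIn-inject₁-inject₁ zero    i       = ≡.refl
punchIn-inject₁-inject₁ (suc j) zero    = ≡.refl
punchIn-inject₁-inject₁ (suc j) (suc i) = ≡.cong suc (punchIn-inject₁-inject₁ j i)

punchIn-inject₁-fromℕ : ∀ {k} (j : Fin (suc k)) → punchIn (inject₁ j) (fromℕ k) ≡ fromℕ (suc k)
punchIn-inject₁-fromℕ         zero    = ≡.refl
punchIn-inject₁-fromℕ {suc k} (suc j) = ≡.cong suc (punchIn-inject₁-fromℕ j)

module Determinants {c ℓ} (R : CommutativeRing c ℓ) where
  open CommutativeRing R hiding (zero)
  open RingProperties ring using (-‿distribˡ-*)
  open SemiringSolver commutativeSemiring using (solve; _:+_; _:*_; _:=_)
  open Determinant R
  open Sums R
  open SetoidReasoning setoid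

  private
    Matrix : ℕ → Set c
    Matrix k = Fin k → Fin k → Carrier

    minor : ∀ {k} → Matrix (suc k) → Fin (suc k) → Matrix k
    minor A j i l = A (suc i) (punchIn j l)

    sgn : ∀ {i} → Fin i → Carrier
    sgn j = sign (toℕ j)

  det-expand : ∀ {k} (A : Matrix (suc k)) → det A ≈ sum λ j → sgn j * (A zero j * det (minor A j))
  det-expand A = sum-def _

  det-cong : ∀ {k} {A B : Matrix k} → (∀ i j → A i j ≈ B i j) → det A ≈ det B
  det-cong {zero}  e = refl
  det-cong {suc k} {A} {B} e = begin
    det A                                                  ≈⟨ det-expand A ⟩
    (sum λ j → sgn j * (A zero j * det (minor A j))) ≈⟨ sum-cong (λ j → *-congˡ (*-cong (e zero j) (det-cong λ i l → e (suc i) (punchIn j l)))) ⟩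
    (sum λ j → sgn j * (B zero j * det (minor B j))) ≈⟨ det-expand B ⟨
    det B                                                  ∎

  -- `f j l` stands for the ordered pair of distinct columns `j` and `punchIn j l`. For j ≤ l the
  -- two terms of the hypothesis are the pairs (j, l + 1) and (l + 1, j), and such exchanged pairs
  -- exhaust the double sum.
  sum-sum-cancel : ∀ {k} (f : Fin (suc k) → Fin k → Carrier) →
    (∀ j l → j Fin.≤ l → f (inject₁ j) l + f (suc l) j ≈ 0#) → (sum λ j → sum (f j)) ≈ 0#
  sum-sum-cancel {zero}  f e = sum-zero λ j → sum-zero λ ()
  sum-sum-cancel {suc k} f e = begin
    (sum λ j → sum (f j))
      ≈⟨ sum-suc _ ⟩
    sum (f zero) + (sum λ j → sum (f (suc j)))
      ≈⟨ +-congˡ (trans (sum-cong λ j → sum-suc (f (suc j))) sum-distrib-+) ⟩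
    sum (f zero) + ((sum λ j → f (suc j) zero) + (sum λ j → sum (f (suc j) ∘ suc)))
      ≈⟨ +-assoc _ _ _ ⟨
    (sum (f zero) + (sum λ j → f (suc j) zero)) + (sum λ j → sum (f (suc j) ∘ suc))
      ≈⟨ +-cong (sym sum-distrib-+)
           (sum-sum-cancel (λ j l → f (suc j) (suc l)) λ j l j≤l → e (suc j) (suc l) (s≤s j≤l)) ⟩
    (sum λ l → f zero l + f (suc l) zero) + 0#
      ≈⟨ +-identityʳ _ ⟩
    (sum λ l → f zero l + f (suc l) zero)
      ≈⟨ sum-zero (λ l → e zero l z≤n) ⟩
    0# ∎

  -- In the expansion along the first two rows, exchanging the two chosen columns keeps the entries
  -- and the remaining minor but flips the sign.
  det-equal-rows : ∀ {k} (A : Matrix (suc (suc k))) → (∀ j → A zero j ≈ A (suc zero) j) → det A ≈ 0#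
  det-equal-rows {k} A e = begin
    det A
      ≈⟨ det-expand A ⟩
    (sum λ j → sgn j * (A zero j * det (minor A j)))
      ≈⟨ sum-cong (λ j → begin
           sgn j * (A zero j * det (minor A j)) ≈⟨ *-congˡ (*-congˡ (det-expand (minor A j))) ⟩
           sgn j * (A zero j * sum (inner j))   ≈⟨ *-congˡ *-distribˡ-sum ⟩
           sgn j * (sum λ l → A zero j * inner j l) ≈⟨ *-distribˡ-sum ⟩
           sum (term j) ∎) ⟩
    (sum λ j → sum (term j))
      ≈⟨ sum-sum-cancel term cancel ⟩
    0# ∎
    where
    D : Fin (suc (suc k)) → Fin (suc k) → Carrier
    D j l = det (minor (minor A j) l)
    inner term : Fin (suc (suc k)) → Fin (suc k) → Carrier
    inner j l = sgn l * (A (suc zero) (punchIn j l) * D j l)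
    term j l = sgn j * (A zero j * inner j l)
    cancel : ∀ j l → j Fin.≤ l → term (inject₁ j) l + term (suc l) j ≈ 0#
    cancel j l j≤l = begin
      term (inject₁ j) l + term (suc l) j
        ≈⟨ +-cong
             (*-cong (reflexive (≡.cong sign (toℕ-inject₁ j))) (*-congˡ (*-congˡ (*-congʳ
               (trans (reflexive (≡.cong (A (suc zero)) (punchIn-inject₁-≤ j l j≤l))) (sym (e (suc l))))))))
             (*-congˡ (*-congˡ (*-congˡ (*-cong
               (trans (reflexive (≡.cong (A (suc zero)) (punchIn-suc-≤ j l j≤l))) (sym (e (inject₁ j))))
               (det-cong λ i i′ → reflexive (≡.cong (A (suc (suc i))) (≡.sym (punchIn-punchIn-≤ j l i′ j≤l)))))))) ⟩
      sgn j * (a * (sgn l * (b * d))) + (- sgn l) * (b * (sgn j * (a * d)))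
        ≈⟨ +-congˡ (-‿distribˡ-* _ _) ⟨
      sgn j * (a * (sgn l * (b * d))) - sgn l * (b * (sgn j * (a * d)))
        ≈⟨ +-congʳ (solve 5 (λ s t a b d → s :* (a :* (t :* (b :* d))) := t :* (b :* (s :* (a :* d)))) refl (sgn j) (sgn l) a b d) ⟩
      sgn l * (b * (sgn j * (a * d))) - sgn l * (b * (sgn j * (a * d)))
        ≈⟨ -‿inverseʳ _ ⟩
      0# ∎
      where
      a = A zero (inject₁ j)
      b = A zero (suc l)
      d = D (inject₁ j) l

  -- Each row is corrected by a multiple of the unmodified row below it, so all corrections can be
  -- made together, from the top down. The correction of the first row contributes a multiple of the
  -- determinant of `doubled`, whose first two rows agree; the minors are treated by induction.
  det-row-operations : ∀ {k} (A A′ : Matrix (suc k)) (q : Fin k → Carrier) →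
    (∀ i j → A (inject₁ i) j ≈ A′ (inject₁ i) j + q i * A (suc i) j) →
    (∀ j → A (fromℕ k) j ≈ A′ (fromℕ k) j) → det A ≈ det A′
  det-row-operations {zero}  A A′ q e f = det-cong {1} {A} {A′} λ { zero → f }
  det-row-operations {suc k} A A′ q e f = begin
    det A
      ≈⟨ det-expand A ⟩
    (sum λ j → sgn j * (A zero j * det (minor A j)))
      ≈⟨ sum-cong (λ j → trans (*-congˡ (*-congʳ (e zero j)))
           (solve 5 (λ s a q b d → s :* ((a :+ q :* b) :* d) := s :* (a :* d) :+ q :* (s :* (b :* d))) refl
             (sgn j) (A′ zero j) (q zero) (A (suc zero) j) (det (minor A j)))) ⟩
    (sum λ j → sgn j * (A′ zero j * det (minor A j)) + q zero * (sgn j * (A (suc zero) j * det (minor A j))))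
      ≈⟨ sum-distrib-+ ⟩
    (sum λ j → sgn j * (A′ zero j * det (minor A j))) +
    (sum λ j → q zero * (sgn j * (A (suc zero) j * det (minor A j))))
      ≈⟨ +-cong
           (sum-cong λ j → *-congˡ (*-congˡ (det-row-operations (minor A j) (minor A′ j) (q ∘ suc)
             (λ i l → e (suc i) (punchIn j l)) (λ l → f (punchIn j l)))))
           (sym *-distribˡ-sum) ⟩
    (sum λ j → sgn j * (A′ zero j * det (minor A′ j))) + q zero * (sum λ j → sgn j * (A (suc zero) j * det (minor A j)))
      ≈⟨ +-cong (det-expand A′) (*-congˡ (det-expand doubled)) ⟨
    det A′ + q zero * det doubled
      ≈⟨ +-congˡ (trans (*-congˡ (det-equal-rows doubled λ _ → refl)) (zeroʳ _)) ⟩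
    det A′ + 0#
      ≈⟨ +-identityʳ _ ⟩
    det A′ ∎
    where
    doubled : Matrix (suc (suc k))
    doubled zero    = A (suc zero)
    doubled (suc i) = A (suc i)

  -- `det` expands along the first row only, so this is an induction: the last cofactor vanishes,
  -- and every other minor inherits the last column of `A`. The corner lies on the diagonal and
  -- leaves no sign.
  det-last-column : ∀ {k} (A : Matrix (suc k)) → (∀ i → A (inject₁ i) (fromℕ k) ≈ 0#) →
    det A ≈ det (λ i j → A (inject₁ i) (inject₁ j)) * A (fromℕ k) (fromℕ k)
  det-last-column {zero} A e = trans (+-identityʳ _) (*-congˡ (*-identityʳ _))
  det-last-column {suc k} A e = begin
    det A
      ≈⟨ det-expand A ⟩
    sum cofactor
      ≈⟨ sum-init-last cofactor ⟩
    sum (cofactor ∘ inject₁) + cofactor (fromℕ (suc k))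
      ≈⟨ +-cong (sum-cong expand) (trans (*-congˡ (trans (*-congʳ (e zero)) (zeroˡ _))) (zeroʳ _)) ⟩
    (sum λ j → (sgn j * (A₀ zero j * det (minor A₀ j))) * A (fromℕ (suc k)) (fromℕ (suc k))) + 0#
      ≈⟨ trans (+-identityʳ _) (sym *-distribʳ-sum) ⟩
    (sum λ j → sgn j * (A₀ zero j * det (minor A₀ j))) * A (fromℕ (suc k)) (fromℕ (suc k))
      ≈⟨ *-congʳ (det-expand A₀) ⟨
    det A₀ * A (fromℕ (suc k)) (fromℕ (suc k)) ∎
    where
    cofactor : Fin (suc (suc k)) → Carrier
    cofactor j = sgn j * (A zero j * det (minor A j))
    corner : Fin (suc k) → Matrix k
    corner j i l = minor A (inject₁ j) (inject₁ i) (inject₁ l)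
    A₀ : Matrix (suc k)
    A₀ i j = A (inject₁ i) (inject₁ j)
    expand : ∀ j → sign (toℕ (inject₁ j)) * (A zero (inject₁ j) * det (minor A (inject₁ j))) ≈
                   (sgn j * (A₀ zero j * det (minor A₀ j))) * A (fromℕ (suc k)) (fromℕ (suc k))
    expand j = begin
      sign (toℕ (inject₁ j)) * (A zero (inject₁ j) * det (minor A (inject₁ j)))
        ≈⟨ *-cong (reflexive (≡.cong sign (toℕ-inject₁ j))) (*-congˡ (det-last-column (minor A (inject₁ j))
             λ i → trans (reflexive (≡.cong (A (suc (inject₁ i))) (punchIn-inject₁-fromℕ j))) (e (suc i)))) ⟩
      sgn j * (A₀ zero j * (det (corner j) * A (fromℕ (suc k)) (punchIn (inject₁ j) (fromℕ k))))
        ≈⟨ *-congˡ (*-congˡ (*-cong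
             (det-cong {k} {corner j} λ i l → reflexive (≡.cong (A (suc (inject₁ i))) (punchIn-inject₁-inject₁ j l)))
             (reflexive (≡.cong (A (fromℕ (suc k))) (punchIn-inject₁-fromℕ j))))) ⟩
      sgn j * (A₀ zero j * (det (minor A₀ j) * A (fromℕ (suc k)) (fromℕ (suc k))))
        ≈⟨ solve 4 (λ s a d z → s :* (a :* (d :* z)) := (s :* (a :* d)) :* z) refl _ _ _ _ ⟩
      (sgn j * (A₀ zero j * det (minor A₀ j))) * A (fromℕ (suc k)) (fromℕ (suc k)) ∎

  det-scale-columns : ∀ {k} (u : Fin k → Carrier) (A : Matrix k) → det (λ i j → u j * A i j) ≈ ∏ u * det A
  det-scale-columns {zero}  u A = sym (trans (*-congʳ (∏-one λ ())) (*-identityˡ 1#))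
  det-scale-columns {suc k} u A = begin
    det (λ i j → u j * A i j)
      ≈⟨ det-expand (λ i j → u j * A i j) ⟩
    (sum λ j → sgn j * ((u j * A zero j) * det (λ i l → u (punchIn j l) * minor A j i l)))
      ≈⟨ sum-cong (λ j → begin
           sgn j * ((u j * A zero j) * det (λ i l → u (punchIn j l) * minor A j i l))
             ≈⟨ *-congˡ (*-congˡ (det-scale-columns (u ∘ punchIn j) (minor A j))) ⟩
           sgn j * ((u j * A zero j) * (∏ (u ∘ punchIn j) * det (minor A j)))
             ≈⟨ solve 5 (λ s u a p d → s :* ((u :* a) :* (p :* d)) := (u :* p) :* (s :* (a :* d))) refl _ _ _ _ _ ⟩
           (u j * ∏ (u ∘ punchIn j)) * (sgn j * (A zero j * det (minor A j)))
             ≈⟨ *-congʳ (∏-remove j u) ⟨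
           ∏ u * (sgn j * (A zero j * det (minor A j))) ∎) ⟩
    (sum λ j → ∏ u * (sgn j * (A zero j * det (minor A j))))
      ≈⟨ *-distribˡ-sum ⟨
    ∏ u * (sum λ j → sgn j * (A zero j * det (minor A j)))
      ≈⟨ *-congˡ (det-expand A) ⟨
    ∏ u * det A ∎

  -- Choosing one summand in every row is an element of `choices L`. With row lengths as labels,
  -- these choices become the candidate shapes of the branching rule.
  det-multilinear : ∀ {k} {S : Set} (L : Fin k → List S) (w : Fin k → S → Carrier) (G : Fin k → S → Fin k → Carrier) →
    det (λ i j → ∑ (L i) λ a → w i a * G i a j) ≈
    ∑ (choices L) λ p → (∏ λ i → w i (p i)) * det λ i j → G i (p i) j
  det-multilinear {zero} L w G = sym (trans (+-identityʳ _) (trans (*-congʳ (∏-one λ ())) (*-identityˡ 1#)))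
  det-multilinear {suc k} {S} L w G = begin
    det (λ i j → ∑ (L i) λ a → w i a * G i a j)
      ≈⟨ det-expand (λ i j → ∑ (L i) λ a → w i a * G i a j) ⟩
    (sum λ j → sgn j * ((∑ (L zero) λ a → w zero a * G zero a j) * det (λ i l → ∑ (L (suc i)) λ a → w (suc i) a * G (suc i) a (punchIn j l))))
      ≈⟨ sum-cong expand ⟩
    (sum λ j → ∑ (L zero) λ a → ∑ (choices (L ∘ suc)) λ p → (w zero a * W p) * (sgn j * (G zero a j * D j p)))
      ≈⟨ ∑-sum-swap (L zero) _ ⟨
    (∑ (L zero) λ a → sum λ j → ∑ (choices (L ∘ suc)) λ p → (w zero a * W p) * (sgn j * (G zero a j * D j p)))
      ≈⟨ ∑-cong (L zero) (λ a → trans (sym (∑-sum-swap (choices (L ∘ suc)) _))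
           (∑-cong (choices (L ∘ suc)) λ p → sym (*-distribˡ-sum))) ⟩
    (∑ (L zero) λ a → ∑ (choices (L ∘ suc)) λ p → (w zero a * W p) * (sum λ j → sgn j * (G zero a j * D j p)))
      ≈⟨ ∑-cong (L zero) (λ a → ∑-cong (choices (L ∘ suc)) λ p → *-cong (∏-suc _) (det-expand λ i j → G i (∀-cons {P = λ _ → S} a p i) j)) ⟨
    (∑ (L zero) λ a → ∑ (choices (L ∘ suc)) λ p → (∏ λ i → w i (∀-cons {P = λ _ → S} a p i)) * det (λ i j → G i (∀-cons {P = λ _ → S} a p i) j))
      ≈⟨ ∑-choices L (λ {g} {h} g≗h → *-cong
           (∏-cong λ i → reflexive (≡.cong (w i) (g≗h i)))
           (det-cong λ i j → reflexive (≡.cong (λ a → G i a j) (g≗h i)))) ⟨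
    (∑ (choices L) λ p → (∏ λ i → w i (p i)) * det λ i j → G i (p i) j) ∎
    where
    W : (Fin k → S) → Carrier
    W p = ∏ λ i → w (suc i) (p i)
    D : Fin (suc k) → (Fin k → S) → Carrier
    D j p = det λ i l → G (suc i) (p i) (punchIn j l)
    expand : ∀ j → sgn j * ((∑ (L zero) λ a → w zero a * G zero a j) * det (λ i l → ∑ (L (suc i)) λ a → w (suc i) a * G (suc i) a (punchIn j l))) ≈
                   (∑ (L zero) λ a → ∑ (choices (L ∘ suc)) λ p → (w zero a * W p) * (sgn j * (G zero a j * D j p)))
    expand j = begin
      sgn j * ((∑ (L zero) λ a → w zero a * G zero a j) * det (λ i l → ∑ (L (suc i)) λ a → w (suc i) a * G (suc i) a (punchIn j l)))
        ≈⟨ *-congˡ (*-congˡ (det-multilinear (L ∘ suc) (w ∘ suc) (λ i a l → G (suc i) a (punchIn j l)))) ⟩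
      sgn j * ((∑ (L zero) λ a → w zero a * G zero a j) * (∑ (choices (L ∘ suc)) λ p → W p * D j p))
        ≈⟨ *-congˡ (*-distribʳ-∑ _ (L zero) _) ⟩
      sgn j * (∑ (L zero) λ a → (w zero a * G zero a j) * (∑ (choices (L ∘ suc)) λ p → W p * D j p))
        ≈⟨ *-distribˡ-∑ _ (L zero) _ ⟩
      (∑ (L zero) λ a → sgn j * ((w zero a * G zero a j) * (∑ (choices (L ∘ suc)) λ p → W p * D j p)))
        ≈⟨ ∑-cong (L zero) (λ a → trans (*-congˡ (*-distribˡ-∑ _ (choices (L ∘ suc)) _)) (trans (*-distribˡ-∑ _ (choices (L ∘ suc)) _)
             (∑-cong (choices (L ∘ suc)) λ p →
               solve 5 (λ s w g W D → s :* ((w :* g) :* (W :* D)) := (w :* W) :* (s :* (g :* D))) refl _ _ _ _ _))) ⟩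
      (∑ (L zero) λ a → ∑ (choices (L ∘ suc)) λ p → (w zero a * W p) * (sgn j * (G zero a j * D j p))) ∎

-- Arithmetic of superscripts modulo n.

remainder-unique : ∀ {n ρ ρ′} k → ρ ℕ.< n → ρ′ ℕ.< n → + ρ ≡ + ρ′ ℤ.+ k ℤ.* + n → ρ ≡ ρ′
remainder-unique {n} {ρ} {ρ′} (+ zero)    ρ<n ρ′<n e = ℤ.+-injective (≡.trans e (≡.trans (≡.cong (λ z → + ρ′ ℤ.+ z) (ℤ.*-zeroˡ (+ n))) (ℤ.+-identityʳ _)))
remainder-unique {n} {ρ} {ρ′} (+ (suc k)) ρ<n ρ′<n e = contradiction ρ<n (ℕ.≤⇒≯ (≡.subst (n ℕ.≤_) (≡.sym ρ≡) (ℕ.≤-trans (ℕ.m≤m+n n (k ℕ.* n)) (ℕ.m≤n+m _ ρ′))))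
  where
  ρ≡ : ρ ≡ ρ′ ℕ.+ suc k ℕ.* n
  ρ≡ = ℤ.+-injective (≡.trans e (≡.cong (λ z → + ρ′ ℤ.+ z) (≡.sym (ℤ.pos-* (suc k) n))))
remainder-unique {n} {ρ} {ρ′} -[1+ k ] ρ<n ρ′<n e = ≡.sym (remainder-unique (+ (suc k)) ρ′<n ρ<n
  (≡.trans (lemma (+ ρ′) (+ (suc k)) (+ n)) (≡.cong (ℤ._+ + (suc k) ℤ.* + n) (≡.sym e))))
  where
  lemma : ∀ a k n → a ≡ a ℤ.+ (ℤ.- k) ℤ.* n ℤ.+ k ℤ.* n
  lemma = solve-∀

module _ {n : ℕ} .{{_ : NonZero n}} where
  -- The congruence is given by an explicit quotient `q`, which reduces an equality of superscripts
  -- to an identity between integers.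
  +ᶻ-cong : ∀ (r s : Fin n) w z q → + toℕ r ℤ.+ w ≡ + toℕ s ℤ.+ z ℤ.+ q ℤ.* + n → r +ᶻ w ≡ s +ᶻ z
  +ᶻ-cong r s w z q e = fromℕ<-cong _ _ (remainder-unique (b ℤ./ℕ n ℤ.+ q ℤ.- a ℤ./ℕ n) (n%ℕd<d a n) (n%ℕd<d b n)
    (lemma _ (+ (a %ℕ n)) (a ℤ./ℕ n) _ (+ (b %ℕ n)) (b ℤ./ℕ n) q (+ n) (a≡a%ℕn+[a/ℕn]*n a n) (a≡a%ℕn+[a/ℕn]*n b n) e)) _ _
    where
    a = + toℕ r ℤ.+ w
    b = + toℕ s ℤ.+ z
    ring : ∀ ρ′ q′ q k n → ρ′ ℤ.+ q′ ℤ.* n ℤ.+ q ℤ.* n ℤ.- k ℤ.* n ≡ ρ′ ℤ.+ (q′ ℤ.+ q ℤ.- k) ℤ.* n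
    ring = solve-∀
    ring′ : ∀ ρ k n → ρ ≡ ρ ℤ.+ k ℤ.* n ℤ.- k ℤ.* n
    ring′ = solve-∀
    lemma : ∀ a ρ k b ρ′ k′ q n → a ≡ ρ ℤ.+ k ℤ.* n → b ≡ ρ′ ℤ.+ k′ ℤ.* n → a ≡ b ℤ.+ q ℤ.* n →
            ρ ≡ ρ′ ℤ.+ (k′ ℤ.+ q ℤ.- k) ℤ.* n
    lemma a ρ k b ρ′ k′ q n ≡.refl ≡.refl e =
      ≡.trans (ring′ ρ k n) (≡.trans (≡.cong (ℤ._- k ℤ.* n) e) (ring ρ′ k′ q k n))

  toℕ-+ᶻ : ∀ (r : Fin n) z → + toℕ r ℤ.+ z ≡ + toℕ (r +ᶻ z) ℤ.+ ((+ toℕ r ℤ.+ z) /ℕ n) ℤ.* + n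
  toℕ-+ᶻ r z = ≡.trans (a≡a%ℕn+[a/ℕn]*n (+ toℕ r ℤ.+ z) n)
    (≡.cong (λ k → + k ℤ.+ ((+ toℕ r ℤ.+ z) /ℕ n) ℤ.* + n) (≡.sym (toℕ-fromℕ< (n%ℕd<d (+ toℕ r ℤ.+ z) n))))

  +ᶻ-assoc : ∀ (r : Fin n) w z → (r +ᶻ w) +ᶻ z ≡ r +ᶻ (w ℤ.+ z)
  +ᶻ-assoc r w z = ≡.sym (+ᶻ-cong r (r +ᶻ w) (w ℤ.+ z) z ((+ toℕ r ℤ.+ w) /ℕ n)
    (≡.trans (≡.sym (ℤ.+-assoc (+ toℕ r) w z)) (≡.trans (≡.cong (ℤ._+ z) (toℕ-+ᶻ r w)) (ring (+ toℕ (r +ᶻ w)) (((+ toℕ r ℤ.+ w) /ℕ n) ℤ.* + n) z))))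
    where
    ring : ∀ a b c → a ℤ.+ b ℤ.+ c ≡ a ℤ.+ c ℤ.+ b
    ring = solve-∀

  +ᶻ-identityʳ : ∀ (r : Fin n) → r +ᶻ (+ 0) ≡ r
  +ᶻ-identityʳ r = toℕ-injective (≡.trans (toℕ-fromℕ< (n%ℕd<d (+ toℕ r ℤ.+ + 0) n))
    (≡.trans (≡.cong (_%ℕ n) (ℤ.+-identityʳ (+ toℕ r))) (m<n⇒m%n≡m (toℕ<n r))))

  +ᶻ-periodic : ∀ (r : Fin n) z q → r +ᶻ (z ℤ.+ q ℤ.* + n) ≡ r +ᶻ z
  +ᶻ-periodic r z q = +ᶻ-cong r r (z ℤ.+ q ℤ.* + n) z q (≡.sym (ℤ.+-assoc (+ toℕ r) z (q ℤ.* + n)))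

  -- Superscripts in a run decrease from `r`, whereas `π` multiplies them in increasing order. The
  -- map t ↦ r - t matches the two and is its own inverse.
  reflection : Fin n → Permutation n n
  reflection r = permutation f f ff≡id ff≡id
    where
    f : Fin n → Fin n
    f t = r +ᶻ (ℤ.- + toℕ t)
    ring : ∀ a b t q n → a ℤ.+ (ℤ.- t) ≡ b ℤ.+ q ℤ.* n → a ℤ.+ (ℤ.- b) ≡ t ℤ.+ + 0 ℤ.+ q ℤ.* n
    ring a b t q n e = ≡.trans (ring₁ a b t) (≡.trans (≡.cong (λ c → c ℤ.+ (t ℤ.- b)) e) (ring₂ b t (q ℤ.* n)))
      where
      ring₁ : ∀ a b t → a ℤ.+ (ℤ.- b) ≡ a ℤ.+ (ℤ.- t) ℤ.+ (t ℤ.- b)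
      ring₁ = solve-∀
      ring₂ : ∀ b t c → b ℤ.+ c ℤ.+ (t ℤ.- b) ≡ t ℤ.+ + 0 ℤ.+ c
      ring₂ = solve-∀
    ff≡id : ∀ t → f (f t) ≡ t
    ff≡id t = ≡.trans (+ᶻ-cong r t (ℤ.- + toℕ (f t)) (+ 0) q (ring (+ toℕ r) (+ toℕ (f t)) (+ toℕ t) q (+ n) (toℕ-+ᶻ r (ℤ.- + toℕ t)))) (+ᶻ-identityʳ t)
      where q = (+ toℕ r ℤ.+ (ℤ.- + toℕ t)) /ℕ n

-- Words and their padding by the largest letter.

Monotone : ∀ {k m} → (Fin k → Fin m) → Set
Monotone q = ∀ t t′ → t Fin.≤ t′ → q t Fin.≤ q t′

words : ∀ k m → List (Fin k → Fin m)
words k m = choices λ _ → allFin m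

-- Meant for p ≤ k, when q is padded with the largest letter; for p > k it is cut.
pad : ∀ {m k} p → (Fin p → Fin m) → Fin k → Fin (suc m)
pad {m} zero    q t       = fromℕ m
pad     (suc p) q zero    = inject₁ (q zero)
pad     (suc p) q (suc t) = pad p (q ∘ suc) t

pad-cong : ∀ {m k} p {q q′ : Fin p → Fin m} → (∀ i → q i ≡ q′ i) → (t : Fin k) → pad p q t ≡ pad p q′ t
pad-cong zero    e t       = ≡.refl
pad-cong (suc p) e zero    = ≡.cong inject₁ (e zero)
pad-cong (suc p) e (suc t) = pad-cong p (e ∘ suc) t

pad-< : ∀ {m k} p (q : Fin p → Fin m) (i : Fin p) (t : Fin k) → toℕ i ≡ toℕ t → pad p q t ≡ inject₁ (q i)
pad-< (suc p) q zero    zero    e = ≡.refl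
pad-< (suc p) q (suc i) (suc t) e = pad-< p (q ∘ suc) i t (ℕ.suc-injective e)

pad-≥ : ∀ {m k} p (q : Fin p → Fin m) (t : Fin k) → p ℕ.≤ toℕ t → pad p q t ≡ fromℕ m
pad-≥ zero    q t       p≤t       = ≡.refl
pad-≥ (suc p) q (suc t) (s≤s p≤t) = pad-≥ p (q ∘ suc) t p≤t

pad-inject≤ : ∀ {m k} p (q : Fin p → Fin m) (p≤k : p ℕ.≤ k) i → pad p q (inject≤ i p≤k) ≡ inject₁ (q i)
pad-inject≤ p q p≤k i = pad-< p q i (inject≤ i p≤k) (≡.sym (toℕ-inject≤ i p≤k))

pad-cases : ∀ {m k} p (q : Fin p → Fin m) (t : Fin k) →
            (Σ[ i ∈ Fin p ] (toℕ i ≡ toℕ t) × (pad p q t ≡ inject₁ (q i))) ⊎ (p ℕ.≤ toℕ t) × (pad p q t ≡ fromℕ m)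
pad-cases p q t with p ℕ.≤? toℕ t
... | yes p≤t = inj₂ (p≤t , pad-≥ p q t p≤t)
... | no  p≰t = inj₁ (i , eq , pad-< p q i t eq)
  where
  i = Fin.fromℕ< (ℕ.≰⇒> p≰t)
  eq = toℕ-fromℕ< (ℕ.≰⇒> p≰t)

inject₁-≤ : ∀ {m} {i j : Fin m} → i Fin.≤ j → inject₁ i Fin.≤ inject₁ j
inject₁-≤ {i = i} {j} = ≡.subst₂ ℕ._≤_ (≡.sym (toℕ-inject₁ i)) (≡.sym (toℕ-inject₁ j))

inject₁-≤⁻ : ∀ {m} {i j : Fin m} → inject₁ i Fin.≤ inject₁ j → i Fin.≤ j
inject₁-≤⁻ {i = i} {j} = ≡.subst₂ ℕ._≤_ (toℕ-inject₁ i) (toℕ-inject₁ j)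

inject₁-<-fromℕ : ∀ {m} (i : Fin m) → inject₁ i Fin.< fromℕ m
inject₁-<-fromℕ {m} i = ≡.subst₂ ℕ._<_ (≡.sym (toℕ-inject₁ i)) (≡.sym (toℕ-fromℕ m)) (toℕ<n i)

pad-monotone : ∀ {m k} p (q : Fin p → Fin m) → Monotone q → Monotone (pad {k = k} p q)
pad-monotone p q mono t t′ t≤t′ with pad-cases p q t | pad-cases p q t′
... | _                 | inj₂ (_ , e′)       rewrite e′ = ≤fromℕ _
... | inj₁ (i , i≡ , e) | inj₁ (i′ , i′≡ , e′) rewrite e | e′ = inject₁-≤ (mono i i′ (≡.subst₂ ℕ._≤_ (≡.sym i≡) (≡.sym i′≡) t≤t′))
... | inj₂ (p≤t , e)    | inj₁ (i′ , i′≡ , e′) = contradiction (ℕ.≤-trans p≤t t≤t′) (ℕ.<⇒≱ (≡.subst (ℕ._< p) i′≡ (toℕ<n i′)))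

pad-monotone⁻ : ∀ {m k} p (q : Fin p → Fin m) → p ℕ.≤ k → Monotone (pad {k = k} p q) → Monotone q
pad-monotone⁻ p q p≤k mono i i′ i≤i′ = inject₁-≤⁻ (≡.subst₂ Fin._≤_ (pad-inject≤ p q p≤k i) (pad-inject≤ p q p≤k i′)
  (mono (inject≤ i p≤k) (inject≤ i′ p≤k) (≡.subst₂ ℕ._≤_ (≡.sym (toℕ-inject≤ i p≤k)) (≡.sym (toℕ-inject≤ i′ p≤k)) i≤i′)))

module _ {m : ℕ} where
  private
    length-filter-tabulate : ∀ {k} {A B : Set} (c : Fin m) (q : A → Fin m) (q′ : B → Fin m) (g : Fin k → A) (h : Fin k → B) →
      (∀ t → q (g t) ≡ q′ (h t)) →
      length (filter (λ a → q a ≟ c) (tabulate g)) ≡ length (filter (λ b → q′ b ≟ c) (tabulate h))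
    length-filter-tabulate {zero}  c q q′ g h e = ≡.refl
    length-filter-tabulate {suc k} c q q′ g h e rewrite e zero with q′ (h zero) ≟ c
    ... | yes _ = ≡.cong suc (length-filter-tabulate c q q′ (g ∘ suc) (h ∘ suc) (e ∘ suc))
    ... | no _  = length-filter-tabulate c q q′ (g ∘ suc) (h ∘ suc) (e ∘ suc)

    tail-occurrences : ∀ {k} (c : Fin m) (q : Fin (suc k) → Fin m) →
                       length (filter (λ t → q t ≟ c) (tabulate suc)) ≡ occurrences c (q ∘ suc)
    tail-occurrences c q = length-filter-tabulate c q (q ∘ suc) suc id λ _ → ≡.refl

  occurrences-cong : ∀ {k} {q q′ : Fin k → Fin m} → (∀ t → q t ≡ q′ t) → ∀ c → occurrences c q ≡ occurrences c q′
  occurrences-cong {q = q} {q′} e c = length-filter-tabulate c q q′ id id e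

  occurrences-≡ : ∀ {k} (c : Fin m) (q : Fin (suc k) → Fin m) → q zero ≡ c → occurrences c q ≡ suc (occurrences c (q ∘ suc))
  occurrences-≡ {k} c q e with q zero ≟ c
  ... | yes _ = ≡.cong suc (tail-occurrences c q)
  ... | no ¬e = contradiction e ¬e

  occurrences-≢ : ∀ {k} (c : Fin m) (q : Fin (suc k) → Fin m) → q zero ≢ c → occurrences c q ≡ occurrences c (q ∘ suc)
  occurrences-≢ {k} c q ¬e with q zero ≟ c
  ... | yes e = contradiction e ¬e
  ... | no _  = tail-occurrences c q

occurrences-pad-fromℕ : ∀ {m} k p (q : Fin p → Fin m) → p ℕ.≤ k → occurrences (fromℕ m) (pad {k = k} p q) ≡ k ∸ p
occurrences-pad-fromℕ zero    zero    q p≤k = ≡.refl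
occurrences-pad-fromℕ (suc k) zero    q p≤k =
  ≡.trans (occurrences-≡ (fromℕ _) (pad zero q) ≡.refl) (≡.cong suc (occurrences-pad-fromℕ k zero q z≤n))
occurrences-pad-fromℕ (suc k) (suc p) q (s≤s p≤k) =
  ≡.trans (occurrences-≢ (fromℕ _) (pad (suc p) q) (fromℕ≢inject₁ ∘ ≡.sym)) (occurrences-pad-fromℕ k p (q ∘ suc) p≤k)

occurrences-pad-inject₁ : ∀ {m} k p (q : Fin p → Fin m) c → p ℕ.≤ k → occurrences (inject₁ c) (pad {k = k} p q) ≡ occurrences c q
occurrences-pad-inject₁ zero    zero    q c p≤k = ≡.refl
occurrences-pad-inject₁ (suc k) zero    q c p≤k =
  ≡.trans (occurrences-≢ (inject₁ c) (pad zero q) fromℕ≢inject₁) (occurrences-pad-inject₁ k zero q c z≤n)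
occurrences-pad-inject₁ {m} (suc k) (suc p) q c (s≤s p≤k) = by-cases (q zero ≟ c)
  where
  by-cases : Dec (q zero ≡ c) → occurrences (inject₁ c) (pad {k = suc k} (suc p) q) ≡ occurrences c q
  by-cases (yes e) = ≡.trans (occurrences-≡ (inject₁ c) (pad (suc p) q) (≡.cong inject₁ e))
    (≡.trans (≡.cong suc (occurrences-pad-inject₁ k p (q ∘ suc) c p≤k)) (≡.sym (occurrences-≡ c q e)))
  by-cases (no ¬e) = ≡.trans (occurrences-≢ (inject₁ c) (pad (suc p) q) (¬e ∘ inject₁-injective))
    (≡.trans (occurrences-pad-inject₁ k p (q ∘ suc) c p≤k) (≡.sym (occurrences-≢ c q ¬e)))

module Words {c ℓ} (R : CommutativeRing c ℓ) where
  open CommutativeRing R hiding (zero)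
  open Sums R
  open SetoidReasoning setoid

  ∑-applyUpTo-∘ : ∀ {A B : Set} (g : ℕ → A) (h : A → B) k (f : B → Carrier) → ∑ (applyUpTo (h ∘ g) k) f ≈ ∑ (applyUpTo g k) (f ∘ h)
  ∑-applyUpTo-∘ g h zero    f = refl
  ∑-applyUpTo-∘ g h (suc k) f = +-congˡ (∑-applyUpTo-∘ (g ∘ suc) h k f)

  -- In a monotone word the copies of the largest letter form a suffix, so the word amounts to a
  -- length `p` and a word of that length in the smaller letters. Words that are not monotone
  -- contribute zero on either side.
  ∑-words-pad : ∀ {m} k {g : (Fin k → Fin (suc m)) → Carrier} → Extensional g → (∀ q → ¬ Monotone q → g q ≈ 0#) →
                ∑ (words k (suc m)) g ≈ ∑ (upTo (suc k)) λ p → ∑ (words p m) λ q → g (pad p q)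
  ∑-words-pad zero    ext van = trans (+-congʳ (ext λ ())) (sym (+-identityʳ _))
  ∑-words-pad {m} (suc k) {g} ext van = begin
    ∑ (words (suc k) (suc m)) g
      ≈⟨ ∑-choices (λ _ → allFin (suc m)) ext ⟩
    (∑ (allFin (suc m)) λ a → ∑ (words k (suc m)) λ q → g (a ∷′ q))
      ≈⟨ ∑-cong (allFin (suc m)) (λ a → ∑-words-pad k
           (λ q≗ → ext λ { zero → ≡.refl ; (suc t) → q≗ t })
           (λ q ¬mono → van (a ∷′ q) λ mono → ¬mono λ t t′ t≤t′ → mono (suc t) (suc t′) (s≤s t≤t′))) ⟩
    (∑ (allFin (suc m)) λ a → ∑ (upTo (suc k)) λ p → ∑ (words p m) λ q → g (a ∷′ pad p q))
      ≈⟨ ∑-tabulate id _ ⟩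
    (sum λ a → ∑ (upTo (suc k)) λ p → ∑ (words p m) λ q → g (a ∷′ pad p q))
      ≈⟨ sum-init-last _ ⟩
    (sum λ a → ∑ (upTo (suc k)) λ p → ∑ (words p m) λ q → g (inject₁ a ∷′ pad p q)) +
    (∑ (upTo (suc k)) λ p → ∑ (words p m) λ q → g (fromℕ m ∷′ pad p q))
      ≈⟨ +-cong (trans (sym (∑-tabulate id _)) (∑-swap (allFin m) (upTo (suc k)) _))
           (+-cong (+-congʳ (ext λ { zero → ≡.refl ; (suc t) → ≡.refl })) vanish) ⟩
    (∑ (upTo (suc k)) λ p → ∑ (allFin m) λ a → ∑ (words p m) λ q → g (inject₁ a ∷′ pad p q)) +
    ((∑ (words 0 m) λ q → g (pad zero q)) + 0#)
      ≈⟨ +-cong (∑-cong (upTo (suc k)) λ p → trans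
           (∑-cong (allFin m) λ a → ∑-cong (words p m) λ q → ext λ { zero → ≡.refl ; (suc t) → ≡.refl })
           (sym (∑-choices (λ _ → allFin m) λ {q} {q′} q≗q′ → ext (pad-cong (suc p) q≗q′)))) (+-identityʳ _) ⟩
    (∑ (upTo (suc k)) λ p → ∑ (words (suc p) m) λ q → g (pad (suc p) q)) + (∑ (words 0 m) λ q → g (pad zero q))
      ≈⟨ +-comm _ _ ⟩
    (∑ (words 0 m) λ q → g (pad zero q)) + (∑ (upTo (suc k)) λ p → ∑ (words (suc p) m) λ q → g (pad (suc p) q))
      ≈⟨ +-congˡ (∑-applyUpTo-∘ id suc (suc k) _) ⟨
    (∑ (upTo (suc (suc k))) λ p → ∑ (words p m) λ q → g (pad p q)) ∎
    where
    infixr 5 _∷′_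
    _∷′_ : ∀ {k} → Fin (suc m) → (Fin k → Fin (suc m)) → Fin (suc k) → Fin (suc m)
    _∷′_ = ∀-cons
    -- Once the first letter is the largest, monotonicity leaves only the constant word, which is
    -- the term p = 0.
    vanish : (∑ (applyUpTo suc k) λ p → ∑ (words p m) λ q → g (fromℕ m ∷′ pad p q)) ≈ 0#
    vanish = trans (∑-applyUpTo-∘ id suc k _)
      (trans (∑-cong-All (All.all-upTo k) λ p p<k → ∑-zero (words (suc p) m) (zeros p p<k)) (∑-zero (upTo k) λ _ → refl))
      where
      zeros : ∀ p → suc p ℕ.≤ k → ∀ q → g (fromℕ m ∷′ pad (suc p) q) ≈ 0#
      zeros p p≤k q = van _ λ mono → ℕ.<⇒≱ (inject₁-<-fromℕ (q zero))
        (≡.subst (fromℕ m Fin.≤_) (pad-inject≤ (suc p) q p≤k zero) (mono zero (suc (inject≤ zero p≤k)) z≤n))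

  -- The weight `h` depends on the letter and on its position, since superscripts move along the
  -- word; the padding therefore starts at position `p`.
  ∏-pad : ∀ {m} k p (q : Fin p → Fin m) (h : Fin (suc m) → ℕ → Carrier) → p ℕ.≤ k →
          (∏ λ (t : Fin k) → h (pad p q t) (toℕ t)) ≈
          (∏ λ t → h (inject₁ (q t)) (toℕ t)) * (∏ λ (t : Fin (k ∸ p)) → h (fromℕ m) (p ℕ.+ toℕ t))
  ∏-pad k zero    q h p≤k = sym (trans (*-congʳ (∏-one λ ())) (*-identityˡ _))
  ∏-pad (suc k) (suc p) q h (s≤s p≤k) = begin
    (∏ λ (t : Fin (suc k)) → h (pad (suc p) q t) (toℕ t))
      ≈⟨ ∏-suc _ ⟩
    h (inject₁ (q zero)) 0 * (∏ λ (t : Fin k) → h (pad p (q ∘ suc) t) (suc (toℕ t)))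
      ≈⟨ *-congˡ (∏-pad k p (q ∘ suc) (λ a → h a ∘ suc) p≤k) ⟩
    h (inject₁ (q zero)) 0 * (_ * _)
      ≈⟨ *-assoc _ _ _ ⟨
    (h (inject₁ (q zero)) 0 * _) * _
      ≈⟨ *-congʳ (∏-suc _) ⟨
    (∏ λ t → h (inject₁ (q t)) (toℕ t)) * (∏ λ (t : Fin (k ∸ p)) → h (fromℕ _) (suc p ℕ.+ toℕ t)) ∎

module _ {m n a : ℕ} (a≤m : a ℕ.≤ m) {k p : ℕ} (p≤k : p ℕ.≤ k) (q : Fin p → Fin m) where

  admissible-pad : Admissible n a m q → k ∸ p ℕ.≤ n ∸ 1 → Admissible n a (suc m) (pad {k = k} p q)
  admissible-pad (mono , range , count) d≤ = pad-monotone p q mono , range′ , count′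
    where
    range′ : ∀ t → a ℕ.≤ pos (pad p q t) × pos (pad p q t) ℕ.≤ suc m
    range′ t with pad-cases p q t
    ... | inj₁ (i , _ , e) rewrite e | toℕ-inject₁ (q i) = proj₁ (range i) , ℕ.m≤n⇒m≤1+n (proj₂ (range i))
    ... | inj₂ (_ , e) rewrite e | toℕ-fromℕ m = ℕ.m≤n⇒m≤1+n a≤m , ℕ.≤-refl
    count′ : ∀ c → a ℕ.< pos c → pos c ℕ.≤ suc m → occurrences c (pad {k = k} p q) ℕ.≤ n ∸ 1
    count′ c a<c c≤ with view c
    ... | ‵fromℕ     = ≡.subst (ℕ._≤ n ∸ 1) (≡.sym (occurrences-pad-fromℕ k p q p≤k)) d≤
    ... | ‵inject₁ c = ≡.subst (ℕ._≤ n ∸ 1) (≡.sym (occurrences-pad-inject₁ k p q c p≤k))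
                         (count c (≡.subst (λ i → a ℕ.< suc i) (toℕ-inject₁ c) a<c) (toℕ<n c))

  -- By `a≤m` the new letter lies strictly above `a`, so the multiplicity bound applies to it; its
  -- multiplicity is `k ∸ p`.
  admissible-pad⁻ : Admissible n a (suc m) (pad {k = k} p q) → Admissible n a m q × k ∸ p ℕ.≤ n ∸ 1
  admissible-pad⁻ (mono , range , count) = (pad-monotone⁻ p q p≤k mono , range′ , count′) ,
    ≡.subst (ℕ._≤ n ∸ 1) (occurrences-pad-fromℕ k p q p≤k)
      (count (fromℕ m) (≡.subst (λ i → a ℕ.< suc i) (≡.sym (toℕ-fromℕ m)) (s≤s a≤m)) (≡.subst (λ i → suc i ℕ.≤ suc m) (≡.sym (toℕ-fromℕ m)) ℕ.≤-refl))
    where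
    range′ : ∀ t → a ℕ.≤ pos (q t) × pos (q t) ℕ.≤ m
    range′ t = ≡.subst (λ i → a ℕ.≤ suc i) (≡.trans (≡.cong toℕ (pad-inject≤ p q p≤k t)) (toℕ-inject₁ (q t)))
                 (proj₁ (range (inject≤ t p≤k))) , toℕ<n (q t)
    count′ : ∀ c → a ℕ.< pos c → pos c ℕ.≤ m → occurrences c q ℕ.≤ n ∸ 1
    count′ c a<c c≤ = ≡.subst (ℕ._≤ n ∸ 1) (occurrences-pad-inject₁ k p q c p≤k)
      (count (inject₁ c) (≡.subst (λ i → a ℕ.< suc i) (≡.sym (toℕ-inject₁ c)) a<c)
        (≡.subst (λ i → suc i ℕ.≤ suc m) (≡.sym (toℕ-inject₁ c)) (ℕ.m≤n⇒m≤1+n c≤)))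

module _ {n : ℕ} .{{_ : NonZero n}} where
  infixl 6 _-ᶻ_
  _-ᶻ_ : Fin n → ℕ → Fin n
  r -ᶻ t = r +ᶻ (ℤ.- + t)

  -ᶻ-assoc : ∀ r s t → (r -ᶻ s) -ᶻ t ≡ r -ᶻ (s ℕ.+ t)
  -ᶻ-assoc r s t = ≡.trans (+ᶻ-assoc r (ℤ.- + s) (ℤ.- + t)) (≡.cong (r +ᶻ_) (≡.sym (ℤ.neg-distrib-+ (+ s) (+ t))))

  -ᶻ-n : ∀ r → r -ᶻ n ≡ r
  -ᶻ-n r = ≡.trans (≡.cong (r +ᶻ_) (≡.trans (≡.sym (ℤ.-1*i≡-i (+ n))) (≡.sym (ℤ.+-identityˡ _))))
    (≡.trans (+ᶻ-periodic r (+ 0) -[1+ 0 ]) (+ᶻ-identityʳ r))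

  1⊖suc : ∀ t → 1 ⊖ suc t ≡ ℤ.- + t
  1⊖suc t = ≡.trans (ℤ.[1+m]⊖[1+n]≡m⊖n 0 t) (ℤ.⊖-≤ z≤n)

-- The polynomials σ expanded in the last variable.

module Sigma {c ℓ} (R : CommutativeRing c ℓ) (N : ℕ) where
  open CommutativeRing R hiding (zero)
  open Sums R
  open Words R
  open SemiringSolver commutativeSemiring using (solve; _:+_; _:*_; _:=_)
  open SetoidReasoning setoid

  n : ℕ
  n = suc N

  Variables : ℕ → Set c
  Variables m = Fin m → Fin n → Carrier

  σ : ∀ {m} → Variables m → ℕ → Fin n → ℕ → Carrier
  σ {m} x k r a = LoopFunctions.σ R {m} {n} x k r a m

  π : ∀ {m} → Variables m → Fin m → Carrier
  π {m} x = LoopFunctions.π R {m} {n} x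

  σ-∑ : ∀ {m} (x : Variables m) k r a →
        σ x k r a ≈ ∑ (words k m) λ q → 𝟙 (admissible? n a m q) * (∏ λ t → x (q t) (r -ᶻ toℕ t))
  σ-∑ {m} x k r a = trans (∑-filter (admissible? n a m) (words k m) _)
    (∑-cong (words k m) λ q → *-congˡ (trans (∏-def _)
      (∏-cong λ t → reflexive (≡.cong (λ z → x (q t) (r +ᶻ z)) (1⊖suc {n} (toℕ t))))))

  private
    term : ∀ {m} (x : Variables m) k r a → (Fin k → Fin m) → Carrier
    term {m} x k r a q = 𝟙 (admissible? n a m q) * (∏ λ t → x (q t) (r -ᶻ toℕ t))

    term-ext : ∀ {m} (x : Variables m) k r a → Extensional (term x k r a)
    term-ext {m} x k r a {q} {q′} e = *-cong
      (𝟙-cong (admissible? n a m q) (admissible? n a m q′) (transfer e) (transfer (≡.sym ∘ e)))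
      (∏-cong λ t → reflexive (≡.cong (λ i → x i (r -ᶻ toℕ t)) (e t)))
      where
      transfer : ∀ {q q′ : Fin k → Fin m} → (∀ t → q t ≡ q′ t) → Admissible n a m q → Admissible n a m q′
      transfer e (mono , range , count) =
        (λ t t′ t≤t′ → ≡.subst₂ Fin._≤_ (e t) (e t′) (mono t t′ t≤t′)) ,
        (λ t → ≡.subst (λ i → a ℕ.≤ pos i × pos i ℕ.≤ m) (e t) (range t)) ,
        (λ c a<c c≤b → ≡.subst (ℕ._≤ N) (occurrences-cong e c) (count c a<c c≤b))

    term-vanishes : ∀ {m} (x : Variables m) k r a q → ¬ Monotone q → term x k r a q ≈ 0#
    term-vanishes {m} x k r a q ¬mono = trans (*-congʳ (𝟙-no (admissible? n a m q) (¬mono ∘ proj₁))) (zeroˡ _)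

    σ-pad : ∀ {m} (x : Variables (suc m)) k r a →
            σ x k r a ≈ ∑ (upTo (suc k)) λ p → ∑ (words p m) λ q → term x k r a (pad p q)
    σ-pad x k r a = trans (σ-∑ x k r a) (∑-words-pad k (term-ext x k r a) (term-vanishes x k r a))

    term-pad : ∀ {m} (x : Variables (suc m)) k r a → a ℕ.≤ m → ∀ p → p ℕ.≤ k → (q : Fin p → Fin m) →
      term x k r a (pad p q) ≈ (𝟙 (k ∸ p ℕ.≤? N) * (∏ λ (t : Fin (k ∸ p)) → x (fromℕ m) (r -ᶻ (p ℕ.+ toℕ t)))) * term (x ∘ inject₁) p r a q
    term-pad {m} x k r a a≤m p p≤k q = begin
      term x k r a (pad p q)
        ≈⟨ *-cong
             (trans (𝟙-cong (admissible? n a (suc m) (pad p q)) (admissible? n a m q ×-dec (k ∸ p ℕ.≤? N))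
                  (admissible-pad⁻ {n = n} a≤m p≤k q) (λ (adm , d≤) → admissible-pad {n = n} a≤m p≤k q adm d≤))
                (𝟙-× (admissible? n a m q) (k ∸ p ℕ.≤? N)))
             (∏-pad k p q (λ i t → x i (r -ᶻ t)) p≤k) ⟩
      (𝟙 (admissible? n a m q) * 𝟙 (k ∸ p ℕ.≤? N)) * (_ * _)
        ≈⟨ solve 4 (λ a d u v → (a :* d) :* (u :* v) := (d :* v) :* (a :* u)) refl _ _ _ _ ⟩
      (𝟙 (k ∸ p ℕ.≤? N) * _) * (𝟙 (admissible? n a m q) * _) ∎

  -- With a single variable allowed, the range condition leaves the constant word, and the
  -- multiplicity of the smallest letter is unrestricted.
  σ-top : ∀ {m} (x : Variables (suc m)) k r → σ x k r (suc m) ≈ ∏ λ (t : Fin k) → x (fromℕ m) (r -ᶻ toℕ t)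
  σ-top {m} x k r = begin
    σ x k r (suc m)
      ≈⟨ σ-pad x k r (suc m) ⟩
    (term x k r (suc m) (pad 0 λ ()) + 0#) + (∑ (applyUpTo suc k) λ p → ∑ (words p m) λ q → term x k r (suc m) (pad p q))
      ≈⟨ +-cong (+-identityʳ _) (trans (∑-applyUpTo-∘ id suc k _)
           (trans (∑-cong-All (All.all-upTo k) λ p p<k → ∑-zero (words (suc p) m) (vanish p p<k)) (∑-zero (upTo k) λ _ → refl))) ⟩
    term x k r (suc m) (pad 0 λ ()) + 0#
      ≈⟨ trans (+-identityʳ _) (trans (*-congʳ (𝟙-yes (admissible? n (suc m) (suc m) (pad {k = k} 0 λ ())) admissible)) (*-identityˡ _)) ⟩
    (∏ λ (t : Fin k) → x (fromℕ m) (r -ᶻ toℕ t)) ∎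
    where
    admissible : Admissible n (suc m) (suc m) {k} λ _ → fromℕ m
    admissible = (λ _ _ _ → ℕ.≤-refl) , (λ _ → ℕ.≤-reflexive (≡.sym top) , ℕ.≤-reflexive top) ,
                 λ c a<c c≤a → contradiction c≤a (ℕ.<⇒≱ a<c)
      where
      top : pos (fromℕ m) ≡ suc m
      top = ≡.cong suc (toℕ-fromℕ m)
    vanish : ∀ p → p ℕ.< k → ∀ q → term x k r (suc m) (pad (suc p) q) ≈ 0#
    vanish p p<k q = trans (*-congʳ (𝟙-no (admissible? n (suc m) (suc m) (pad {k = k} (suc p) q)) λ (_ , range , _) →
      ℕ.<⇒≱ (toℕ<n (q zero)) (ℕ.s≤s⁻¹ (≡.subst (λ i → suc m ℕ.≤ suc i)
        (≡.trans (≡.cong toℕ (pad-inject≤ (suc p) q p<k zero)) (toℕ-inject₁ (q zero))) (proj₁ (range (inject≤ zero p<k))))))) (zeroˡ _)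

  sum-+ : ∀ k l (f : ℕ → Carrier) → (sum λ (i : Fin (k ℕ.+ l)) → f (toℕ i)) ≈
          (sum λ (i : Fin k) → f (toℕ i)) + (sum λ (i : Fin l) → f (k ℕ.+ toℕ i))
  sum-+ zero    l f = sym (trans (+-congʳ (sum-zero λ ())) (+-identityˡ _))
  sum-+ (suc k) l f = begin
    (sum λ (i : Fin (suc k ℕ.+ l)) → f (toℕ i))                ≈⟨ sum-suc _ ⟩
    f 0 + (sum λ (i : Fin (k ℕ.+ l)) → f (suc (toℕ i)))        ≈⟨ +-congˡ (sum-+ k l (f ∘ suc)) ⟩
    f 0 + (_ + _)                                              ≈⟨ +-assoc _ _ _ ⟨
    (f 0 + _) + _                                              ≈⟨ +-congʳ (sum-suc _) ⟨
    (sum λ (i : Fin (suc k)) → f (toℕ i)) + (sum λ (i : Fin l) → f (suc k ℕ.+ toℕ i)) ∎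

  -- The p-th term collects the words in which the last variable occurs N ∸ p times.
  σ-last-variable : ∀ {m} (x : Variables (suc m)) K r a → a ℕ.≤ m →
    σ x (K ℕ.+ N) r a ≈ sum λ (p : Fin n) → σ (x ∘ inject₁) (K ℕ.+ toℕ p) r a *
      ∏ λ (t : Fin (N ∸ toℕ p)) → x (fromℕ m) (r -ᶻ (K ℕ.+ toℕ p ℕ.+ toℕ t))
  σ-last-variable {m} x K r a a≤m = begin
    σ x (K ℕ.+ N) r a
      ≈⟨ σ-pad x (K ℕ.+ N) r a ⟩
    (∑ (upTo (suc (K ℕ.+ N))) λ p → ∑ (words p m) λ q → term x (K ℕ.+ N) r a (pad p q))
      ≈⟨ ∑-cong-All (All.all-upTo (suc (K ℕ.+ N))) (λ p p<k →
           trans (∑-cong (words p m) (term-pad x (K ℕ.+ N) r a a≤m p (ℕ.s≤s⁻¹ p<k)))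
           (trans (sym (*-distribˡ-∑ _ (words p m) _))
           (trans (*-congˡ (sym (σ-∑ (x ∘ inject₁) p r a))) (*-assoc _ _ _)))) ⟩
    ∑ (upTo (suc (K ℕ.+ N))) f
      ≈⟨ ∑-applyUpTo id (suc (K ℕ.+ N)) f ⟩
    (sum λ (p : Fin (suc (K ℕ.+ N))) → f (toℕ p))
      ≡⟨ ≡.cong (λ k → sum λ (p : Fin k) → f (toℕ p)) (≡.sym (ℕ.+-suc K N)) ⟩
    (sum λ (p : Fin (K ℕ.+ n)) → f (toℕ p))
      ≈⟨ sum-+ K n f ⟩
    (sum λ (p : Fin K) → f (toℕ p)) + (sum λ (p : Fin n) → f (K ℕ.+ toℕ p))
      -- For p < K the word would need more than `N` copies of the last letter. The remaining
      -- lengths K, ..., K + N give exactly n terms.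
      ≈⟨ +-cong (sum-zero λ p → trans (*-congʳ (𝟙-no (K ℕ.+ N ∸ toℕ p ℕ.≤? N) (too-many p))) (zeroˡ _)) (sum-cong keep) ⟩
    0# + (sum λ (p : Fin n) → g p)
      ≈⟨ +-identityˡ _ ⟩
    (sum λ (p : Fin n) → g p) ∎
    where
    f : ℕ → Carrier
    f p = 𝟙 (K ℕ.+ N ∸ p ℕ.≤? N) * ((∏ λ (t : Fin (K ℕ.+ N ∸ p)) → x (fromℕ m) (r -ᶻ (p ℕ.+ toℕ t))) * σ (x ∘ inject₁) p r a)
    g : Fin n → Carrier
    g p = σ (x ∘ inject₁) (K ℕ.+ toℕ p) r a * ∏ λ (t : Fin (N ∸ toℕ p)) → x (fromℕ m) (r -ᶻ (K ℕ.+ toℕ p ℕ.+ toℕ t))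
    too-many : ∀ (p : Fin K) → ¬ K ℕ.+ N ∸ toℕ p ℕ.≤ N
    too-many p d≤N = ℕ.<⇒≱ (toℕ<n p) (ℕ.+-cancelʳ-≤ N K (toℕ p) (ℕ.≤-trans (ℕ.m≤n+m∸n (K ℕ.+ N) (toℕ p)) (ℕ.+-monoʳ-≤ (toℕ p) d≤N)))
    keep : ∀ p → f (K ℕ.+ toℕ p) ≈ g p
    keep p rewrite ℕ.[m+n]∸[m+o]≡n∸o K N (toℕ p) =
      trans (*-congʳ (𝟙-yes (N ∸ toℕ p ℕ.≤? N) (ℕ.m∸n≤m N (toℕ p)))) (trans (*-identityˡ _) (*-comm _ _))

∸-pos : ∀ {m} (j : Fin m) → m ∸ toℕ j ≡ suc (m ∸ pos j)
∸-pos {suc m} zero    = ≡.refl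
∸-pos {suc m} (suc j) = ∸-pos j

module Recurrence {c ℓ} (R : CommutativeRing c ℓ) (N : ℕ) where
  open CommutativeRing R hiding (zero)
  open Sums R
  open Sigma R N
  open RingProperties ring using ([y-z]x≈yx-zx)
  open SetoidReasoning setoid

  -- The `m ∸ pos j` letters above `j` fill at most `N * (m ∸ pos j)` places, so the longer words on
  -- the right all begin with `j`. Instead of a bijection of words, the proof strips off later
  -- variables until `j` is the last one, where `σ-top` applies.
  σ-first-variable : ∀ {m} (x : Variables m) (j : Fin m) K r → N ℕ.* (m ∸ pos j) ℕ.≤ K →
                     x j r * σ x K (r -ᶻ 1) (pos j) ≈ σ x (suc K) r (pos j)
  -- One more variable raises the critical degree by `N`. The expansions of both sides by
  -- `σ-last-variable` match term by term: the first variable is absorbed by induction, and starting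
  -- at `r -ᶻ 1` makes up for the shorter word in the superscripts of the last variable.
  σ-first-variable-step : ∀ {m} (x : Variables (suc m)) (j : Fin m) K r → N ℕ.* (m ∸ pos j) ℕ.≤ K →
                     x (inject₁ j) r * σ x (K ℕ.+ N) (r -ᶻ 1) (pos j) ≈ σ x (suc K ℕ.+ N) r (pos j)

  σ-first-variable {suc m} x j K r d≤K with view j
  ... | ‵fromℕ rewrite toℕ-fromℕ m = begin
    x (fromℕ m) r * σ x K (r -ᶻ 1) (suc m)
      ≈⟨ *-cong (reflexive (≡.cong (x (fromℕ m)) (≡.sym (+ᶻ-identityʳ r)))) (σ-top x K (r -ᶻ 1)) ⟩
    x (fromℕ m) (r -ᶻ 0) * (∏ λ (t : Fin K) → x (fromℕ m) (r -ᶻ 1 -ᶻ toℕ t))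
      ≈⟨ *-congˡ (∏-cong λ t → reflexive (≡.cong (x (fromℕ m)) (-ᶻ-assoc r 1 (toℕ t)))) ⟩
    x (fromℕ m) (r -ᶻ 0) * (∏ λ (t : Fin K) → x (fromℕ m) (r -ᶻ suc (toℕ t)))
      ≈⟨ ∏-suc _ ⟨
    (∏ λ (t : Fin (suc K)) → x (fromℕ m) (r -ᶻ toℕ t))
      ≈⟨ σ-top x (suc K) r ⟨
    σ x (suc K) r (suc m) ∎
  ... | ‵inject₁ j rewrite toℕ-inject₁ j | ∸-pos j | ℕ.*-suc N (m ∸ pos j) =
    ≡.subst (λ K → x (inject₁ j) r * σ x K (r -ᶻ 1) (pos j) ≈ σ x (suc K) r (pos j))
      (ℕ.m∸n+n≡m (ℕ.≤-trans (ℕ.m≤m+n N _) d≤K))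
      (σ-first-variable-step x j (K ∸ N) r (≡.subst (ℕ._≤ K ∸ N) (ℕ.m+n∸m≡n N _) (ℕ.∸-monoˡ-≤ N d≤K)))

  σ-first-variable-step {m} x j K r d≤K = begin
    x (inject₁ j) r * σ x (K ℕ.+ N) (r -ᶻ 1) (pos j)
      ≈⟨ *-congˡ (σ-last-variable x K (r -ᶻ 1) (pos j) (toℕ<n j)) ⟩
    x (inject₁ j) r * (sum λ (p : Fin n) → σ (x ∘ inject₁) (K ℕ.+ toℕ p) (r -ᶻ 1) (pos j) *
      ∏ λ (t : Fin (N ∸ toℕ p)) → x (fromℕ m) (r -ᶻ 1 -ᶻ (K ℕ.+ toℕ p ℕ.+ toℕ t)))
      ≈⟨ *-distribˡ-sum ⟩
    (sum λ (p : Fin n) → x (inject₁ j) r * (σ (x ∘ inject₁) (K ℕ.+ toℕ p) (r -ᶻ 1) (pos j) *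
      ∏ λ (t : Fin (N ∸ toℕ p)) → x (fromℕ m) (r -ᶻ 1 -ᶻ (K ℕ.+ toℕ p ℕ.+ toℕ t))))
      ≈⟨ sum-cong (λ p → trans (sym (*-assoc _ _ _)) (*-cong
           (σ-first-variable (x ∘ inject₁) j (K ℕ.+ toℕ p) r (ℕ.≤-trans d≤K (ℕ.m≤m+n K (toℕ p))))
           (∏-cong λ t → reflexive (≡.cong (x (fromℕ m)) (-ᶻ-assoc r 1 (K ℕ.+ toℕ p ℕ.+ toℕ t)))))) ⟩
    (sum λ (p : Fin n) → σ (x ∘ inject₁) (suc K ℕ.+ toℕ p) r (pos j) *
      ∏ λ (t : Fin (N ∸ toℕ p)) → x (fromℕ m) (r -ᶻ (suc K ℕ.+ toℕ p ℕ.+ toℕ t)))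
      ≈⟨ σ-last-variable x (suc K) r (pos j) (toℕ<n j) ⟨
    σ x (suc K ℕ.+ N) r (pos j) ∎

  σ-first-variables : ∀ {m} (x : Variables m) (j : Fin m) d K r → N ℕ.* (m ∸ pos j) ℕ.≤ K →
    (∏ λ (t : Fin d) → x j (r -ᶻ toℕ t)) * σ x K (r -ᶻ d) (pos j) ≈ σ x (d ℕ.+ K) r (pos j)
  σ-first-variables x j zero K r d≤K = trans (*-congʳ (∏-one λ ())) (trans (*-identityˡ _)
    (reflexive (≡.cong (λ r → σ x K r (pos j)) (+ᶻ-identityʳ r))))
  σ-first-variables x j (suc d) K r d≤K = begin
    (∏ λ (t : Fin (suc d)) → x j (r -ᶻ toℕ t)) * σ x K (r -ᶻ suc d) (pos j)
      ≈⟨ *-cong (trans (∏-suc _) (*-cong (reflexive (≡.cong (x j) (+ᶻ-identityʳ r)))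
           (∏-cong λ t → reflexive (≡.cong (x j) (≡.sym (-ᶻ-assoc r 1 (toℕ t)))))))
           (reflexive (≡.cong (λ r → σ x K r (pos j)) (≡.sym (-ᶻ-assoc r 1 d)))) ⟩
    (x j r * ∏ λ (t : Fin d) → x j (r -ᶻ 1 -ᶻ toℕ t)) * σ x K (r -ᶻ 1 -ᶻ d) (pos j)
      ≈⟨ trans (*-assoc _ _ _) (*-congˡ (σ-first-variables x j d K (r -ᶻ 1) d≤K)) ⟩
    x j r * σ x (d ℕ.+ K) (r -ᶻ 1) (pos j)
      ≈⟨ σ-first-variable x j (d ℕ.+ K) r (ℕ.≤-trans d≤K (ℕ.m≤n+m K d)) ⟩
    σ x (suc d ℕ.+ K) r (pos j) ∎

  π-run : ∀ {m} (x : Variables m) j r → (∏ λ (t : Fin n) → x j (r -ᶻ toℕ t)) ≈ π x j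
  π-run x j r = sym (trans (∏-def (x j)) (∏-permute (x j) (reflection r)))

  -- The left side is the sum of h (p + 1) and the first term on the right that of h p,
  -- for p = 0, …, N; so only h n and h 0 survive in the difference.
  σ-difference : ∀ {m} (x : Variables (suc m)) (j : Fin m) r → let K = N ℕ.* (m ∸ pos j) in
    x (inject₁ j) r * σ x (K ℕ.+ N) (r -ᶻ 1) (pos j) ≈
    x (fromℕ m) (r -ᶻ (K ℕ.+ N)) * σ x (K ℕ.+ N) r (pos j) +
    (π x (inject₁ j) - π x (fromℕ m)) * σ (x ∘ inject₁) K r (pos j)
  σ-difference {m} x j r = begin
    x (inject₁ j) r * σ x (K ℕ.+ N) (r -ᶻ 1) (pos j)
      ≈⟨ σ-first-variable-step x j K r ℕ.≤-refl ⟩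
    σ x (suc K ℕ.+ N) r (pos j)
      ≈⟨ σ-last-variable x (suc K) r (pos j) (toℕ<n j) ⟩
    (sum λ (p : Fin n) → σ (x ∘ inject₁) (suc K ℕ.+ toℕ p) r (pos j) *
      ∏ λ (t : Fin (N ∸ toℕ p)) → x (fromℕ m) (r -ᶻ (suc K ℕ.+ toℕ p ℕ.+ toℕ t)))
      ≈⟨ sum-cong (λ p → reflexive (≡.cong (λ k → σ (x ∘ inject₁) k r (pos j) *
           ∏ λ (t : Fin (N ∸ toℕ p)) → x (fromℕ m) (r -ᶻ (k ℕ.+ toℕ t))) (≡.sym (ℕ.+-suc K (toℕ p))))) ⟩
    (sum λ (p : Fin n) → h (suc (toℕ p)))
      ≈⟨ trans (sym (+-identityˡ _)) (trans (+-congʳ (sym (-‿inverseˡ _))) (trans (+-assoc _ _ _) (+-congˡ (sym (sum-suc (h ∘ toℕ)))))) ⟩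
    - h 0 + (sum λ (p : Fin (suc n)) → h (toℕ p))
      ≈⟨ +-congˡ (trans (sum-init-last _) (+-cong (sum-cong λ p → reflexive (≡.cong h (toℕ-inject₁ p))) (reflexive (≡.cong h (toℕ-fromℕ n))))) ⟩
    - h 0 + ((sum λ (p : Fin n) → h (toℕ p)) + h n)
      ≈⟨ trans (+-comm _ _) (+-assoc _ _ _) ⟩
    (sum λ (p : Fin n) → h (toℕ p)) + (h n - h 0)
      ≈⟨ +-cong (trans (sum-cong shift) (sym *-distribˡ-sum)) (trans (+-cong h-n (-‿cong h-0)) (sym ([y-z]x≈yx-zx _ _ _))) ⟩
    x (fromℕ m) (r -ᶻ (K ℕ.+ N)) * (sum λ (p : Fin n) → _) + (π x (inject₁ j) - π x (fromℕ m)) * σ (x ∘ inject₁) K r (pos j)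
      ≈⟨ +-congʳ (*-congˡ (σ-last-variable x K r (pos j) (toℕ<n j))) ⟨
    x (fromℕ m) (r -ᶻ (K ℕ.+ N)) * σ x (K ℕ.+ N) r (pos j) + (π x (inject₁ j) - π x (fromℕ m)) * σ (x ∘ inject₁) K r (pos j) ∎
    where
    K = N ℕ.* (m ∸ pos j)
    h : ℕ → Carrier
    h p = σ (x ∘ inject₁) (K ℕ.+ p) r (pos j) * ∏ λ (t : Fin (n ∸ p)) → x (fromℕ m) (r -ᶻ (K ℕ.+ p ℕ.+ toℕ t))
    -- At p = n no last variable is left and the degree exceeds the critical one by n, so a full
    -- cycle of the first variable splits off. At p = 0 it is the last variable that occurs n times,
    -- once with each superscript.
    h-n : h n ≈ π x (inject₁ j) * σ (x ∘ inject₁) K r (pos j)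
    h-n = begin
      h n
        ≈⟨ *-cong (reflexive (≡.cong (λ k → σ (x ∘ inject₁) k r (pos j)) (ℕ.+-comm K n)))
             (trans (reflexive (≡.cong (λ d → ∏ λ (t : Fin d) → x (fromℕ m) (r -ᶻ (K ℕ.+ n ℕ.+ toℕ t))) (ℕ.n∸n≡0 N))) (∏-one λ ())) ⟩
      σ (x ∘ inject₁) (n ℕ.+ K) r (pos j) * 1#
        ≈⟨ trans (*-identityʳ _) (sym (σ-first-variables (x ∘ inject₁) j n K r ℕ.≤-refl)) ⟩
      (∏ λ (t : Fin n) → x (inject₁ j) (r -ᶻ toℕ t)) * σ (x ∘ inject₁) K (r -ᶻ n) (pos j)
        ≈⟨ *-cong (π-run x (inject₁ j) r) (reflexive (≡.cong (λ r → σ (x ∘ inject₁) K r (pos j)) (-ᶻ-n r))) ⟩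
      π x (inject₁ j) * σ (x ∘ inject₁) K r (pos j) ∎
    h-0 : h 0 ≈ π x (fromℕ m) * σ (x ∘ inject₁) K r (pos j)
    h-0 = begin
      h 0
        ≡⟨ ≡.cong (λ k → σ (x ∘ inject₁) k r (pos j) * ∏ λ (t : Fin n) → x (fromℕ m) (r -ᶻ (k ℕ.+ toℕ t))) (ℕ.+-identityʳ K) ⟩
      σ (x ∘ inject₁) K r (pos j) * (∏ λ (t : Fin n) → x (fromℕ m) (r -ᶻ (K ℕ.+ toℕ t)))
        ≈⟨ *-congˡ (trans (∏-cong λ t → reflexive (≡.cong (x (fromℕ m)) (≡.sym (-ᶻ-assoc r K (toℕ t))))) (π-run x (fromℕ m) (r -ᶻ K))) ⟩
      σ (x ∘ inject₁) K r (pos j) * π x (fromℕ m)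
        ≈⟨ *-comm _ _ ⟩
      π x (fromℕ m) * σ (x ∘ inject₁) K r (pos j) ∎
    -- `h p` has n - p factors of the last variable, one more than the corresponding term of
    -- `σ-last-variable`. The extra one is the final factor, whose superscript does not depend on p.
    shift : ∀ (p : Fin n) → h (toℕ p) ≈ x (fromℕ m) (r -ᶻ (K ℕ.+ N)) *
      (σ (x ∘ inject₁) (K ℕ.+ toℕ p) r (pos j) * ∏ λ (t : Fin (N ∸ toℕ p)) → x (fromℕ m) (r -ᶻ (K ℕ.+ toℕ p ℕ.+ toℕ t)))
    shift p = begin
      h (toℕ p)
        ≡⟨ ≡.cong (λ d → s * ∏ λ (t : Fin d) → x (fromℕ m) (r -ᶻ (K ℕ.+ toℕ p ℕ.+ toℕ t))) (ℕ.+-∸-assoc 1 p≤N) ⟩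
      s * (∏ λ (t : Fin (suc (N ∸ toℕ p))) → x (fromℕ m) (r -ᶻ (K ℕ.+ toℕ p ℕ.+ toℕ t)))
        ≈⟨ *-congˡ (trans (∏-init-last _) (*-cong
             (∏-cong λ t → reflexive (≡.cong (λ t → x (fromℕ m) (r -ᶻ (K ℕ.+ toℕ p ℕ.+ t))) (toℕ-inject₁ t)))
             (reflexive (≡.cong (λ k → x (fromℕ m) (r -ᶻ k)) last)))) ⟩
      s * ((∏ λ (t : Fin (N ∸ toℕ p)) → x (fromℕ m) (r -ᶻ (K ℕ.+ toℕ p ℕ.+ toℕ t))) * x (fromℕ m) (r -ᶻ (K ℕ.+ N)))
        ≈⟨ trans (sym (*-assoc _ _ _)) (*-comm _ _) ⟩
      x (fromℕ m) (r -ᶻ (K ℕ.+ N)) * (s * ∏ λ (t : Fin (N ∸ toℕ p)) → x (fromℕ m) (r -ᶻ (K ℕ.+ toℕ p ℕ.+ toℕ t))) ∎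
      where
      s = σ (x ∘ inject₁) (K ℕ.+ toℕ p) r (pos j)
      p≤N : toℕ p ℕ.≤ N
      p≤N = ℕ.s≤s⁻¹ (toℕ<n p)
      last : K ℕ.+ toℕ p ℕ.+ toℕ (fromℕ (N ∸ toℕ p)) ≡ K ℕ.+ N
      last = ≡.trans (≡.cong (K ℕ.+ toℕ p ℕ.+_) (toℕ-fromℕ (N ∸ toℕ p)))
        (≡.trans (ℕ.+-assoc K (toℕ p) (N ∸ toℕ p)) (≡.cong (K ℕ.+_) (ℕ.m+[n∸m]≡n p≤N)))

-- The determinants b and their branching rule.

module _ {n : ℕ} .{{_ : NonZero n}} where
  +ᶻ-suc⊖suc : ∀ (r : Fin n) a t → r +ᶻ (suc a ⊖ suc t) ≡ r +ᶻ + a -ᶻ t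
  +ᶻ-suc⊖suc r a t = ≡.trans (≡.cong (r +ᶻ_) (≡.trans (ℤ.[1+m]⊖[1+n]≡m⊖n a t) (≡.sym (ℤ.m-n≡m⊖n a t))))
    (≡.sym (+ᶻ-assoc r (+ a) (ℤ.- + t)))

  +ᶻ-cancel : ∀ (r : Fin n) a d t → r +ᶻ + (a ℕ.+ d) -ᶻ (d ℕ.+ t) ≡ r +ᶻ + a -ᶻ t
  +ᶻ-cancel r a d t = ≡.trans (+ᶻ-assoc r (+ (a ℕ.+ d)) (ℤ.- + (d ℕ.+ t)))
    (≡.trans (≡.cong (r +ᶻ_) (≡.trans (≡.cong₂ (λ u v → u ℤ.- v) (ℤ.pos-+ a d) (ℤ.pos-+ d t)) (ring (+ a) (+ d) (+ t))))
    (≡.sym (+ᶻ-assoc r (+ a) (ℤ.- + t))))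
    where
    ring : ∀ a d t → a ℤ.+ d ℤ.- (d ℤ.+ t) ≡ a ℤ.- t
    ring = solve-∀

-- `N` is -1 modulo `suc N`, so lowering by `N * d` raises by `d`. With d = m - j this removes the
-- column from the superscript of the last variable.
-ᶻ-*-winding : ∀ {N} (r : Fin (suc N)) j a d → r +ᶻ + j -ᶻ a -ᶻ (N ℕ.* d) ≡ r +ᶻ + (j ℕ.+ d) -ᶻ a
-ᶻ-*-winding {N} r j a d = begin
  r +ᶻ + j -ᶻ a -ᶻ (N ℕ.* d)
    ≡⟨ ≡.trans (+ᶻ-assoc (r +ᶻ + j) (ℤ.- + a) (ℤ.- + (N ℕ.* d))) (+ᶻ-assoc r (+ j) (ℤ.- + a ℤ.- + (N ℕ.* d))) ⟩
  r +ᶻ (+ j ℤ.+ (ℤ.- + a ℤ.- + (N ℕ.* d)))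
    ≡⟨ ≡.cong (r +ᶻ_) (≡.trans (≡.cong (λ k → + j ℤ.+ (ℤ.- + a ℤ.- k)) (ℤ.pos-* N d)) (regroup (+ N) (+ j) (+ a) (+ d))) ⟩
  r +ᶻ (+ j ℤ.+ + d ℤ.- + a ℤ.+ (ℤ.- + d) ℤ.* (+ 1 ℤ.+ + N))
    ≡⟨ +ᶻ-periodic r (+ j ℤ.+ + d ℤ.- + a) (ℤ.- + d) ⟩
  r +ᶻ (+ j ℤ.+ + d ℤ.- + a)
    ≡⟨ +ᶻ-assoc r (+ (j ℕ.+ d)) (ℤ.- + a) ⟨
  r +ᶻ + (j ℕ.+ d) -ᶻ a ∎
  where
  open ≡.≡-Reasoning
  regroup : ∀ N j a d → j ℤ.+ (ℤ.- a ℤ.- N ℤ.* d) ≡ j ℤ.+ d ℤ.- a ℤ.+ (ℤ.- d) ℤ.* (+ 1 ℤ.+ N)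
  regroup = solve-∀

module Bialternants {c ℓ} (R : CommutativeRing c ℓ) (N : ℕ) where
  open CommutativeRing R hiding (zero)
  open Sums R
  open Determinant R
  open Determinants R
  open Sigma R N
  open Recurrence R N
  open SemiringSolver commutativeSemiring using (solve; _:+_; _:*_; _:=_)
  open SetoidReasoning setoid

  b : ∀ {m} → Variables m → Vector ℕ m → Fin n → Carrier
  b {m} x = LoopFunctions.b R {m} {n} x

  -- A row enters the matrix only through its exponent, so the entry is made a function of `a`, in
  -- which the recurrence runs. With columns counted from zero, the superscript r + j - 1 becomes
  -- `r +ᶻ + toℕ j`.
  entry : ∀ {m} → Variables m → Fin n → ℕ → Fin m → Carrier
  entry {m} x r a j = (∏ λ (t : Fin a) → x j (r +ᶻ + toℕ j -ᶻ toℕ t)) * σ x (N ℕ.* (m ∸ pos j)) (r +ᶻ + toℕ j -ᶻ a) (pos j)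

  b-entry : ∀ {m} (x : Variables m) α r → b x α r ≈ det λ i j → entry x r (α i) j
  b-entry {m} x α r = det-cong λ i j → *-cong
    (trans (∏-def _) (∏-cong λ t → reflexive (≡.cong (x j) (+ᶻ-suc⊖suc r (toℕ j) (toℕ t)))))
    (reflexive (≡.cong (λ s → σ x (N ℕ.* (m ∸ pos j)) s (pos j)) (+ᶻ-suc⊖suc r (toℕ j) (α i))))

  κ : ∀ {m} → Variables (suc m) → Fin m → Carrier
  κ {m} x j = π x (inject₁ j) - π x (fromℕ m)

  module _ {m} (x : Variables (suc m)) (r : Fin n) where
    top : ℕ → Carrier
    top a = x (fromℕ m) (r +ᶻ + m -ᶻ a)

    entry-inject₁ : ∀ a j → entry x r a (inject₁ j) ≈
      (∏ λ (t : Fin a) → x (inject₁ j) (r +ᶻ + toℕ j -ᶻ toℕ t)) * σ x (N ℕ.* (m ∸ pos j) ℕ.+ N) (r +ᶻ + toℕ j -ᶻ a) (pos j)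
    entry-inject₁ a j rewrite toℕ-inject₁ j | ∸-pos j | ℕ.*-suc N (m ∸ pos j) | ℕ.+-comm N (N ℕ.* (m ∸ pos j)) = refl

    -- The longer run ends at superscript `s -ᶻ a`, just above the one where its σ starts, so
    -- `σ-difference` applies there; `superscript` then frees the coefficient from `j`.
    entry-suc-inject₁ : ∀ a j → entry x r (suc a) (inject₁ j) ≈ top a * entry x r a (inject₁ j) + κ x j * entry (x ∘ inject₁) r a j
    entry-suc-inject₁ a j = begin
      entry x r (suc a) (inject₁ j)
        ≈⟨ entry-inject₁ (suc a) j ⟩
      (∏ λ (t : Fin (suc a)) → x (inject₁ j) (s -ᶻ toℕ t)) * σ x (K ℕ.+ N) (s -ᶻ suc a) (pos j)
        ≈⟨ *-cong (trans (∏-init-last _) (*-cong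
               (∏-cong λ t → reflexive (≡.cong (λ t → x (inject₁ j) (s -ᶻ t)) (toℕ-inject₁ t)))
               (reflexive (≡.cong (λ t → x (inject₁ j) (s -ᶻ t)) (toℕ-fromℕ a)))))
             (reflexive (≡.cong (λ s → σ x (K ℕ.+ N) s (pos j))
               (≡.sym (≡.trans (-ᶻ-assoc s a 1) (≡.cong (s -ᶻ_) (ℕ.+-comm a 1)))))) ⟩
      (P * x (inject₁ j) (s -ᶻ a)) * σ x (K ℕ.+ N) (s -ᶻ a -ᶻ 1) (pos j)
        ≈⟨ trans (*-assoc _ _ _) (*-congˡ (σ-difference x j (s -ᶻ a))) ⟩
      P * (x (fromℕ m) (s -ᶻ a -ᶻ (K ℕ.+ N)) * σ x (K ℕ.+ N) (s -ᶻ a) (pos j) + κ x j * σ (x ∘ inject₁) K (s -ᶻ a) (pos j))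
        ≈⟨ solve 5 (λ p v w k u → p :* (v :* w :+ k :* u) := v :* (p :* w) :+ k :* (p :* u)) refl _ _ _ _ _ ⟩
      x (fromℕ m) (s -ᶻ a -ᶻ (K ℕ.+ N)) * (P * σ x (K ℕ.+ N) (s -ᶻ a) (pos j)) + κ x j * (P * σ (x ∘ inject₁) K (s -ᶻ a) (pos j))
        ≈⟨ +-congʳ (*-cong (reflexive (≡.cong (x (fromℕ m)) superscript)) (sym (entry-inject₁ a j))) ⟩
      top a * entry x r a (inject₁ j) + κ x j * entry (x ∘ inject₁) r a j ∎
      where
      K = N ℕ.* (m ∸ pos j)
      s = r +ᶻ + toℕ j
      P = ∏ λ (t : Fin a) → x (inject₁ j) (s -ᶻ toℕ t)
      d = m ∸ toℕ j
      K+N≡ : K ℕ.+ N ≡ N ℕ.* d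
      K+N≡ = ≡.trans (ℕ.+-comm K N) (≡.trans (≡.sym (ℕ.*-suc N (m ∸ pos j))) (≡.cong (N ℕ.*_) (≡.sym (∸-pos j))))
      superscript : s -ᶻ a -ᶻ (K ℕ.+ N) ≡ r +ᶻ + m -ᶻ a
      superscript = ≡.trans (≡.cong (s -ᶻ a -ᶻ_) K+N≡) (≡.trans (-ᶻ-*-winding r (toℕ j) a d)
        (≡.cong (λ k → r +ᶻ + k -ᶻ a) (ℕ.m+[n∸m]≡n (ℕ.<⇒≤ (toℕ<n j)))))

    entry-fromℕ : ∀ a → entry x r a (fromℕ m) ≈ ∏ λ (t : Fin a) → top (toℕ t)
    entry-fromℕ a rewrite toℕ-fromℕ m | ℕ.n∸n≡0 m | ℕ.*-zeroʳ N =
      trans (*-congˡ (trans (σ-top x 0 (r +ᶻ + m -ᶻ a)) (∏-one λ ()))) (*-identityʳ _)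

    -- The summand `0#` gives the last column the same form of recurrence as the others, so that
    -- `telescope-row` treats both.
    entry-suc-fromℕ : ∀ a → entry x r (suc a) (fromℕ m) ≈ top a * entry x r a (fromℕ m) + 0#
    entry-suc-fromℕ a = begin
      entry x r (suc a) (fromℕ m)
        ≈⟨ trans (entry-fromℕ (suc a)) (∏-init-last _) ⟩
      (∏ λ (t : Fin a) → top (toℕ (inject₁ t))) * top (toℕ (fromℕ a))
        ≈⟨ *-cong (trans (∏-cong λ t → reflexive (≡.cong top (toℕ-inject₁ t))) (sym (entry-fromℕ a))) (reflexive (≡.cong top (toℕ-fromℕ a))) ⟩
      entry x r a (fromℕ m) * top a
        ≈⟨ trans (*-comm _ _) (sym (+-identityʳ _)) ⟩
      top a * entry x r a (fromℕ m) + 0# ∎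

  -- Iterates the recurrence from `lo` up to `hi`. The sum runs over all p ≤ hi with an indicator,
  -- not from `lo`, so that its range is the one used for row lengths and the interlacing condition
  -- becomes a factor.
  telescope : ∀ (F v G : ℕ → Carrier) → (∀ a → F (suc a) ≈ v a * F a + G a) → ∀ lo hi → lo ℕ.≤ hi →
    F (suc hi) ≈ (sum λ (p : Fin (suc hi)) → (𝟙 (lo ℕ.≤? toℕ p) * ∏ λ (t : Fin (hi ∸ toℕ p)) → v (suc (toℕ p ℕ.+ toℕ t))) * G (toℕ p)) +
                 (∏ λ (t : Fin (suc hi ∸ lo)) → v (lo ℕ.+ toℕ t)) * F lo
  telescope F v G rec zero zero _ = begin
    F 1
      ≈⟨ rec 0 ⟩
    v 0 * F 0 + G 0
      ≈⟨ +-comm _ _ ⟩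
    G 0 + v 0 * F 0
      ≈⟨ +-cong
           (trans (sum-suc _) (trans (+-cong (trans (*-congʳ (trans (*-identityˡ _) (∏-one λ ()))) (*-identityˡ _)) (sum-zero λ ())) (+-identityʳ _)))
           (*-congʳ (trans (∏-suc _) (trans (*-congˡ (∏-one λ ())) (*-identityʳ _)))) ⟨
    _ ∎
  telescope F v G rec zero (suc hi) _ = begin
    F (suc (suc hi))
      ≈⟨ telescope (F ∘ suc) (v ∘ suc) (G ∘ suc) (rec ∘ suc) zero hi z≤n ⟩
    S + V * F 1
      ≈⟨ +-congˡ (*-congˡ (rec 0)) ⟩
    S + V * (v 0 * F 0 + G 0)
      ≈⟨ solve 5 (λ S V v f g → S :+ V :* (v :* f :+ g) := (V :* g :+ S) :+ (v :* V) :* f) refl S V (v 0) (F 0) (G 0) ⟩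
    (V * G 0 + S) + (v 0 * V) * F 0
      ≈⟨ +-cong (trans (sum-suc _) (+-congʳ (*-congʳ (*-identityˡ _)))) (*-congʳ (∏-suc _)) ⟨
    _ ∎
    where
    S = sum λ (p : Fin (suc hi)) → (𝟙 (0 ℕ.≤? toℕ p) * ∏ λ (t : Fin (hi ∸ toℕ p)) → v (suc (suc (toℕ p ℕ.+ toℕ t)))) * G (suc (toℕ p))
    V = ∏ λ (t : Fin (suc hi)) → v (suc (toℕ t))
  telescope F v G rec (suc lo) (suc hi) (s≤s lo≤hi) = begin
    F (suc (suc hi))
      ≈⟨ telescope (F ∘ suc) (v ∘ suc) (G ∘ suc) (rec ∘ suc) lo hi lo≤hi ⟩
    _ + _
      ≈⟨ +-congʳ (trans (sum-suc _) (trans (+-cong (trans (*-congʳ (zeroˡ _)) (zeroˡ _))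
           (sum-cong λ p → *-congʳ (*-congʳ (𝟙-cong (suc lo ℕ.≤? suc (toℕ p)) (lo ℕ.≤? toℕ p) ℕ.s≤s⁻¹ s≤s)))) (+-identityˡ _))) ⟨
    _ ∎

  -- The weight of the boxes of row `i` beyond the first `p` when they hold the largest letter. The
  -- indicator is one half of interlacing; the other half, p ≤ ν_i, is left to the range of
  -- summation.
  stripWeight : ∀ {m} → Variables (suc m) → Fin n → Vector ℕ (suc m) → Fin m → ℕ → Carrier
  stripWeight {m} x r ν i p = 𝟙 (ν (suc i) ℕ.≤? p) *
    ∏ λ (t : Fin (ν (inject₁ i) ∸ p)) → x (fromℕ m) (r +ᶻ + toℕ i -ᶻ (p ℕ.+ toℕ t))

  lastRowWeight : ∀ {m} → Variables (suc m) → Fin n → Vector ℕ (suc m) → Carrier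
  lastRowWeight {m} x r ν = ∏ λ (t : Fin (ν (fromℕ m))) → x (fromℕ m) (r +ᶻ + m -ᶻ toℕ t)

  module _ {m} (x : Variables (suc m)) (r : Fin n) (ν : Vector ℕ (suc m)) (ν-partition : IsPartition ν) where
    private
      ν+δ : Vector ℕ (suc m)
      ν+δ = zipWith ℕ._+_ ν δ

      shapes : Fin m → List ℕ
      shapes i = upTo (suc (ν (inject₁ i)))

      A : Fin (suc m) → Fin (suc m) → Carrier
      A i j = entry x r (ν+δ i) j

      A₀ : Fin m → Fin m → Carrier
      A₀ i j = κ x j * ∑ (shapes i) λ p → stripWeight x r ν i p * entry (x ∘ inject₁) r (p ℕ.+ (m ∸ pos i)) j

      A′ : Fin (suc m) → Fin (suc m) → Carrier
      A′ = snoc (λ i → snoc (A₀ i) 0#) (A (fromℕ m))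

      q : Fin m → Carrier
      q i = ∏ λ (t : Fin (suc (ν (inject₁ i)) ∸ ν (suc i))) → top x r (ν (suc i) ℕ.+ toℕ t ℕ.+ (m ∸ pos i))

      -- Relative to the offset `m ∸ pos i`, rows i and i + 1 have exponents `suc (ν (inject₁ i))`
      -- and `ν (suc i)`, so the recurrence iterated between them ends in a multiple of row i + 1.
      -- The offset is also the i-th entry of `δ` for m variables, which puts the exponents of the
      -- summands in the form p + δ.
      telescope-row : ∀ i j (G : ℕ → Carrier) → (∀ a → entry x r (suc a) j ≈ top x r a * entry x r a j + G a) →
        A (inject₁ i) j ≈ (∑ (shapes i) λ p → stripWeight x r ν i p * G (p ℕ.+ (m ∸ pos i))) + q i * A (suc i) j
      telescope-row i j G rec = begin
        A (inject₁ i) j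
          ≡⟨ ≡.cong (λ a → entry x r a j) (≡.trans (≡.cong (ν (inject₁ i) ℕ.+_) (≡.trans (≡.cong (m ∸_) (toℕ-inject₁ i)) (∸-pos i))) (ℕ.+-suc _ _)) ⟩
        entry x r (suc (ν (inject₁ i)) ℕ.+ (m ∸ pos i)) j
          ≈⟨ telescope (λ a → entry x r (a ℕ.+ (m ∸ pos i)) j) (λ a → top x r (a ℕ.+ (m ∸ pos i))) (λ a → G (a ℕ.+ (m ∸ pos i)))
               (λ a → rec (a ℕ.+ (m ∸ pos i))) (ν (suc i)) (ν (inject₁ i)) (ν-partition (inject₁ i) (suc i) (ℕ.≤-trans (ℕ.≤-reflexive (toℕ-inject₁ i)) (ℕ.n≤1+n _))) ⟩
        _ + q i * A (suc i) j
          ≈⟨ +-congʳ (trans (∑-applyUpTo id (suc (ν (inject₁ i))) _)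
               (sum-cong λ p → *-congʳ (*-congˡ (∏-cong λ t → reflexive (≡.cong (x (fromℕ m)) (superscript (toℕ p ℕ.+ toℕ t))))))) ⟨
        (∑ (shapes i) λ p → stripWeight x r ν i p * G (p ℕ.+ (m ∸ pos i))) + q i * A (suc i) j ∎
        where
        -- With the offset taken out, the superscript of `top` becomes that of the box in row `i`
        -- and column `t`, both counted from zero.
        superscript : ∀ t → r +ᶻ + toℕ i -ᶻ t ≡ r +ᶻ + m -ᶻ (suc t ℕ.+ (m ∸ pos i))
        superscript t = ≡.trans (≡.sym (+ᶻ-cancel r (toℕ i) (suc (m ∸ pos i)) t))
          (≡.cong₂ (λ k l → r +ᶻ + k -ᶻ l)
            (≡.trans (≡.cong (toℕ i ℕ.+_) (≡.sym (∸-pos i))) (ℕ.m+[n∸m]≡n (ℕ.<⇒≤ (toℕ<n i))))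
            (≡.cong suc (ℕ.+-comm (m ∸ pos i) t)))

      row-operations : ∀ i j → A (inject₁ i) j ≈ A′ (inject₁ i) j + q i * A (suc i) j
      row-operations i j rewrite snoc-inject₁ {A = λ _ → Fin (suc m) → Carrier} (λ i → snoc (A₀ i) 0#) (A (fromℕ m)) i with view j
      ... | ‵fromℕ rewrite snoc-fromℕ {A = λ _ → Carrier} (A₀ i) 0# =
        trans (telescope-row i (fromℕ m) (λ _ → 0#) (entry-suc-fromℕ x r)) (+-congʳ (∑-zero (shapes i) λ p → zeroʳ _))
      ... | ‵inject₁ j rewrite snoc-inject₁ {A = λ _ → Carrier} (A₀ i) 0# j =
        trans (telescope-row i (inject₁ j) (λ a → κ x j * entry (x ∘ inject₁) r a j) (λ a → entry-suc-inject₁ x r a j))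
          (+-congʳ (trans (∑-cong (shapes i) λ p → solve 3 (λ w k e → w :* (k :* e) := k :* (w :* e)) refl _ _ _) (sym (*-distribˡ-∑ _ (shapes i) _))))

    b-branching : b x ν+δ r ≈ (∏ (κ x) * lastRowWeight x r ν) *
      (∑ (choices λ i → upTo (suc (ν (inject₁ i)))) λ p → (∏ λ i → stripWeight x r ν i (p i)) * b (x ∘ inject₁) (zipWith ℕ._+_ p δ) r)
    b-branching = begin
      b x ν+δ r
        ≈⟨ b-entry x ν+δ r ⟩
      det A
        ≈⟨ det-row-operations A A′ q row-operations (λ j → reflexive (≡.cong (λ row → row j) (≡.sym last-row))) ⟩
      det A′
        ≈⟨ det-last-column A′ (λ i → reflexive (≡.trans (≡.cong (λ row → row (fromℕ m)) (row i)) (snoc-fromℕ {A = λ _ → Carrier} (A₀ i) 0#))) ⟩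
      det (λ i j → A′ (inject₁ i) (inject₁ j)) * A′ (fromℕ m) (fromℕ m)
        ≈⟨ *-cong (det-cong {m} λ i j → reflexive (≡.trans (≡.cong (λ row → row (inject₁ j)) (row i)) (snoc-inject₁ {A = λ _ → Carrier} (A₀ i) 0# j)))
             (trans (reflexive (≡.cong (λ row → row (fromℕ m)) last-row)) (trans (reflexive (≡.cong (λ a → entry x r a (fromℕ m)) last-length)) (entry-fromℕ x r (ν (fromℕ m))))) ⟩
      det A₀ * lastRowWeight x r ν
        ≈⟨ *-congʳ (trans (det-scale-columns (κ x) _) (*-congˡ (det-multilinear shapes (stripWeight x r ν) λ i p → entry (x ∘ inject₁) r (p ℕ.+ (m ∸ pos i))))) ⟩
      (∏ (κ x) * (∑ (choices shapes) λ p → (∏ λ i → stripWeight x r ν i (p i)) * det (λ i j → entry (x ∘ inject₁) r (p i ℕ.+ (m ∸ pos i)) j))) * lastRowWeight x r ν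
        ≈⟨ solve 3 (λ a b c → (a :* b) :* c := (a :* c) :* b) refl _ _ _ ⟩
      (∏ (κ x) * lastRowWeight x r ν) * (∑ (choices shapes) λ p → (∏ λ i → stripWeight x r ν i (p i)) * det (λ i j → entry (x ∘ inject₁) r (p i ℕ.+ (m ∸ pos i)) j))
        ≈⟨ *-congˡ (∑-cong (choices shapes) λ p → *-congˡ (b-entry (x ∘ inject₁) (zipWith ℕ._+_ p δ) r)) ⟨
      _ ∎
      where
      last-row : A′ (fromℕ m) ≡ A (fromℕ m)
      last-row = snoc-fromℕ {A = λ _ → Fin (suc m) → Carrier} (λ i → snoc (A₀ i) 0#) (A (fromℕ m))
      row : ∀ i → A′ (inject₁ i) ≡ snoc (A₀ i) 0#
      row i = snoc-inject₁ {A = λ _ → Fin (suc m) → Carrier} (λ i → snoc (A₀ i) 0#) (A (fromℕ m)) i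
      last-length : ν+δ (fromℕ m) ≡ ν (fromℕ m)
      last-length = ≡.trans (≡.cong (ν (fromℕ m) ℕ.+_) (≡.trans (≡.cong (m ∸_) (toℕ-fromℕ m)) (ℕ.n∸n≡0 m))) (ℕ.+-identityʳ _)

-- Semistandard tableaux and the boxes with the largest entry.

semistandard-cong : ∀ {m} (ν : Vector ℕ m) {T T′ : Filling ν} → (∀ i j → T i j ≡ T′ i j) → Semistandard ν T → Semistandard ν T′
semistandard-cong ν e (rows , cols) =
  (λ i j j′ j≤j′ → ≡.subst₂ Fin._≤_ (e i j) (e i j′) (rows i j j′ j≤j′)) ,
  (λ i i′ j j′ i<i′ j≡j′ → ≡.subst₂ Fin._<_ (e i j) (e i′ j′) (cols i i′ j j′ i<i′ j≡j′))

-- A box below the first row has a box above it because `ν` is a partition, and that entry is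
-- strictly smaller. In the last row this leaves only the largest letter.
semistandard-entry-≥ : ∀ {m} (ν : Vector ℕ m) → IsPartition ν → (T : Filling ν) → Semistandard ν T → ∀ i j → i Fin.≤ T i j
semistandard-entry-≥ {zero}  ν ν-partition T ss ()
semistandard-entry-≥ {suc m} ν ν-partition T (_ , cols) = <-weakInduction (λ i → ∀ j → i Fin.≤ T i j) (λ _ → z≤n) step
  where
  step : ∀ i → (∀ j → inject₁ i Fin.≤ T (inject₁ i) j) → ∀ j → suc i Fin.≤ T (suc i) j
  step i ih j = ℕ.≤-trans (s≤s (≡.subst (ℕ._≤ toℕ (T (inject₁ i) j↑)) (toℕ-inject₁ i) (ih j↑))) (cols (inject₁ i) (suc i) j↑ j i<1+i (≡.cong suc (toℕ-inject≤ j shorter)))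
    where
    i<1+i : inject₁ i Fin.< suc i
    i<1+i = s≤s (ℕ.≤-reflexive (toℕ-inject₁ i))
    shorter : ν (suc i) ℕ.≤ ν (inject₁ i)
    shorter = ν-partition (inject₁ i) (suc i) (ℕ.<⇒≤ i<1+i)
    j↑ : Fin (ν (inject₁ i))
    j↑ = inject≤ j shorter

-- T is T₀ with its rows filled up to the shape ν by the largest letter.
module _ {m} (ν : Vector ℕ (suc m)) (ν-partition : IsPartition ν) (p : Vector ℕ m) (p≤ν : ∀ i → p i ℕ.≤ ν (inject₁ i))
         (T : Filling ν) (T₀ : Filling p) (init : ∀ i j → T (inject₁ i) j ≡ pad (p i) (T₀ i) j)
         (last : ∀ j → T (fromℕ m) j ≡ fromℕ m) where
  private
    entry≡ : ∀ i j → T (inject₁ i) (inject≤ j (p≤ν i)) ≡ inject₁ (T₀ i j)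
    entry≡ i j = ≡.trans (init i _) (pad-inject≤ (p i) (T₀ i) (p≤ν i) j)

    toℕ-entry : ∀ i j → toℕ (T (inject₁ i) (inject≤ j (p≤ν i))) ≡ toℕ (T₀ i j)
    toℕ-entry i j = ≡.trans (≡.cong toℕ (entry≡ i j)) (toℕ-inject₁ (T₀ i j))

  -- Otherwise the first padded box of row i has a box below it, whose entry would have to exceed
  -- the largest letter.
  semistandard-interlacing : Semistandard ν T → ∀ i → ν (suc i) ℕ.≤ p i
  semistandard-interlacing (_ , cols) i with ν (suc i) ℕ.≤? p i
  ... | yes ν≤p = ν≤p
  ... | no  ν≰p = contradiction
    (≡.subst (Fin._< T (suc i) j) (≡.trans (init i j↑) (pad-≥ (p i) (T₀ i) j↑ (ℕ.≤-reflexive (≡.sym toℕ-j↑))))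
      (cols (inject₁ i) (suc i) j↑ j i<1+i (≡.cong suc (toℕ-inject≤ j shorter))))
    (ℕ.≤⇒≯ (≤fromℕ (T (suc i) j)))
    where
    i<1+i : inject₁ i Fin.< suc i
    i<1+i = s≤s (ℕ.≤-reflexive (toℕ-inject₁ i))
    shorter : ν (suc i) ℕ.≤ ν (inject₁ i)
    shorter = ν-partition (inject₁ i) (suc i) (ℕ.<⇒≤ i<1+i)
    j : Fin (ν (suc i))
    j = fromℕ< (ℕ.≰⇒> ν≰p)
    j↑ : Fin (ν (inject₁ i))
    j↑ = inject≤ j shorter
    toℕ-j↑ : toℕ j↑ ≡ p i
    toℕ-j↑ = ≡.trans (toℕ-inject≤ j shorter) (toℕ-fromℕ< (ℕ.≰⇒> ν≰p))

  semistandard-restrict : Semistandard ν T → Semistandard p T₀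
  semistandard-restrict (rows , cols) =
    (λ i j j′ j≤j′ → ≡.subst₂ ℕ._≤_ (toℕ-entry i j) (toℕ-entry i j′)
      (rows (inject₁ i) (inject≤ j (p≤ν i)) (inject≤ j′ (p≤ν i))
        (≡.subst₂ ℕ._≤_ (≡.sym (toℕ-inject≤ j (p≤ν i))) (≡.sym (toℕ-inject≤ j′ (p≤ν i))) j≤j′))) ,
    (λ i i′ j j′ i<i′ j≡j′ → ≡.subst₂ ℕ._<_ (toℕ-entry i j) (toℕ-entry i′ j′)
      (cols (inject₁ i) (inject₁ i′) (inject≤ j (p≤ν i)) (inject≤ j′ (p≤ν i′))
        (≡.subst₂ ℕ._<_ (≡.sym (toℕ-inject₁ i)) (≡.sym (toℕ-inject₁ i′)) i<i′)
        (≡.trans (≡.cong suc (toℕ-inject≤ j (p≤ν i))) (≡.trans j≡j′ (≡.cong suc (≡.sym (toℕ-inject≤ j′ (p≤ν i′))))))))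

  semistandard-extend : (∀ i → ν (suc i) ℕ.≤ p i) → Semistandard p T₀ → Semistandard ν T
  semistandard-extend ν≤p (rows , cols) = rows′ , cols′
    where
    rows′ : ∀ i (j j′ : Fin (ν i)) → j Fin.≤ j′ → T i j Fin.≤ T i j′
    rows′ i j j′ j≤j′ with view i
    ... | ‵fromℕ     rewrite last j | last j′ = ℕ.≤-refl
    ... | ‵inject₁ i rewrite init i j | init i j′ = pad-monotone (p i) (T₀ i) (rows i) j j′ j≤j′

    -- By interlacing, a box with another one below it in its column lies inside `p`, so its entry
    -- is not the largest letter.
    short : ∀ i i′ (j : Fin (ν (inject₁ i))) (j′ : Fin (ν i′)) → inject₁ i Fin.< i′ → pos j ≡ pos j′ → toℕ j ℕ.< p i
    short i i′ j j′ i<i′ j≡j′ = ℕ.≤-trans (≡.subst (ℕ._≤ ν i′) (≡.sym j≡j′) (toℕ<n j′))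
      (ℕ.≤-trans (ν-partition (suc i) i′ (≡.subst (ℕ._< toℕ i′) (toℕ-inject₁ i) i<i′)) (ν≤p i))

    cols′ : ∀ i i′ (j : Fin (ν i)) (j′ : Fin (ν i′)) → i Fin.< i′ → pos j ≡ pos j′ → T i j Fin.< T i′ j′
    cols′ i i′ j j′ i<i′ j≡j′ with view i
    ... | ‵fromℕ = contradiction i<i′ (ℕ.≤⇒≯ (≤fromℕ i′))
    ... | ‵inject₁ i with pad-cases (p i) (T₀ i) j
    ...   | inj₂ (p≤j , _) = contradiction (short i i′ j j′ i<i′ j≡j′) (ℕ.≤⇒≯ p≤j)
    ...   | inj₁ (j₀ , j₀≡j , e) rewrite init i j | e with view i′
    ...     | ‵fromℕ rewrite last j′ = inject₁-<-fromℕ (T₀ i j₀)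
    ...     | ‵inject₁ i′ with pad-cases (p i′) (T₀ i′) j′
    ...       | inj₂ (_ , e′) rewrite init i′ j′ | e′ = inject₁-<-fromℕ (T₀ i j₀)
    ...       | inj₁ (j₀′ , j₀′≡j′ , e′) rewrite init i′ j′ | e′ =
      ≡.subst₂ ℕ._<_ (≡.sym (toℕ-inject₁ (T₀ i j₀))) (≡.sym (toℕ-inject₁ (T₀ i′ j₀′)))
        (cols i i′ j₀ j₀′ (≡.subst₂ ℕ._<_ (toℕ-inject₁ i) (toℕ-inject₁ i′) i<i′)
          (≡.trans (≡.cong suc j₀≡j) (≡.trans j≡j′ (≡.cong suc (≡.sym j₀′≡j′)))))

-- Sums over fillings with rows of varying length.

module Rows {c ℓ} (R : CommutativeRing c ℓ) where
  open CommutativeRing R hiding (zero)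
  open Sums R
  open Words R
  open SetoidReasoning setoid

  Row : ℕ → Set
  Row m = ∃ λ l → Fin l → Fin m

  arrays : ∀ {k} m (ν : Vector ℕ k) → List (∀ i → Fin (ν i) → Fin m)
  arrays m ν = choices λ i → words (ν i) m

  -- Rows carry their lengths, so that a change of ν does not change the type of the summand.
  ∑-rows : ∀ {k m} → Vector ℕ k → ((Fin k → Row m) → Carrier) → Carrier
  ∑-rows {m = m} ν f = ∑ (arrays m ν) λ T → f λ i → ν i , T i

  ∑-rows-suc : ∀ {k m} (ν : Vector ℕ (suc k)) {f : (Fin (suc k) → Row m) → Carrier} → Extensional f →
               ∑-rows ν f ≈ ∑ (words (ν zero) m) λ w → ∑-rows (ν ∘ suc) λ ρ → f (∀-cons (ν zero , w) ρ)
  ∑-rows-suc {m = m} ν {f} ext = trans (∑-choices (λ i → words (ν i) m) λ T≗ → ext λ i → ≡.cong (ν i ,_) (T≗ i))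
    (∑-cong (words (ν zero) m) λ w → ∑-cong (arrays m (ν ∘ suc)) λ T → ext λ { zero → ≡.refl ; (suc i) → ≡.refl })

  ∀-cons-cong : ∀ {k} {A : Fin (suc k) → Set} {f : (∀ i → A i) → Carrier} → Extensional f →
                ∀ a → Extensional {A = A ∘ suc} λ g → f (∀-cons a g)
  ∀-cons-cong ext a g≗ = ext λ { zero → ≡.refl ; (suc i) → g≗ i }

  ∑-rows-cong : ∀ {k m} {ν ν′ : Vector ℕ k} {f : (Fin k → Row m) → Carrier} → Extensional f →
                (∀ i → ν i ≡ ν′ i) → ∑-rows ν f ≈ ∑-rows ν′ f
  ∑-rows-cong {zero}  ext e = +-congʳ (ext λ ())
  ∑-rows-cong {suc k} {m} {ν} {ν′} {f} ext e = begin
    ∑-rows ν f                                                                            ≈⟨ ∑-rows-suc ν ext ⟩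
    (∑ (words (ν zero) m) λ w → ∑-rows (ν ∘ suc) λ ρ → f (∀-cons (ν zero , w) ρ))         ≡⟨ ≡.cong (λ l → ∑ (words l m) λ w → ∑-rows (ν ∘ suc) λ ρ → f (∀-cons (l , w) ρ)) (e zero) ⟩
    (∑ (words (ν′ zero) m) λ w → ∑-rows (ν ∘ suc) λ ρ → f (∀-cons (ν′ zero , w) ρ))       ≈⟨ ∑-cong (words (ν′ zero) m) (λ w → ∑-rows-cong (∀-cons-cong ext (ν′ zero , w)) (e ∘ suc)) ⟩
    (∑ (words (ν′ zero) m) λ w → ∑-rows (ν′ ∘ suc) λ ρ → f (∀-cons (ν′ zero , w) ρ))      ≈⟨ ∑-rows-suc ν′ ext ⟨
    ∑-rows ν′ f                                                                           ∎

  Extensional₂ : ∀ {k m} {ν : Vector ℕ k} → ((∀ i → Fin (ν i) → Fin m) → Carrier) → Set ℓ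
  Extensional₂ f = ∀ {T T′} → (∀ i j → T i j ≡ T′ i j) → f T ≈ f T′

  Extensional₂⇒Extensional : ∀ {k m} {ν : Vector ℕ k} {f : (∀ i → Fin (ν i) → Fin m) → Carrier} → Extensional₂ f → Extensional f
  Extensional₂⇒Extensional ext e = ext λ i j → ≡.cong (λ w → w j) (e i)

  padRows : ∀ {k m} (ν : Vector ℕ k) → (Fin k → Row m) → ∀ i → Fin (ν i) → Fin (suc m)
  padRows ν ρ i = pad (proj₁ (ρ i)) (proj₂ (ρ i))

  -- `∑-words-pad` is applied in each row; the lengths of the unpadded parts, collected over all
  -- rows, form the shape `p`.
  ∑-arrays-pad : ∀ {k m} (ν : Vector ℕ k) {f : (∀ i → Fin (ν i) → Fin (suc m)) → Carrier} → Extensional₂ f →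
    (∀ T i → ¬ Monotone (T i) → f T ≈ 0#) →
    ∑ (arrays (suc m) ν) f ≈ ∑ (choices λ i → upTo (suc (ν i))) λ p → ∑-rows p (f ∘ padRows ν)
  ∑-arrays-pad {zero}  ν ext van = trans (+-congʳ (ext λ ())) (sym (+-identityʳ _))
  ∑-arrays-pad {suc k} {m} ν {f} ext van = begin
    ∑ (arrays (suc m) ν) f
      ≈⟨ ∑-choices (λ i → words (ν i) (suc m)) (Extensional₂⇒Extensional ext) ⟩
    (∑ (words (ν zero) (suc m)) λ w → ∑ (arrays (suc m) (ν ∘ suc)) λ T → f (∀-cons w T))
      ≈⟨ ∑-cong (words (ν zero) (suc m)) (λ w → ∑-arrays-pad (ν ∘ suc)
           (λ e → ext λ { zero j → ≡.refl ; (suc i) j → e i j }) (λ T i → van (∀-cons w T) (suc i))) ⟩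
    (∑ (words (ν zero) (suc m)) λ w → ∑ shapes λ p → ∑-rows p λ ρ → f (∀-cons w (padRows (ν ∘ suc) ρ)))
      ≈⟨ ∑-words-pad (ν zero)
           (λ e → ∑-cong shapes λ p → ∑-cong (arrays m p) λ T → ext λ { zero j → e j ; (suc i) j → ≡.refl })
           (λ w ¬mono → ∑-zero shapes λ p → ∑-zero (arrays m p) λ T → van _ zero ¬mono) ⟩
    (∑ (upTo (suc (ν zero))) λ l → ∑ (words l m) λ w → ∑ shapes λ p → ∑-rows p λ ρ → f (∀-cons (pad l w) (padRows (ν ∘ suc) ρ)))
      ≈⟨ ∑-cong (upTo (suc (ν zero))) (λ l → trans (∑-swap (words l m) shapes _) (∑-cong shapes λ p →
           trans (∑-cong (words l m) λ w → ∑-cong (arrays m p) λ T → ext λ { zero j → ≡.refl ; (suc i) j → ≡.refl })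
                 (sym (∑-rows-suc (∀-cons l p) f-ext)))) ⟩
    (∑ (upTo (suc (ν zero))) λ l → ∑ shapes λ p → ∑-rows (∀-cons l p) (f ∘ padRows ν))
      ≈⟨ ∑-choices (λ i → upTo (suc (ν i))) (∑-rows-cong f-ext) ⟨
    (∑ (choices λ i → upTo (suc (ν i))) λ p → ∑-rows p (f ∘ padRows ν)) ∎
    where
    shapes : List (Fin k → ℕ)
    shapes = choices λ i → upTo (suc (ν (suc i)))
    f-ext : Extensional (f ∘ padRows ν)
    f-ext e = ext λ i j → ≡.cong (λ (l , w) → pad l w j) (e i)

  ∏-𝟙 : ∀ {k} {P : Fin k → Set} (P? : ∀ i → Dec (P i)) → (∏ λ i → 𝟙 (P? i)) ≈ 𝟙 (all? P?)
  ∏-𝟙 {zero}  P? = trans (∏-one λ ()) (sym (𝟙-yes (all? P?) λ ()))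
  ∏-𝟙 {suc k} P? = begin
    (∏ λ i → 𝟙 (P? i))                    ≈⟨ ∏-suc _ ⟩
    𝟙 (P? zero) * (∏ λ i → 𝟙 (P? (suc i))) ≈⟨ *-congˡ (∏-𝟙 (P? ∘ suc)) ⟩
    𝟙 (P? zero) * 𝟙 (all? (P? ∘ suc))      ≈⟨ 𝟙-× (P? zero) (all? (P? ∘ suc)) ⟨
    𝟙 (P? zero ×-dec all? (P? ∘ suc))      ≈⟨ 𝟙-cong (P? zero ×-dec all? (P? ∘ suc)) (all? P?) (λ { (a , b) zero → a ; (a , b) (suc i) → b i }) (λ a → a zero , a ∘ suc) ⟩
    𝟙 (all? P?)                            ∎

-- The branching rule for loop Schur functions.

module LoopSchur {c ℓ} (R : CommutativeRing c ℓ) (N : ℕ) where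
  open CommutativeRing R hiding (zero)
  open Sums R
  open Words R
  open Rows R
  open Sigma R N
  open Bialternants R N
  open SemiringSolver commutativeSemiring using (solve; _:+_; _:*_; _:=_)
  open SetoidReasoning setoid

  loopSchur : ∀ {m} → Variables m → Vector ℕ m → Fin n → Carrier
  loopSchur {m} x = LoopFunctions.loopSchur R {m} {n} x

  weight : ∀ {m} → Variables m → Fin n → (ν : Vector ℕ m) → Filling ν → Carrier
  weight x r ν T = 𝟙 (semistandard? ν T) * (∏ λ i → ∏ λ j → x (T i j) (r +ᶻ + toℕ i -ᶻ toℕ j))

  loopSchur-∑ : ∀ {m} (x : Variables m) ν r → loopSchur x ν r ≈ ∑ (arrays m ν) (weight x r ν)
  loopSchur-∑ {m} x ν r = trans (∑-filter (semistandard? ν) (fillings ν) _)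
    (∑-cong (fillings ν) λ T → *-congˡ (trans (∏-def _) (∏-cong λ i → trans (∏-def _)
      (∏-cong λ j → reflexive (≡.cong (x (T i j)) (+ᶻ-suc⊖suc r (toℕ i) (toℕ j)))))))

  weight-ext : ∀ {m} (x : Variables m) r ν → Extensional₂ (weight x r ν)
  weight-ext x r ν {T} {T′} e = *-cong
    (𝟙-cong (semistandard? ν T) (semistandard? ν T′) (semistandard-cong ν e) (semistandard-cong ν λ i j → ≡.sym (e i j)))
    (∏-cong λ i → ∏-cong λ j → reflexive (≡.cong (λ a → x a (r +ᶻ + toℕ i -ᶻ toℕ j)) (e i j)))

  weight-vanishes : ∀ {m} (x : Variables m) r ν T → ¬ Semistandard ν T → weight x r ν T ≈ 0#
  weight-vanishes x r ν T ¬ss = trans (*-congʳ (𝟙-no (semistandard? ν T) ¬ss)) (zeroˡ _)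

  module _ {m} (x : Variables (suc m)) (r : Fin n) (ν : Vector ℕ (suc m)) (ν-partition : IsPartition ν) where
    private
      _▷_ : (∀ i → Fin (ν (inject₁ i)) → Fin (suc m)) → (Fin (ν (fromℕ m)) → Fin (suc m)) → Filling ν
      T ▷ w = snoc {A = λ i → Fin (ν i) → Fin (suc m)} T w

      ▷-init : ∀ T w i j → (T ▷ w) (inject₁ i) j ≡ T i j
      ▷-init T w i j = ≡.cong (λ row → row j) (snoc-inject₁ {A = λ i → Fin (ν i) → Fin (suc m)} T w i)

      ▷-last : ∀ T w j → (T ▷ w) (fromℕ m) j ≡ w j
      ▷-last T w j = ≡.cong (λ row → row j) (snoc-fromℕ {A = λ i → Fin (ν i) → Fin (suc m)} T w)

      ▷-cong : ∀ {T T′ w w′} → (∀ i j → T i j ≡ T′ i j) → (∀ j → w j ≡ w′ j) → ∀ i j → (T ▷ w) i j ≡ (T′ ▷ w′) i j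
      ▷-cong e e′ = snoc-cong {A = λ i → Fin (ν i) → Fin (suc m)} (λ w w′ → ∀ j → w j ≡ w′ j) e e′

      row-monotone : ∀ T → Semistandard ν T → ∀ i → Monotone (T i)
      row-monotone T (rows , _) i = rows i

      top-row : Fin (ν (fromℕ m)) → Fin (suc m)
      top-row _ = fromℕ m

      g : Filling ν → Carrier
      g = weight x r ν

      -- All entries of the last row are forced by `semistandard-entry-≥`, so of the padded words
      -- only `pad 0`, the constant one, survives.
      last-row : ∀ T → (∑ (words (ν (fromℕ m)) (suc m)) λ w → g (T ▷ w)) ≈ g (T ▷ top-row)
      last-row T = begin
        (∑ (words (ν (fromℕ m)) (suc m)) λ w → g (T ▷ w))
          ≈⟨ ∑-words-pad (ν (fromℕ m)) (λ e → weight-ext x r ν (▷-cong (λ _ _ → ≡.refl) e))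
               (λ w ¬mono → weight-vanishes x r ν (T ▷ w) λ ss → ¬mono λ t t′ t≤t′ →
                 ≡.subst₂ Fin._≤_ (▷-last T w t) (▷-last T w t′) (row-monotone (T ▷ w) ss (fromℕ m) t t′ t≤t′)) ⟩
        (g (T ▷ pad 0 λ ()) + 0#) + (∑ (applyUpTo suc (ν (fromℕ m))) λ p → ∑ (words p m) λ w → g (T ▷ pad p w))
          ≈⟨ +-cong (trans (+-identityʳ _) (weight-ext x r ν (▷-cong (λ _ _ → ≡.refl) λ _ → ≡.refl)))
               (trans (∑-applyUpTo-∘ id suc (ν (fromℕ m)) _)
               (trans (∑-cong-All (All.all-upTo (ν (fromℕ m))) λ p p<ν → ∑-zero (words (suc p) m) (vanish p p<ν)) (∑-zero (upTo (ν (fromℕ m))) λ _ → refl))) ⟩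
        g (T ▷ top-row) + 0#
          ≈⟨ +-identityʳ _ ⟩
        g (T ▷ top-row) ∎
        where
        vanish : ∀ p → p ℕ.< ν (fromℕ m) → ∀ w → g (T ▷ pad (suc p) w) ≈ 0#
        vanish p p<ν w = weight-vanishes x r ν (T ▷ pad (suc p) w) λ ss →
          ℕ.<⇒≱ (inject₁-<-fromℕ (w zero))
            (≡.subst (fromℕ m Fin.≤_) (≡.trans (▷-last T (pad (suc p) w) (inject≤ zero p<ν)) (pad-inject≤ (suc p) w p<ν zero))
              (semistandard-entry-≥ ν ν-partition (T ▷ pad (suc p) w) ss (fromℕ m) (inject≤ zero p<ν)))

      module _ (p : Vector ℕ m) (p≤ν : ∀ i → p i ℕ.≤ ν (inject₁ i)) (T₀ : Filling p) where
        private
          T : Filling ν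
          T = padRows (ν ∘ inject₁) (λ i → p i , T₀ i) ▷ top-row

          T-init : ∀ i j → T (inject₁ i) j ≡ pad (p i) (T₀ i) j
          T-init = ▷-init (padRows (ν ∘ inject₁) (λ i → p i , T₀ i)) top-row

          T-last : ∀ j → T (fromℕ m) j ≡ fromℕ m
          T-last = ▷-last (padRows (ν ∘ inject₁) (λ i → p i , T₀ i)) top-row

          interlaces? : Dec (∀ i → ν (suc i) ℕ.≤ p i)
          interlaces? = all? λ i → ν (suc i) ℕ.≤? p i

          strip : Fin m → Carrier
          strip i = ∏ λ (t : Fin (ν (inject₁ i) ∸ p i)) → x (fromℕ m) (r +ᶻ + toℕ i -ᶻ (p i ℕ.+ toℕ t))

          indicator : 𝟙 (semistandard? ν T) ≈ (∏ λ i → 𝟙 (ν (suc i) ℕ.≤? p i)) * 𝟙 (semistandard? p T₀)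
          indicator = begin
            𝟙 (semistandard? ν T)
              ≈⟨ 𝟙-cong (semistandard? ν T) (interlaces? ×-dec semistandard? p T₀)
                   (λ ss → semistandard-interlacing ν ν-partition p p≤ν T T₀ T-init T-last ss ,
                           semistandard-restrict ν ν-partition p p≤ν T T₀ T-init T-last ss)
                   (λ (ν≤p , ss) → semistandard-extend ν ν-partition p p≤ν T T₀ T-init T-last ν≤p ss) ⟩
            𝟙 (interlaces? ×-dec semistandard? p T₀)
              ≈⟨ 𝟙-× interlaces? (semistandard? p T₀) ⟩
            𝟙 interlaces? * 𝟙 (semistandard? p T₀)
              ≈⟨ *-congʳ (∏-𝟙 λ i → ν (suc i) ℕ.≤? p i) ⟨
            (∏ λ i → 𝟙 (ν (suc i) ℕ.≤? p i)) * 𝟙 (semistandard? p T₀) ∎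

          row : ∀ i → (∏ λ j → x (T (inject₁ i) j) (r +ᶻ + toℕ (inject₁ i) -ᶻ toℕ j)) ≈
                      (∏ λ j → x (inject₁ (T₀ i j)) (r +ᶻ + toℕ i -ᶻ toℕ j)) * strip i
          row i = trans (∏-cong λ j → reflexive (≡.cong₂ (λ a k → x a (r +ᶻ + k -ᶻ toℕ j)) (T-init i j) (toℕ-inject₁ i)))
            (∏-pad (ν (inject₁ i)) (p i) (T₀ i) (λ a t → x a (r +ᶻ + toℕ i -ᶻ t)) (p≤ν i))

        weight-pad : g T ≈ (lastRowWeight x r ν * (∏ λ i → stripWeight x r ν i (p i))) * weight (x ∘ inject₁) r p T₀
        weight-pad = begin
          g T
            ≈⟨ *-cong indicator (trans (∏-init-last _) (*-cong (trans (∏-cong row) ∏-distrib-*)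
                 (∏-cong λ j → reflexive (≡.cong₂ (λ a k → x a (r +ᶻ + k -ᶻ toℕ j)) (T-last j) (toℕ-fromℕ m))))) ⟩
          ((∏ λ i → 𝟙 (ν (suc i) ℕ.≤? p i)) * 𝟙 (semistandard? p T₀)) * (((∏ λ i → ∏ λ j → x (inject₁ (T₀ i j)) (r +ᶻ + toℕ i -ᶻ toℕ j)) * ∏ strip) * lastRowWeight x r ν)
            ≈⟨ solve 5 (λ a b u v w → (a :* b) :* ((u :* v) :* w) := (w :* (a :* v)) :* (b :* u)) refl _ _ _ _ _ ⟩
          (lastRowWeight x r ν * ((∏ λ i → 𝟙 (ν (suc i) ℕ.≤? p i)) * ∏ strip)) * weight (x ∘ inject₁) r p T₀
            ≈⟨ *-congʳ (*-congˡ ∏-distrib-*) ⟨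
          (lastRowWeight x r ν * (∏ λ i → stripWeight x r ν i (p i))) * weight (x ∘ inject₁) r p T₀ ∎

    -- The shapes and weights are literally those of `b-branching`; only the factor `∏ (κ x)` is
    -- special to the determinants.
    loopSchur-branching : loopSchur x ν r ≈ lastRowWeight x r ν *
      (∑ (choices λ i → upTo (suc (ν (inject₁ i)))) λ p → (∏ λ i → stripWeight x r ν i (p i)) * loopSchur (x ∘ inject₁) p r)
    loopSchur-branching = begin
      loopSchur x ν r
        ≈⟨ loopSchur-∑ x ν r ⟩
      ∑ (arrays (suc m) ν) g
        ≈⟨ ∑-choices-snoc (λ i → words (ν i) (suc m)) (Extensional₂⇒Extensional {ν = ν} (weight-ext x r ν)) ⟩
      (∑ (arrays (suc m) (ν ∘ inject₁)) λ T → ∑ (words (ν (fromℕ m)) (suc m)) λ w → g (T ▷ w))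
        ≈⟨ ∑-cong (arrays (suc m) (ν ∘ inject₁)) last-row ⟩
      (∑ (arrays (suc m) (ν ∘ inject₁)) λ T → g (T ▷ top-row))
        ≈⟨ ∑-arrays-pad (ν ∘ inject₁) (λ e → weight-ext x r ν (▷-cong e λ _ → ≡.refl))
             (λ T i ¬mono → weight-vanishes x r ν (T ▷ top-row) λ ss → ¬mono λ t t′ t≤t′ →
               ≡.subst₂ Fin._≤_ (▷-init T top-row i t) (▷-init T top-row i t′) (row-monotone (T ▷ top-row) ss (inject₁ i) t t′ t≤t′)) ⟩
      (∑ shapes λ p → ∑-rows p λ ρ → g (padRows (ν ∘ inject₁) ρ ▷ top-row))
        ≈⟨ ∑-cong-All (choices-All (λ i → upTo (suc (ν (inject₁ i)))) λ i → All.all-upTo (suc (ν (inject₁ i))))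
             (λ p p<1+ν → begin
               (∑-rows p λ ρ → g (padRows (ν ∘ inject₁) ρ ▷ top-row))
                 ≈⟨ ∑-cong (arrays m p) (weight-pad p λ i → ℕ.s≤s⁻¹ (p<1+ν i)) ⟩
               (∑ (arrays m p) λ T₀ → (lastRowWeight x r ν * (∏ λ i → stripWeight x r ν i (p i))) * weight (x ∘ inject₁) r p T₀)
                 ≈⟨ *-distribˡ-∑ _ (arrays m p) _ ⟨
               (lastRowWeight x r ν * (∏ λ i → stripWeight x r ν i (p i))) * ∑ (arrays m p) (weight (x ∘ inject₁) r p)
                 ≈⟨ trans (*-assoc _ _ _) (*-congˡ (*-congˡ (sym (loopSchur-∑ (x ∘ inject₁) p r)))) ⟩
               lastRowWeight x r ν * ((∏ λ i → stripWeight x r ν i (p i)) * loopSchur (x ∘ inject₁) p r) ∎) ⟩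
      (∑ shapes λ p → lastRowWeight x r ν * ((∏ λ i → stripWeight x r ν i (p i)) * loopSchur (x ∘ inject₁) p r))
        ≈⟨ *-distribˡ-∑ _ shapes _ ⟨
      lastRowWeight x r ν * (∑ shapes λ p → (∏ λ i → stripWeight x r ν i (p i)) * loopSchur (x ∘ inject₁) p r) ∎
      where
      shapes : List (Fin m → ℕ)
      shapes = choices λ i → upTo (suc (ν (inject₁ i)))

-- The bialternant identity over a commutative ring.

-- For i < j the chain is p_j ≤ ν_j ≤ ν_{i+1} ≤ p_i.
interlacing-partition : ∀ {m} (ν : Vector ℕ (suc m)) → IsPartition ν → (p : Vector ℕ m) →
  (∀ i → p i ℕ.≤ ν (inject₁ i)) → (∀ i → ν (suc i) ℕ.≤ p i) → IsPartition p
interlacing-partition ν ν-partition p p≤ν ν≤p i j i≤j with ℕ.m≤n⇒m<n∨m≡n i≤j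
... | inj₁ i<j = ℕ.≤-trans (p≤ν j) (ℕ.≤-trans (ν-partition (suc i) (inject₁ j) (≡.subst (suc (toℕ i) ℕ.≤_) (≡.sym (toℕ-inject₁ j)) i<j)) (ν≤p i))
... | inj₂ i≡j = ℕ.≤-reflexive (≡.cong p (≡.sym (toℕ-injective i≡j)))

module Products {c ℓ} (R : CommutativeRing c ℓ) where
  open CommutativeRing R hiding (zero)
  open Sums R

  product : ∀ {A : Set} → List A → (A → Carrier) → Carrier
  product L f = foldr (λ a s → f a * s) 1# L

  -- The multiplicative counterpart of `𝟙`: excluded factors become 1, so a product over i < j can
  -- run over the full square.
  guard : ∀ {P : Set} → Dec P → Carrier → Carrier
  guard P? a = if does P? then a else 1#

  guard-yes : ∀ {P : Set} (P? : Dec P) → P → ∀ a → guard P? a ≈ a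
  guard-yes (yes _) p a = refl
  guard-yes (no ¬p) p a = contradiction p ¬p

  guard-no : ∀ {P : Set} (P? : Dec P) → ¬ P → ∀ a → guard P? a ≈ 1#
  guard-no (yes p) ¬p a = contradiction p ¬p
  guard-no (no _)  ¬p a = refl

  guard-cong : ∀ {P Q : Set} (P? : Dec P) (Q? : Dec Q) → (P → Q) → (Q → P) → ∀ a → guard P? a ≈ guard Q? a
  guard-cong (yes p) Q? f g a = sym (guard-yes Q? (f p) a)
  guard-cong (no ¬p) Q? f g a = sym (guard-no Q? (¬p ∘ g) a)

  product-++ : ∀ {A : Set} L M (f : A → Carrier) → product (L ++ M) f ≈ product L f * product M f
  product-++ []      M f = sym (*-identityˡ _)
  product-++ (a ∷ L) M f = trans (*-congˡ (product-++ L M f)) (sym (*-assoc _ _ _))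

  product-map : ∀ {A B : Set} (h : A → B) L (f : B → Carrier) → product (map h L) f ≈ product L (f ∘ h)
  product-map h []      f = refl
  product-map h (a ∷ L) f = *-congˡ (product-map h L f)

  product-filter : ∀ {A : Set} {P : A → Set} (P? : Decidable₁ P) L (f : A → Carrier) →
                   product (filter P? L) f ≈ product L λ a → guard (P? a) (f a)
  product-filter P? []      f = refl
  product-filter P? (a ∷ L) f with does (P? a)
  ... | true  = *-congˡ (product-filter P? L f)
  ... | false = trans (product-filter P? L f) (sym (*-identityˡ _))

  product-cartesianProduct : ∀ {A B : Set} L M (f : A × B → Carrier) →
                             product (cartesianProduct L M) f ≈ product L λ a → product M λ b → f (a , b)
  product-cartesianProduct []      M f = refl
  product-cartesianProduct (a ∷ L) M f = trans (product-++ (map (a ,_) M) _ f)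
    (*-cong (product-map (a ,_) M f) (product-cartesianProduct L M f))

  product-tabulate : ∀ {A : Set} {k} (g : Fin k → A) (f : A → Carrier) → product (tabulate g) f ≈ ∏ (f ∘ g)
  product-tabulate {k = zero}  g f = sym (∏-one λ ())
  product-tabulate {k = suc k} g f = trans (*-congˡ (product-tabulate (g ∘ suc) f)) (sym (∏-suc _))

module Main {c ℓ} (R : CommutativeRing c ℓ) (N : ℕ) where
  open CommutativeRing R hiding (zero)
  open Sums R
  open Products R
  open Rows R
  open Sigma R N
  open Bialternants R N
  open LoopSchur R N
  open SemiringSolver commutativeSemiring using (solve; _:+_; _:*_; _:=_)
  open SetoidReasoning setoid

  vandermonde : ∀ {m} → Variables m → Carrier
  vandermonde {m} x = LoopFunctions.∏[πᵢ-πⱼ] R {m} {n} x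

  private
    factor : ∀ {m} → Variables m → Fin m → Fin m → Carrier
    factor x i j = guard (i <? j) (π x i - π x j)

  vandermonde-∏ : ∀ {m} (x : Variables m) → vandermonde x ≈ ∏ λ i → ∏ λ j → factor x i j
  vandermonde-∏ {m} x = begin
    vandermonde x                                                   ≈⟨ product-filter (λ (i , j) → i <? j) (cartesianProduct (allFin m) (allFin m)) _ ⟩
    product (cartesianProduct (allFin m) (allFin m)) _              ≈⟨ product-cartesianProduct (allFin m) (allFin m) _ ⟩
    (product (allFin m) λ i → product (allFin m) λ j → factor x i j) ≈⟨ product-tabulate id _ ⟩
    (∏ λ i → product (allFin m) λ j → factor x i j)                 ≈⟨ ∏-cong (λ i → product-tabulate id _) ⟩
    (∏ λ i → ∏ λ j → factor x i j)                                  ∎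

  -- The pairs ending in the last index supply the factors of `κ`, and no pair begins with it.
  vandermonde-suc : ∀ {m} (x : Variables (suc m)) → vandermonde x ≈ vandermonde (x ∘ inject₁) * ∏ (κ x)
  vandermonde-suc {m} x = begin
    vandermonde x
      ≈⟨ trans (vandermonde-∏ x) (∏-init-last _) ⟩
    (∏ λ i → ∏ λ j → factor x (inject₁ i) j) * (∏ λ j → factor x (fromℕ m) j)
      ≈⟨ *-cong (∏-cong λ i → trans (∏-init-last _) (*-cong
             (∏-cong λ j → guard-cong (inject₁ i <? inject₁ j) (i <? j)
               (≡.subst₂ ℕ._<_ (toℕ-inject₁ i) (toℕ-inject₁ j)) (≡.subst₂ ℕ._<_ (≡.sym (toℕ-inject₁ i)) (≡.sym (toℕ-inject₁ j))) _)
             (guard-yes (inject₁ i <? fromℕ m) (inject₁-<-fromℕ i) _)))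
           (∏-one λ j → guard-no (fromℕ m <? j) (ℕ.≤⇒≯ (≤fromℕ j)) _) ⟩
    (∏ λ i → (∏ λ j → factor (x ∘ inject₁) i j) * κ x i) * 1#
      ≈⟨ trans (*-identityʳ _) ∏-distrib-* ⟩
    (∏ λ i → ∏ λ j → factor (x ∘ inject₁) i j) * ∏ (κ x)
      ≈⟨ *-congʳ (vandermonde-∏ (x ∘ inject₁)) ⟨
    vandermonde (x ∘ inject₁) * ∏ (κ x) ∎

  bialternant-formula : ∀ {m} (x : Variables m) ν → IsPartition ν → ∀ r → b x (zipWith ℕ._+_ ν δ) r ≈ loopSchur x ν r * vandermonde x
  bialternant-formula {zero} x ν ν-partition r = sym (begin
    loopSchur x ν r * vandermonde x ≈⟨ *-identityʳ _ ⟩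
    loopSchur x ν r                 ≈⟨ loopSchur-∑ x ν r ⟩
    weight x r ν (λ ()) + 0#        ≈⟨ +-identityʳ _ ⟩
    weight x r ν (λ ())             ≈⟨ *-cong (𝟙-yes (semistandard? ν λ ()) ((λ ()) , (λ ()))) (∏-one λ ()) ⟩
    1# * 1#                         ≈⟨ *-identityˡ 1# ⟩
    1#                              ∎)
  bialternant-formula {suc m} x ν ν-partition r = begin
    b x (zipWith ℕ._+_ ν δ) r
      ≈⟨ b-branching x r ν ν-partition ⟩
    (∏ (κ x) * lastRowWeight x r ν) * (∑ shapes λ p → strip p * b (x ∘ inject₁) (zipWith ℕ._+_ p δ) r)
      ≈⟨ *-congˡ (∑-cong-All (choices-All (λ i → upTo (suc (ν (inject₁ i)))) λ i → All.all-upTo (suc (ν (inject₁ i)))) step) ⟩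
    (∏ (κ x) * lastRowWeight x r ν) * (∑ shapes λ p → (strip p * loopSchur (x ∘ inject₁) p r) * vandermonde (x ∘ inject₁))
      ≈⟨ *-congˡ (*-distribʳ-∑ _ shapes _) ⟨
    (∏ (κ x) * lastRowWeight x r ν) * ((∑ shapes λ p → strip p * loopSchur (x ∘ inject₁) p r) * vandermonde (x ∘ inject₁))
      ≈⟨ solve 4 (λ k l s v → (k :* l) :* (s :* v) := (l :* s) :* (v :* k)) refl _ _ _ _ ⟩
    (lastRowWeight x r ν * (∑ shapes λ p → strip p * loopSchur (x ∘ inject₁) p r)) * (vandermonde (x ∘ inject₁) * ∏ (κ x))
      ≈⟨ *-cong (loopSchur-branching x r ν ν-partition) (vandermonde-suc x) ⟨
    loopSchur x ν r * vandermonde x ∎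
    where
    shapes : List (Fin m → ℕ)
    shapes = choices λ i → upTo (suc (ν (inject₁ i)))
    strip : (Fin m → ℕ) → Carrier
    strip p = ∏ λ i → stripWeight x r ν i (p i)
    step : ∀ p → (∀ i → p i ℕ.< suc (ν (inject₁ i))) →
      strip p * b (x ∘ inject₁) (zipWith ℕ._+_ p δ) r ≈ (strip p * loopSchur (x ∘ inject₁) p r) * vandermonde (x ∘ inject₁)
    step p p<1+ν with all? (λ i → ν (suc i) ℕ.≤? p i)
    ... | yes ν≤p = trans (*-congˡ (bialternant-formula (x ∘ inject₁) p
          (interlacing-partition ν ν-partition p (λ i → ℕ.s≤s⁻¹ (p<1+ν i)) ν≤p) r)) (sym (*-assoc _ _ _))
    ... | no  ν≰p = trans (trans (*-congʳ vanish) (zeroˡ _)) (sym (trans (*-congʳ (trans (*-congʳ vanish) (zeroˡ _))) (zeroˡ _)))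
      where
      vanish : strip p ≈ 0#
      vanish = begin
        strip p                                             ≈⟨ ∏-distrib-* ⟩
        (∏ λ i → 𝟙 (ν (suc i) ℕ.≤? p i)) * _               ≈⟨ *-congʳ (∏-𝟙 λ i → ν (suc i) ℕ.≤? p i) ⟩
        𝟙 (all? λ i → ν (suc i) ℕ.≤? p i) * _              ≈⟨ *-congʳ (𝟙-no (all? λ i → ν (suc i) ℕ.≤? p i) ν≰p) ⟩
        0# * _                                              ≈⟨ zeroˡ _ ⟩
        0#                                                  ∎

  loopSchur-empty : ∀ {m} (x : Variables m) r → loopSchur x (λ _ → 0) r ≈ 1#
  loopSchur-empty {m} x r = trans (loopSchur-∑ x (λ _ → 0) r) (trans (∑-cong (arrays m λ _ → 0) λ T → trans
      (*-cong (𝟙-yes (semistandard? (λ _ → 0) T) ((λ _ ()) , (λ _ _ ()))) (∏-one λ i → ∏-one λ ())) (*-identityˡ 1#))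
    (one-array m))
    where
    one-array : ∀ k → (∑ (arrays {k} m λ _ → 0) λ _ → 1#) ≈ 1#
    one-array zero    = +-identityʳ 1#
    one-array (suc k) = trans (∑-choices {A = λ (_ : Fin (suc k)) → Fin 0 → Fin m} (λ _ → words 0 m) λ _ → refl) (trans (+-identityʳ _) (one-array k))

  b-δ : ∀ {m} (x : Variables m) r → b x δ r ≈ vandermonde x
  b-δ x r = trans (bialternant-formula x (λ _ → 0) (λ _ _ _ → z≤n) r) (trans (*-congʳ (loopSchur-empty x r)) (*-identityˡ _))

-- Evaluation of polynomials at rational points.

-- A homomorphism to ℚ, packaged so that it lifts through each of the nested univariate rings that
-- make up `ℚ[ N ]`.
record Evaluation (D : DiscreteDomain) : Set where
  open DiscreteDomain D using (Carrier; _≈_; 0#; 1#) renaming (_+_ to _⊕_; _*_ to _⊗_)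
  field
    ⟦_⟧    : Carrier → ℚ
    ⟦⟧-cong : ∀ {a b} → a ≈ b → ⟦ a ⟧ ≡ ⟦ b ⟧
    0-homo : ⟦ 0# ⟧ ≡ ℚ.0ℚ
    1-homo : ⟦ 1# ⟧ ≡ ℚ.1ℚ
    +-homo : ∀ a b → ⟦ a ⊕ b ⟧ ≡ ⟦ a ⟧ ℚ.+ ⟦ b ⟧
    *-homo : ∀ a b → ⟦ a ⊗ b ⟧ ≡ ⟦ a ⟧ ℚ.* ⟦ b ⟧

module _ {D : DiscreteDomain} (E : Evaluation D) (point : ℚ) where
  private module D = DiscreteDomain D
  open Evaluation E
  open Polynomial D
  open SemiringSolver (CommutativeRing.commutativeSemiring ℚ.+-*-commutativeRing) using (solve; _:+_; _:*_; _:=_)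
  open ≡.≡-Reasoning
  private
    eval : Poly → ℚ
    eval []      = ℚ.0ℚ
    eval (a ∷ p) = ⟦ a ⟧ ℚ.+ point ℚ.* eval p

    vanish : ∀ {a p} → ⟦ a ⟧ ≡ ℚ.0ℚ → eval p ≡ ℚ.0ℚ → eval (a ∷ p) ≡ ℚ.0ℚ
    vanish {a} {p} e f rewrite e | f = ≡.trans (ℚ.+-identityˡ _) (ℚ.*-zeroʳ point)

    -- Lists of different lengths may represent the same polynomial, so compatibility with `_≋_`
    -- must deal with trailing zeros.
    eval-zero : ∀ p → p ≋ [] → eval p ≡ ℚ.0ℚ
    eval-zero []      e = ≡.refl
    eval-zero (a ∷ p) e = vanish {a} {p} (≡.trans (⟦⟧-cong (at e 0)) 0-homo) (eval-zero p (coeffwise λ k → at e (suc k)))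

    eval-cong : ∀ p q → p ≋ q → eval p ≡ eval q
    eval-cong []      q       e = ≡.sym (eval-zero q (coeffwise λ k → D.sym (at e k)))
    eval-cong (a ∷ p) []      e = eval-zero (a ∷ p) e
    eval-cong (a ∷ p) (b ∷ q) e = ≡.cong₂ (λ u v → u ℚ.+ point ℚ.* v) (⟦⟧-cong (at e 0)) (eval-cong p q (coeffwise λ k → at e (suc k)))

    eval-⊕ : ∀ p q → eval (p ⊕ q) ≡ eval p ℚ.+ eval q
    eval-⊕ []      q       = ≡.sym (ℚ.+-identityˡ _)
    eval-⊕ (a ∷ p) []      = ≡.sym (ℚ.+-identityʳ _)
    eval-⊕ (a ∷ p) (b ∷ q) = ≡.trans (≡.cong₂ (λ u v → u ℚ.+ point ℚ.* v) (+-homo a b) (eval-⊕ p q))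
      (solve 5 (λ a b x p q → a :+ b :+ x :* (p :+ q) := (a :+ x :* p) :+ (b :+ x :* q)) ≡.refl ⟦ a ⟧ ⟦ b ⟧ point (eval p) (eval q))

    eval-⊙ : ∀ a p → eval (a ⊙ p) ≡ ⟦ a ⟧ ℚ.* eval p
    eval-⊙ a []      = ≡.sym (ℚ.*-zeroʳ ⟦ a ⟧)
    eval-⊙ a (b ∷ p) = ≡.trans (≡.cong₂ (λ u v → u ℚ.+ point ℚ.* v) (*-homo a b) (eval-⊙ a p))
      (solve 4 (λ a b x p → a :* b :+ x :* (a :* p) := a :* (b :+ x :* p)) ≡.refl ⟦ a ⟧ ⟦ b ⟧ point (eval p))

    eval-⊗ : ∀ p q → eval (p ⊗ q) ≡ eval p ℚ.* eval q
    eval-⊗ []      q = ≡.sym (ℚ.*-zeroˡ (eval q))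
    eval-⊗ (a ∷ p) q = begin
      eval ((a ⊙ q) ⊕ (D.0# ∷ (p ⊗ q)))
        ≡⟨ eval-⊕ (a ⊙ q) (D.0# ∷ (p ⊗ q)) ⟩
      eval (a ⊙ q) ℚ.+ (⟦ D.0# ⟧ ℚ.+ point ℚ.* eval (p ⊗ q))
        ≡⟨ ≡.cong₂ ℚ._+_ (eval-⊙ a q) (≡.trans (≡.cong₂ (λ u v → u ℚ.+ point ℚ.* v) 0-homo (eval-⊗ p q)) (ℚ.+-identityˡ _)) ⟩
      ⟦ a ⟧ ℚ.* eval q ℚ.+ point ℚ.* (eval p ℚ.* eval q)
        ≡⟨ solve 4 (λ a x p q → a :* q :+ x :* (p :* q) := (a :+ x :* p) :* q) ≡.refl ⟦ a ⟧ point (eval p) (eval q) ⟩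
      (⟦ a ⟧ ℚ.+ point ℚ.* eval p) ℚ.* eval q ∎

  evaluatePoly : Evaluation domain
  evaluatePoly = record
    { ⟦_⟧     = eval
    ; ⟦⟧-cong = λ {p} {q} → eval-cong p q
    ; 0-homo  = ≡.refl
    ; 1-homo  = constant D.1# 1-homo
    ; +-homo  = eval-⊕
    ; *-homo  = eval-⊗ }
    where
    constant : ∀ a {c} → ⟦ a ⟧ ≡ c → eval (a ∷ []) ≡ c
    constant a e = ≡.trans (≡.cong₂ ℚ._+_ e (ℚ.*-zeroʳ point)) (ℚ.+-identityʳ _)

evaluate : ∀ {N} → (Fin N → ℚ) → Evaluation ℚ[ N ]
evaluate {zero}  v = record
  { ⟦_⟧ = id ; ⟦⟧-cong = id ; 0-homo = ≡.refl ; 1-homo = ≡.refl ; +-homo = λ _ _ → ≡.refl ; *-homo = λ _ _ → ≡.refl }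
evaluate {suc N} v = evaluatePoly (evaluate (v ∘ suc)) (v zero)

evaluate-var : ∀ {N} (v : Fin N → ℚ) i → Evaluation.⟦_⟧ (evaluate v) (var i) ≡ v i
evaluate-var {suc N} v zero = begin
  ⟦ D.0# ⟧ ℚ.+ v zero ℚ.* (⟦ D.1# ⟧ ℚ.+ v zero ℚ.* ℚ.0ℚ) ≡⟨ ≡.cong₂ (λ a b → a ℚ.+ v zero ℚ.* (b ℚ.+ v zero ℚ.* ℚ.0ℚ)) 0-homo 1-homo ⟩
  ℚ.0ℚ ℚ.+ v zero ℚ.* (ℚ.1ℚ ℚ.+ v zero ℚ.* ℚ.0ℚ)         ≡⟨ ℚ.+-identityˡ _ ⟩
  v zero ℚ.* (ℚ.1ℚ ℚ.+ v zero ℚ.* ℚ.0ℚ)                  ≡⟨ ≡.cong (λ a → v zero ℚ.* (ℚ.1ℚ ℚ.+ a)) (ℚ.*-zeroʳ (v zero)) ⟩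
  v zero ℚ.* (ℚ.1ℚ ℚ.+ ℚ.0ℚ)                             ≡⟨ ℚ.*-identityʳ (v zero) ⟩
  v zero                                                  ∎
  where
  open ≡.≡-Reasoning
  open Evaluation (evaluate (v ∘ suc))
  module D = DiscreteDomain ℚ[ N ]
evaluate-var {suc N} v (suc i) = ≡.trans (≡.cong₂ ℚ._+_ (evaluate-var (v ∘ suc) i) (ℚ.*-zeroʳ (v zero))) (ℚ.+-identityʳ _)

-- Fractions and the nonvanishing of the denominators.

module Fractions (D : DiscreteDomain) where
  open FieldOfFractions D
  open CommutativeRing commutativeRing hiding (zero)
  private module D = DiscreteDomain D

  ι-injective : ∀ {a b} → ι a ≃ ι b → a D.≈ b
  ι-injective (cross e) = D.trans (D.sym (D.*-identityʳ _)) (D.trans e (D.*-identityʳ _))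

  ι-* : ∀ a b → ι a * ι b ≃ ι (a D.* b)
  ι-* a b = cross (D.*-congˡ (D.sym (D.*-identityʳ D.1#)))

  inv-inverseʳ : ∀ u (u≄0 : ¬ u ≃ 0ᶠ) → u * inv u u≄0 ≃ 1ᶠ
  inv-inverseʳ (fraction a b _) _ = cross (D.trans (D.*-comm _ _) (D.*-congˡ (D.*-comm a b)))

  divide : ∀ {u v} s (v≄0 : ¬ v ≃ 0ᶠ) → u ≃ s * v → s ≃ u / v [ v≄0 ]
  divide {u} {v} s v≄0 e = sym (trans (*-congʳ {inv v v≄0} e) (trans (*-assoc s v (inv v v≄0))
    (trans (*-congˡ {s} (inv-inverseʳ v v≄0)) (*-identityʳ s))))

  *-nonzero : ∀ {u v} → ¬ u ≃ 0ᶠ → ¬ v ≃ 0ᶠ → ¬ u * v ≃ 0ᶠ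
  *-nonzero {u} {v} u≄0 v≄0 e = u≄0 (trans (divide u v≄0 (refl {u * v})) (trans (*-congʳ {inv v v≄0} e) (zeroˡ (inv v v≄0))))

  product-nonzero : ∀ {A : Set} {L : List A} {f : A → Fraction} → All (λ a → ¬ f a ≃ 0ᶠ) L → ¬ foldr (λ a s → f a * s) 1ᶠ L ≃ 0ᶠ
  product-nonzero []           (cross e) = D.1≉0 (D.trans (D.sym (D.*-identityʳ D.1#)) (D.trans e (D.zeroˡ D.1#)))
  product-nonzero {f = f} (_∷_ {a} {L} f≄0 fs≄0) = *-nonzero {f a} f≄0 (product-nonzero fs≄0)

module Nonvanishing (m N : ℕ) where
  open RationalFunctions m (suc N)
  open Fractions ℚ[ m ℕ.* suc N ]
  open LoopFunctions commutativeRing {m} {suc N} indeterminate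
  private
    module D = DiscreteDomain ℚ[ m ℕ.* suc N ]
    module K = CommutativeRing commutativeRing
    module ∏D = FiniteSum D.*-commutativeMonoid
    module ∏K = FiniteSum K.*-commutativeMonoid
    module ∏ℚ = FiniteSum (CommutativeRing.*-commutativeMonoid ℚ.+-*-commutativeRing)

    -- Evaluation is defined on polynomials only, so `π i`, a product of fractions, is first
    -- recognised as the image of a monomial.
    ∏-ι : ∀ {k} (f : Fin k → D.Carrier) → ∏K.sum (ι ∘ f) ≃ ι (∏D.sum f)
    ∏-ι {zero}  f = K.refl {1ᶠ}
    ∏-ι {suc k} f = K.trans (K.*-congˡ {ι (f zero)} (∏-ι (f ∘ suc))) (ι-* (f zero) (∏D.sum (f ∘ suc)))

    indicator : Fin m → Fin m → ℚ
    indicator i j = if does (j ≟ i) then ℚ.1ℚ else ℚ.0ℚ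

    -- The point where the variables x_i are 1 and all others are 0.
    point : Fin m → Fin (m ℕ.* suc N) → ℚ
    point i = indicator i ∘ proj₁ ∘ remQuot {m} (suc N)

    point-combine : ∀ i j k → point i (combine j k) ≡ indicator i j
    point-combine i j k = ≡.cong (indicator i ∘ proj₁) (remQuot-combine {m} {suc N} j k)

    indicator-≡ : ∀ i → indicator i i ≡ ℚ.1ℚ
    indicator-≡ i with i ≟ i
    ... | yes _  = ≡.refl
    ... | no i≢i = contradiction ≡.refl i≢i

    indicator-≢ : ∀ {i j} → j ≢ i → indicator i j ≡ ℚ.0ℚ
    indicator-≢ {i} {j} j≢i with j ≟ i
    ... | yes j≡i = contradiction j≡i j≢i
    ... | no _    = ≡.refl

    monomial : Fin m → D.Carrier
    monomial i = ∏D.sum λ k → var (combine i k)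

    module _ (v : Fin (m ℕ.* suc N) → ℚ) where
      open Evaluation (evaluate v)

      ∏-homo : ∀ {k} (f : Fin k → D.Carrier) → ⟦ ∏D.sum f ⟧ ≡ ∏ℚ.sum (⟦_⟧ ∘ f)
      ∏-homo {zero}  f = 1-homo
      ∏-homo {suc k} f = ≡.trans (*-homo (f zero) (∏D.sum (f ∘ suc))) (≡.cong (⟦ f zero ⟧ ℚ.*_) (∏-homo (f ∘ suc)))

      evaluate-monomial : ∀ j → ⟦ monomial j ⟧ ≡ ∏ℚ.sum λ k → v (combine j k)
      evaluate-monomial j = ≡.trans (∏-homo λ k → var (combine j k)) (∏ℚ.sum-cong-≗ {suc N} λ k → evaluate-var v (combine j k))

    monomial-distinct : ∀ {i j} → j ≢ i → ¬ monomial i D.≈ monomial j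
    monomial-distinct {i} {j} j≢i e with ≡.trans (≡.sym one) (≡.trans (⟦⟧-cong e) zer)
      where
      open Evaluation (evaluate (point i))
      ones : ∀ k → ∏ℚ.sum {k} (λ _ → ℚ.1ℚ) ≡ ℚ.1ℚ
      ones zero    = ≡.refl
      ones (suc k) = ≡.trans (ℚ.*-identityˡ _) (ones k)
      one : ⟦ monomial i ⟧ ≡ ℚ.1ℚ
      one = ≡.trans (evaluate-monomial (point i) i) (≡.trans (∏ℚ.sum-cong-≗ {suc N} λ k → ≡.trans (point-combine i i k) (indicator-≡ i)) (ones (suc N)))
      zer : ⟦ monomial j ⟧ ≡ ℚ.0ℚ
      -- As n = `suc N` is positive, the monomial has a first factor, and that factor already
      -- vanishes at this point.
      zer = ≡.trans (evaluate-monomial (point i) j) (≡.trans (≡.cong (ℚ._* rest) (≡.trans (point-combine i j zero) (indicator-≢ j≢i))) (ℚ.*-zeroˡ rest))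
        where rest = ∏ℚ.sum λ (k : Fin N) → point i (combine j (suc k))
    ... | ()

  π-distinct : ∀ {i j} → j ≢ i → ¬ π i K.- π j ≃ 0ᶠ
  π-distinct {i} {j} j≢i e = monomial-distinct j≢i (ι-injective (K.trans (K.sym (∏-ι λ k → var (combine i k)))
    (K.trans (GroupProperties.x∙y⁻¹≈ε⇒x≈y K.+-group (π i) (π j) e) (∏-ι λ k → var (combine j k)))))

  ∏[πᵢ-πⱼ]-nonzero : ¬ ∏[πᵢ-πⱼ] ≃ 0ᶠ
  ∏[πᵢ-πⱼ]-nonzero = product-nonzero {f = λ (i , j) → π i K.- π j}
    (All.map (λ {(i , j)} i<j → π-distinct {i} {j} (<⇒≢ i<j ∘ ≡.sym)) (All.all-filter (λ (i , j) → i <? j) (cartesianProduct (allFin m) (allFin m))))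

open import Data.Nat using (_+_)

theorem3p3 : (m n : ℕ) .{{_ : NonZero m}} .{{_ : NonZero n}} (r : Fin n) (ν : Vector ℕ m) → IsPartition ν →
    let open RationalFunctions m n
        open LoopFunctions commutativeRing indeterminate
        ν+δ = zipWith _+_ ν δ
    in Σ[ bδ≄0 ∈ ¬ b δ r ≃ 0ᶠ ]
       Σ[ ∏≄0 ∈ ¬ ∏[πᵢ-πⱼ] ≃ 0ᶠ ]
         (loopSchur ν r ≃ b ν+δ r / b δ r [ bδ≄0 ]) ×
         (b ν+δ r / b δ r [ bδ≄0 ] ≃ b ν+δ r / ∏[πᵢ-πⱼ] [ ∏≄0 ])
-- Both quotients come from the division-free `formula` and meet in `s`. By `b-δ` the two
-- denominators are equal, so `bδ≄0` follows from `∏≄0`.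
theorem3p3 m (suc N) r ν ν-partition = bδ≄0 , ∏≄0 , quotient , trans (sym quotient) (divide s ∏≄0 formula)
  where
  open RationalFunctions m (suc N)
  open LoopFunctions commutativeRing {m} {suc N} indeterminate
  open CommutativeRing commutativeRing using (sym; trans; *-congˡ) renaming (_*_ to _⊛_)
  open Main commutativeRing N using (bialternant-formula; b-δ)
  open Fractions ℚ[ m ℕ.* suc N ] using (divide)
  s = loopSchur ν r
  ∏≄0 : ¬ ∏[πᵢ-πⱼ] ≃ 0ᶠ
  ∏≄0 = Nonvanishing.∏[πᵢ-πⱼ]-nonzero m N
  bδ≄0 : ¬ b δ r ≃ 0ᶠ
  bδ≄0 e = ∏≄0 (trans (sym (b-δ indeterminate r)) e)
  formula : b (zipWith _+_ ν δ) r ≃ s ⊛ ∏[πᵢ-πⱼ]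
  formula = bialternant-formula indeterminate ν ν-partition r
  quotient : s ≃ b (zipWith _+_ ν δ) r / b δ r [ bδ≄0 ]
  quotient = divide s bδ≄0 (trans formula (*-congˡ {s} (sym (b-δ indeterminate r))))
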